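{- Let $d\ge 1$ and let $\mathcal{B}_d$ be the set of all boxes $\prod_{i=1}^d[a_i,b_i]\subseteq\mathbb{R}^d$ with $a_i\le b_i$ integers. The $\mathbb{C}$-algebra homomorphism $\phi:\mathbb{C}[x_1^{\pm1},\dots,x_d^{\pm1},y_1^{\pm1},\dots,y_d^{\pm1}]\to M(\mathcal{B}_d)$ given by $\phi(x_i)=[\{\tilde e_i\}]$ and $\phi(y_i)=[\pi_i([0,1]^d)]$ is surjective with kernel $\ker(\phi)=((y_1-1)(y_1-x_1),\dots,(y_d-1)(y_d-x_d))$, and so $$M(\mathcal{B}_d)\cong \mathbb{C}[x_1^{\pm1},\dots,x_d^{\pm1},y_1^{\pm1},\dots,y_d^{\pm1}]/((y_1-1)(y_1-x_1),\dots,(y_d-1)(y_d-x_d)).$$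
   Context: For $S\subseteq W=\mathbb{R}^d$, $[S]:W\to\mathbb{C}$ denotes its indicator function. Let $M(\mathcal{P}(W))$ be the complex vector space of functions on $W$ spanned by the indicator functions of closed convex polyhedra; it is a commutative $\mathbb{C}$-algebra with the well-defined bilinear product determined by $[A]\cdot[B]=[A+B]$ (Minkowski sum) for nonempty closed convex polyhedra $A,B$, with unit $[\{0\}]$. For a set $\mathcal{D}$ of closed convex polyhedra, the Minkowski ring $M(\mathcal{D})$ is the unital $\mathbb{C}$-subalgebra generated by all $[P]$, $P\in\mathcal{D}$. For a nonempty convex polytope $P$, $[P]$ is invertible in $M(\mathcal{P}(W))$, with $[P]^{ -1}=(-1)^{\dim P}[-\mathring{P}]$, $\mathring P$ the relative interior. $\tilde e_i$ is the $i$-th standard basis vector of $\mathbb{R}^d$ and $\pi_i:\mathbb{R}^d\to\mathbb{R}^d$ is $\tilde x\mapsto x_i\tilde e_i$. -}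

module Defs where

open import Level using (0ℓ)
open import Algebra.Bundles using (AbelianGroup; CommutativeRing; RawRing)
open import Algebra.Construct.DirectProduct using () renaming (abelianGroup to _×-abelianGroup_)
open import Algebra.Core using (Op₂)
import Algebra.Morphism.RingMonomorphism as RingMonomorphism
open import Algebra.Morphism.Structures using (IsRingHomomorphism; IsRingMonomorphism; IsRingIsomorphism)
import Algebra.Properties.Ring as RingProperties
import Algebra.Properties.Semiring.Mult.TCOptimised as Multiples
import Algebra.Solver.Ring as RingSolver
open import Algebra.Solver.Ring.AlmostCommutativeRing using (fromCommutativeRing; _-Raw-AlmostCommutative⟶_)
open import Data.Bool.Base using (if_then_else_)
open import Data.Empty using (⊥-elim)
open import Data.Fin.Base using (Fin)
open import Data.Integer.Base as ℤ using (ℤ; -[1+_]; 0ℤ; 1ℤ)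
import Data.Integer.Properties as ℤ
open import Data.List.Base using (List; []; _∷_; [_]; map; _++_; concatMap; cartesianProduct)
open import Data.List.Membership.Propositional using (find; lose) renaming (_∈_ to _∈ˡ_)
open import Data.List.Membership.Propositional.Properties using (∈-++⁺ˡ; ∈-++⁺ʳ; ∈-concatMap⁺; ∈-cartesianProduct⁺; ∈-cartesianProduct⁻)
open import Data.List.Relation.Binary.Permutation.Propositional using (↭-sym)
open import Data.List.Relation.Binary.Permutation.Propositional.Properties using (∈-resp-↭)
open import Data.List.Relation.Unary.All as All using (All; []; _∷_; all?)
open import Data.List.Relation.Unary.All.Properties using (++⁺; ++⁻ˡ; ++⁻ʳ; concat⁺; concat⁻; map⁺; map⁻)
open import Data.List.Relation.Unary.AllPairs using (AllPairs; []; _∷_)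
open import Data.List.Relation.Unary.Any using (Any; here; there; any?)
open import Data.List.Relation.Unary.Sorted.TotalOrder.Properties using (Sorted⇒AllPairs)
import Data.List.Sort as Sorting
open import Data.Maybe.Base using (Maybe; just; nothing)
open import Data.Nat.Base as ℕ using (ℕ; zero; suc)
import Data.Nat.Properties as ℕ
open import Data.Product.Base using (Σ; _×_; _,_; proj₁; proj₂; ∃; ∃₂)
open import Data.Product.Properties using () renaming (≡-dec to ×-≡-dec)
open import Data.Sum.Base using (_⊎_; inj₁; inj₂; [_,_]′)
open import Data.Unit.Base using (⊤; tt)
open import Data.Vec.Base as Vec using (Vec; []; _∷_; zipWith; replicate; lookup; _[_]≔_)
import Data.Vec.Properties as Vec
open import Data.Vec.Relation.Binary.Pointwise.Inductive as Pointwise using (Pointwise; []; _∷_)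
open import Function.Base using (_∘_; id)
open import Function.Bundles using (_⇔_; mk⇔; Equivalence)
open import Relation.Binary.Bundles using (DecTotalOrder)
open import Relation.Binary.Core using (Rel)
open import Relation.Binary.PropositionalEquality as ≡ using (_≡_)
import Relation.Binary.Reasoning.Setoid as SetoidReasoning
open import Relation.Binary.Structures using (IsDecTotalOrder)
open import Relation.Nullary.Decidable using (Dec; yes; no; does)
open import Relation.Nullary.Negation using (¬_)
open import Relation.Unary using (Pred; _∈_)

module IntegerMultiples (R : CommutativeRing 0ℓ 0ℓ) where
  open CommutativeRing R
  open RingProperties ring using (-0#≈0#; -‿involutive; -‿+-comm; -‿distribˡ-*; -‿distribʳ-*)
  open Multiples semiring using (1+×; ×-homo-+; ×1-homo-*) renaming (_×_ to _⋆_)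
  open SetoidReasoning setoid

  fromℤ : ℤ → Carrier
  fromℤ (ℤ.+ n)    = n ⋆ 1#
  fromℤ (-[1+ n ]) = - (suc n ⋆ 1#)

  private
    cancel : ∀ x y z → (x + y) - (x + z) ≈ y - z
    cancel x y z = begin
      (x + y) - (x + z)     ≈⟨ +-cong (+-comm x y) (sym (-‿+-comm x z)) ⟩
      (y + x) + (- x - z)   ≈⟨ +-assoc y x _ ⟩
      y + (x + (- x - z))   ≈⟨ +-congˡ (+-assoc x (- x) (- z)) ⟨
      y + ((x - x) - z)     ≈⟨ +-congˡ (+-congʳ (-‿inverseʳ x)) ⟩
      y + (0# - z)          ≈⟨ +-congˡ (+-identityˡ _) ⟩
      y - z                 ∎

    ⊖-homo : ∀ m n → fromℤ (m ℤ.⊖ n) ≈ m ⋆ 1# - n ⋆ 1#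
    ⊖-homo zero    zero    = sym (-‿inverseʳ 0#)
    ⊖-homo zero    (suc n) = sym (+-identityˡ _)
    ⊖-homo (suc m) zero    = sym (trans (+-congˡ -0#≈0#) (+-identityʳ _))
    ⊖-homo (suc m) (suc n) = begin
      fromℤ (suc m ℤ.⊖ suc n)           ≡⟨ ≡.cong fromℤ (ℤ.[1+m]⊖[1+n]≡m⊖n m n) ⟩
      fromℤ (m ℤ.⊖ n)                   ≈⟨ ⊖-homo m n ⟩
      m ⋆ 1# - n ⋆ 1#                   ≈⟨ cancel 1# _ _ ⟨
      (1# + m ⋆ 1#) - (1# + n ⋆ 1#)     ≈⟨ +-cong (1+× m 1#) (-‿cong (1+× n 1#)) ⟨
      suc m ⋆ 1# - suc n ⋆ 1#           ∎

  fromℤ-‿homo : ∀ i → fromℤ (ℤ.- i) ≈ - fromℤ i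
  fromℤ-‿homo (ℤ.+ zero)  = sym -0#≈0#
  fromℤ-‿homo (ℤ.+ suc n) = refl
  fromℤ-‿homo (-[1+ n ])  = sym (-‿involutive _)

  fromℤ-+-homo : ∀ i j → fromℤ (i ℤ.+ j) ≈ fromℤ i + fromℤ j
  fromℤ-+-homo (ℤ.+ m)    (ℤ.+ n)    = ×-homo-+ 1# m n
  fromℤ-+-homo (ℤ.+ m)    (-[1+ n ]) = ⊖-homo m (suc n)
  fromℤ-+-homo (-[1+ m ]) (ℤ.+ n)    = trans (⊖-homo n (suc m)) (+-comm _ _)
  fromℤ-+-homo (-[1+ m ]) (-[1+ n ]) = begin
    - (suc (suc (m ℕ.+ n)) ⋆ 1#)       ≡⟨ ≡.cong (λ k → - (suc k ⋆ 1#)) (ℕ.+-suc m n) ⟨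
    - ((suc m ℕ.+ suc n) ⋆ 1#)         ≈⟨ -‿cong (×-homo-+ 1# (suc m) (suc n)) ⟩
    - (suc m ⋆ 1# + suc n ⋆ 1#)        ≈⟨ -‿+-comm _ _ ⟨
    - (suc m ⋆ 1#) - suc n ⋆ 1#        ∎

  private
    ⁺*⁺-homo : ∀ m n → fromℤ (ℤ.+ m ℤ.* ℤ.+ n) ≈ m ⋆ 1# * n ⋆ 1#
    ⁺*⁺-homo m n = trans (reflexive (≡.cong fromℤ (≡.sym (ℤ.pos-* m n)))) (×1-homo-* m n)

    ⁺*-homo : ∀ m j → fromℤ (ℤ.+ m ℤ.* j) ≈ m ⋆ 1# * fromℤ j
    ⁺*-homo m (ℤ.+ n)    = ⁺*⁺-homo m n
    ⁺*-homo m (-[1+ n ]) = begin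
      fromℤ (ℤ.+ m ℤ.* -[1+ n ])           ≡⟨ ≡.cong fromℤ (ℤ.neg-distribʳ-* (ℤ.+ m) (ℤ.+ suc n)) ⟨
      fromℤ (ℤ.- (ℤ.+ m ℤ.* ℤ.+ suc n))    ≈⟨ fromℤ-‿homo (ℤ.+ m ℤ.* ℤ.+ suc n) ⟩
      - fromℤ (ℤ.+ m ℤ.* ℤ.+ suc n)        ≈⟨ -‿cong (⁺*⁺-homo m (suc n)) ⟩
      - (m ⋆ 1# * suc n ⋆ 1#)              ≈⟨ -‿distribʳ-* _ _ ⟩
      m ⋆ 1# * - (suc n ⋆ 1#)              ∎

  fromℤ-*-homo : ∀ i j → fromℤ (i ℤ.* j) ≈ fromℤ i * fromℤ j
  fromℤ-*-homo (ℤ.+ m)    j = ⁺*-homo m j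
  fromℤ-*-homo (-[1+ m ]) j = begin
    fromℤ (-[1+ m ] ℤ.* j)               ≡⟨ ≡.cong fromℤ (ℤ.neg-distribˡ-* (ℤ.+ suc m) j) ⟨
    fromℤ (ℤ.- (ℤ.+ suc m ℤ.* j))        ≈⟨ fromℤ-‿homo (ℤ.+ suc m ℤ.* j) ⟩
    - fromℤ (ℤ.+ suc m ℤ.* j)            ≈⟨ -‿cong (⁺*-homo (suc m) j) ⟩
    - (suc m ⋆ 1# * fromℤ j)             ≈⟨ -‿distribˡ-* _ _ ⟩
    - (suc m ⋆ 1#) * fromℤ j             ∎

  private
    morphism : ℤ.+-*-rawRing -Raw-AlmostCommutative⟶ fromCommutativeRing R
    morphism = record
      { ⟦_⟧ = fromℤ
      ; +-homo = fromℤ-+-homo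
      ; *-homo = fromℤ-*-homo
      ; -‿homo = fromℤ-‿homo
      ; 0-homo = refl
      ; 1-homo = refl
      }

    coefficientEquality : ∀ i j → Maybe (fromℤ i ≈ fromℤ j)
    coefficientEquality i j with i ℤ.≟ j
    ... | yes ≡.refl = just refl
    ... | no _       = nothing

  open RingSolver ℤ.+-*-rawRing (fromCommutativeRing R) morphism coefficientEquality public
    using (solve; _:=_; _:+_; _:*_; _:-_; :-_; con)

-- The real numbers enter axiomatically: up to isomorphism they are the only
-- complete ordered field.  Equality and order are decidable, as they are
-- classically; this is what makes indicator functions into functions.
record CompleteOrderedField : Set₁ where
  infix 4 _≤_
  field
    commutativeRing : CommutativeRing 0ℓ 0ℓ
  open CommutativeRing commutativeRing public
  field
    _≤_             : Rel Carrier 0ℓ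
    isDecTotalOrder : IsDecTotalOrder _≈_ _≤_
    +-monoʳ-≤       : ∀ z {x y} → x ≤ y → z + x ≤ z + y
    *-nonNegative   : ∀ {x y} → 0# ≤ x → 0# ≤ y → 0# ≤ x * y
    0≉1             : ¬ 0# ≈ 1#
    inverse         : ∀ x → ¬ x ≈ 0# → ∃ λ y → x * y ≈ 1#

  _isUpperBoundOf_ : Carrier → Pred Carrier 0ℓ → Set
  u isUpperBoundOf S = ∀ x → x ∈ S → x ≤ u

  field
    supremum : (S : Pred Carrier 0ℓ) → ∃ S → (∃ λ u → u isUpperBoundOf S) →
               ∃ λ s → s isUpperBoundOf S × (∀ u → u isUpperBoundOf S → s ≤ u)

module _ (R : CommutativeRing 0ℓ 0ℓ) where
  open CommutativeRing R
  open IntegerMultiples R using (solve; _:=_; _:+_; _:*_; _:-_; con)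

  private
    additive : AbelianGroup 0ℓ 0ℓ
    additive = +-abelianGroup ×-abelianGroup +-abelianGroup
    module ℂ = AbelianGroup additive

    infixl 7 _·_
    _·_ : Op₂ ℂ.Carrier
    (a , b) · (c , d) = a * c - b * d , a * d + b * c

    assoc₁ : ∀ a b c d e f →
      (a * c - b * d) * e - (a * d + b * c) * f ≈ a * (c * e - d * f) - b * (c * f + d * e)
    assoc₁ = solve 6 (λ a b c d e f →
      (a :* c :- b :* d) :* e :- (a :* d :+ b :* c) :* f :=
      a :* (c :* e :- d :* f) :- b :* (c :* f :+ d :* e)) refl

    assoc₂ : ∀ a b c d e f →
      (a * c - b * d) * f + (a * d + b * c) * e ≈ a * (c * f + d * e) + b * (c * e - d * f)
    assoc₂ = solve 6 (λ a b c d e f →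
      (a :* c :- b :* d) :* f :+ (a :* d :+ b :* c) :* e :=
      a :* (c :* f :+ d :* e) :+ b :* (c :* e :- d :* f)) refl

    distrib₁ : ∀ a b c d e f →
      a * (c + e) - b * (d + f) ≈ (a * c - b * d) + (a * e - b * f)
    distrib₁ = solve 6 (λ a b c d e f →
      a :* (c :+ e) :- b :* (d :+ f) := (a :* c :- b :* d) :+ (a :* e :- b :* f)) refl

    distrib₂ : ∀ a b c d e f →
      a * (d + f) + b * (c + e) ≈ (a * d + b * c) + (a * f + b * e)
    distrib₂ = solve 6 (λ a b c d e f →
      a :* (d :+ f) :+ b :* (c :+ e) := (a :* d :+ b :* c) :+ (a :* f :+ b :* e)) refl

    ·-comm : ∀ z w → (z · w) ℂ.≈ (w · z)
    ·-comm (a , b) (c , d) =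
      +-cong (*-comm a c) (-‿cong (*-comm b d)) ,
      trans (+-comm _ _) (+-cong (*-comm b c) (*-comm a d))

    ·-identityˡ : ∀ z → ((1# , 0#) · z) ℂ.≈ z
    ·-identityˡ (a , b) =
      solve 2 (λ a b → con 1ℤ :* a :- con 0ℤ :* b := a) refl a b ,
      solve 2 (λ a b → con 1ℤ :* b :+ con 0ℤ :* a := b) refl a b

    distribˡ′ : ∀ z w v → (z · (w ℂ.∙ v)) ℂ.≈ ((z · w) ℂ.∙ (z · v))
    distribˡ′ (a , b) (c , d) (e , f) = distrib₁ a b c d e f , distrib₂ a b c d e f

    ·-cong : ∀ {z z′ w w′} → z ℂ.≈ z′ → w ℂ.≈ w′ → (z · w) ℂ.≈ (z′ · w′)
    ·-cong (p , q) (r , s) =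
      +-cong (*-cong p r) (-‿cong (*-cong q s)) , +-cong (*-cong p s) (*-cong q r)

  complexNumbers : CommutativeRing 0ℓ 0ℓ
  complexNumbers = record
    { Carrier = Carrier × Carrier
    ; _≈_ = ℂ._≈_
    ; _+_ = ℂ._∙_
    ; _*_ = _·_
    ; -_ = ℂ._⁻¹
    ; 0# = 0# , 0#
    ; 1# = 1# , 0#
    ; isCommutativeRing = record
      { isRing = record
        { +-isAbelianGroup = ℂ.isAbelianGroup
        ; *-cong = ·-cong
        ; *-assoc = λ { (a , b) (c , d) (e , f) → assoc₁ a b c d e f , assoc₂ a b c d e f }
        ; *-identity = ·-identityˡ , λ z → ℂ.trans (·-comm z _) (·-identityˡ z)
        ; distrib = distribˡ′ , λ z w v → ℂ.trans (·-comm _ z)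
                      (ℂ.trans (distribˡ′ z w v) (ℂ.∙-cong (·-comm z w) (·-comm z v)))
        }
      ; *-comm = ·-comm
      }
    }

module OrderedFieldProperties (F : CompleteOrderedField) where
  open CompleteOrderedField F
  open IsDecTotalOrder isDecTotalOrder public using (total; _≤?_)
    renaming (refl to ≤-refl; reflexive to ≤-reflexive; trans to ≤-trans; antisym to ≤-antisym)
  open IntegerMultiples commutativeRing

  decTotalOrder : DecTotalOrder 0ℓ 0ℓ 0ℓ
  decTotalOrder = record { isDecTotalOrder = isDecTotalOrder }

  ≤-resp : ∀ {x x′ y y′} → x ≈ x′ → y ≈ y′ → x ≤ y → x′ ≤ y′
  ≤-resp p q r = ≤-trans (≤-reflexive (sym p)) (≤-trans r (≤-reflexive q))

  +-monoˡ-≤ : ∀ z {x y} → x ≤ y → x + z ≤ y + z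
  +-monoˡ-≤ z p = ≤-resp (+-comm z _) (+-comm z _) (+-monoʳ-≤ z p)

  +-mono-≤ : ∀ {x y u v} → x ≤ y → u ≤ v → x + u ≤ y + v
  +-mono-≤ {y = y} {u} p q = ≤-trans (+-monoˡ-≤ u p) (+-monoʳ-≤ y q)

  x≤y⇒0≤y-x : ∀ {x y} → x ≤ y → 0# ≤ y - x
  x≤y⇒0≤y-x {x} p = ≤-resp (-‿inverseʳ x) refl (+-monoˡ-≤ (- x) p)

  0≤y-x⇒x≤y : ∀ {x y} → 0# ≤ y - x → x ≤ y
  0≤y-x⇒x≤y {x} {y} p = ≤-resp (+-identityʳ x)
    (solve 2 (λ x y → x :+ (y :- x) := y) refl x y) (+-monoʳ-≤ x p)

  *-monoˡ-≤ : ∀ {a x y} → 0# ≤ a → x ≤ y → a * x ≤ a * y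
  *-monoˡ-≤ {a} {x} {y} a≥0 p = 0≤y-x⇒x≤y (≤-resp refl
    (solve 3 (λ a x y → a :* (y :- x) := a :* y :- a :* x) refl a x y)
    (*-nonNegative a≥0 (x≤y⇒0≤y-x p)))

  ≰⇒≥ : ∀ {x y} → ¬ x ≤ y → y ≤ x
  ≰⇒≥ {x} {y} p with total x y
  ... | inj₁ q = ⊥-elim (p q)
  ... | inj₂ q = q

  *-cancelˡ-≈ : ∀ {a x y} → ¬ a ≈ 0# → a * x ≈ a * y → x ≈ y
  *-cancelˡ-≈ {a} {x} {y} a≉0 p with inverse a a≉0
  ... | b , ab≈1 = begin
    x            ≈⟨ *-identityˡ x ⟨
    1# * x       ≈⟨ *-congʳ ab≈1 ⟨
    (a * b) * x  ≈⟨ solve 3 (λ a b x → a :* b :* x := b :* (a :* x)) refl a b x ⟩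
    b * (a * x)  ≈⟨ *-congˡ p ⟩
    b * (a * y)  ≈⟨ solve 3 (λ a b x → b :* (a :* x) := a :* b :* x) refl a b y ⟩
    (a * b) * y  ≈⟨ *-congʳ ab≈1 ⟩
    1# * y       ≈⟨ *-identityˡ y ⟩
    y            ∎
    where open SetoidReasoning setoid

  *-cancelˡ-≤ : ∀ {a x y} → ¬ a ≤ 0# → a * x ≤ a * y → x ≤ y
  *-cancelˡ-≤ {a} {x} {y} a>0 p with x ≤? y
  ... | yes q = q
  ... | no ¬q = ≤-reflexive (*-cancelˡ-≈ (λ a≈0 → a>0 (≤-reflexive a≈0))
                  (≤-antisym p (*-monoˡ-≤ (≰⇒≥ a>0) (≰⇒≥ ¬q))))

  -‿anti-≤ : ∀ {x y} → x ≤ y → - y ≤ - x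
  -‿anti-≤ {x} {y} p = 0≤y-x⇒x≤y (≤-resp refl
    (solve 2 (λ x y → y :- x := :- x :- :- y) refl x y) (x≤y⇒0≤y-x p))

  0≤1 : 0# ≤ 1#
  0≤1 with total 0# 1#
  ... | inj₁ p = p
  ... | inj₂ p = ≤-resp refl (solve 0 (:- con 1ℤ :* :- con 1ℤ := con 1ℤ) refl) (*-nonNegative q q)
    where
    q : 0# ≤ - 1#
    q = ≤-resp (solve 0 (:- con 0ℤ := con 0ℤ) refl) refl (-‿anti-≤ p)

  2>0 : ¬ 1# + 1# ≤ 0#
  2>0 p = 0≉1 (≤-antisym 0≤1 (≤-trans (≤-resp (+-identityʳ 1#) refl (+-monoʳ-≤ 1# 0≤1)) p))

  private
    half : ∃ λ h → (1# + 1#) * h ≈ 1#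
    half = inverse (1# + 1#) (λ p → 2>0 (≤-reflexive p))

  midpoint : Carrier → Carrier → Carrier
  midpoint x y = proj₁ half * (x + y)

  private
    midpoint-double : ∀ x y → (1# + 1#) * midpoint x y ≈ x + y
    midpoint-double x y = trans (sym (*-assoc _ _ _)) (trans (*-congʳ (proj₂ half)) (*-identityˡ _))

    double : ∀ x → x + x ≈ (1# + 1#) * x
    double = solve 1 (λ x → x :+ x := (con 1ℤ :+ con 1ℤ) :* x) refl

  ≤-midpoint : ∀ {x y} → x ≤ y → x ≤ midpoint x y
  ≤-midpoint {x} {y} p = *-cancelˡ-≤ 2>0
    (≤-resp (double x) (sym (midpoint-double x y)) (+-monoʳ-≤ x p))

  midpoint-≤ : ∀ {x y} → x ≤ y → midpoint x y ≤ y
  midpoint-≤ {x} {y} p = *-cancelˡ-≤ 2>0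
    (≤-resp (sym (midpoint-double x y)) (double y) (+-monoˡ-≤ y p))

  ≤-midpoint⇒≥ : ∀ {x y} → y ≤ midpoint x y → y ≤ x
  ≤-midpoint⇒≥ {x} {y} p = 0≤y-x⇒x≤y (≤-resp refl
    (trans (+-congʳ (midpoint-double x y)) (solve 2 (λ x y → x :+ y :- (con 1ℤ :+ con 1ℤ) :* y := x :- y) refl x y))
    (x≤y⇒0≤y-x (*-monoˡ-≤ (≰⇒≥ 2>0) p)))

  midpoint-≤⇒≥ : ∀ {x y} → midpoint x y ≤ x → y ≤ x
  midpoint-≤⇒≥ {x} {y} p = 0≤y-x⇒x≤y (≤-resp refl
    (trans (+-congˡ (-‿cong (midpoint-double x y))) (solve 2 (λ x y → (con 1ℤ :+ con 1ℤ) :* x :- (x :+ y) := x :- y) refl x y))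
    (x≤y⇒0≤y-x (*-monoˡ-≤ (≰⇒≥ 2>0) p)))

record CommutativeAlgebra (K : CommutativeRing 0ℓ 0ℓ) : Set₁ where
  field
    commutativeRing : CommutativeRing 0ℓ 0ℓ
  open CommutativeRing commutativeRing public
  field
    ι                    : CommutativeRing.Carrier K → Carrier
    ι-isRingHomomorphism : IsRingHomomorphism (CommutativeRing.rawRing K) rawRing ι

module _ {K : CommutativeRing 0ℓ 0ℓ} where

  module _ (A B : CommutativeAlgebra K) where
    private
      module A = CommutativeAlgebra A
      module B = CommutativeAlgebra B

    record IsAlgebraHomomorphism (φ : A.Carrier → B.Carrier) : Set where
      field
        isRingHomomorphism : IsRingHomomorphism A.rawRing B.rawRing φ
        ι-homo             : ∀ k → φ (A.ι k) B.≈ B.ι k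

    record IsAlgebraIsomorphism (φ : A.Carrier → B.Carrier) : Set where
      field
        isRingIsomorphism : IsRingIsomorphism A.rawRing B.rawRing φ
        ι-homo            : ∀ k → φ (A.ι k) B.≈ B.ι k

    infix 4 _≅_
    _≅_ : Set
    _≅_ = ∃ IsAlgebraIsomorphism

  module _ (A : CommutativeAlgebra K) {I : Set} (g : I → CommutativeAlgebra.Carrier A) where
    open CommutativeAlgebra A
    open IntegerMultiples commutativeRing using (solve; _:=_; _:+_; _:*_; _:-_; :-_; con)
    open IsRingHomomorphism ι-isRingHomomorphism renaming (⟦⟧-cong to ι-cong; 0#-homo to ι-0; 1#-homo to ι-1; -‿homo to ι-neg)

    data Generated : Pred Carrier 0ℓ where
      generator : ∀ i → Generated (g i)
      scalar    : ∀ k → Generated (ι k)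
      sum       : ∀ {x y} → Generated x → Generated y → Generated (x + y)
      product   : ∀ {x y} → Generated x → Generated y → Generated (x * y)
      respects  : ∀ {x y} → x ≈ y → Generated x → Generated y

    private
      negative : ∀ {x} → Generated x → Generated (- x)
      negative {x} p = respects
        (trans (*-congʳ (trans (ι-neg _) (-‿cong ι-1))) (solve 1 (λ x → :- con 1ℤ :* x := :- x) refl x))
        (product (scalar _) p)

      subring : RawRing 0ℓ 0ℓ
      subring = record
        { Carrier = Σ Carrier Generated
        ; _≈_ = λ (x , _) (y , _) → x ≈ y
        ; _+_ = λ (x , p) (y , q) → x + y , sum p q
        ; _*_ = λ (x , p) (y , q) → x * y , product p q
        ; -_  = λ (x , p) → - x , negative p
        ; 0#  = 0# , respects ι-0 (scalar _)
        ; 1#  = 1# , respects ι-1 (scalar _)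
        }

      inclusion : IsRingMonomorphism subring rawRing proj₁
      inclusion = record
        { isRingHomomorphism = record
          { isSemiringHomomorphism = record
            { isNearSemiringHomomorphism = record
              { +-isMonoidHomomorphism = record
                { isMagmaHomomorphism = record
                  { isRelHomomorphism = record { cong = id }
                  ; homo = λ _ _ → refl
                  }
                ; ε-homo = refl
                }
              ; *-homo = λ _ _ → refl
              }
            ; 1#-homo = refl
            }
          ; -‿homo = λ _ → refl
          }
        ; injective = id
        }

    subalgebra : CommutativeAlgebra K
    subalgebra = record
      { commutativeRing = record
        { isCommutativeRing = RingMonomorphism.isCommutativeRing inclusion isCommutativeRing }
      ; ι = λ k → ι k , scalar k
      ; ι-isRingHomomorphism = record
        { isSemiringHomomorphism = record
          { isNearSemiringHomomorphism = record
            { +-isMonoidHomomorphism = record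
              { isMagmaHomomorphism = record
                { isRelHomomorphism = record { cong = ι-cong }
                ; homo = +-homo
                }
              ; ε-homo = ι-0
              }
            ; *-homo = *-homo
            }
          ; 1#-homo = ι-1
          }
        ; -‿homo = ι-neg
        }
      }

    data Ideal : Pred Carrier 0ℓ where
      generator : ∀ i → Ideal (g i)
      null      : Ideal 0#
      sum       : ∀ {x y} → Ideal x → Ideal y → Ideal (x + y)
      multiple  : ∀ r {x} → Ideal x → Ideal (r * x)
      respects  : ∀ {x y} → x ≈ y → Ideal x → Ideal y

    quotient : CommutativeAlgebra K
    quotient = record
      { commutativeRing = record
        { Carrier = Carrier
        ; _≈_ = _~_
        ; _+_ = _+_
        ; _*_ = _*_
        ; -_ = -_
        ; 0# = 0#
        ; 1# = 1#
        ; isCommutativeRing = record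
          { isRing = record
            { +-isAbelianGroup = record
              { isGroup = record
                { isMonoid = record
                  { isSemigroup = record
                    { isMagma = record
                      { isEquivalence = record { refl = ≈⇒~ refl ; sym = ~-sym ; trans = ~-trans }
                      ; ∙-cong = ~-+-cong
                      }
                    ; assoc = λ x y z → ≈⇒~ (+-assoc x y z)
                    }
                  ; identity = (λ x → ≈⇒~ (+-identityˡ x)) , λ x → ≈⇒~ (+-identityʳ x)
                  }
                ; inverse = (λ x → ≈⇒~ (-‿inverseˡ x)) , λ x → ≈⇒~ (-‿inverseʳ x)
                ; ⁻¹-cong = ~-neg-cong
                }
              ; comm = λ x y → ≈⇒~ (+-comm x y)
              }
            ; *-cong = ~-*-cong
            ; *-assoc = λ x y z → ≈⇒~ (*-assoc x y z)
            ; *-identity = (λ x → ≈⇒~ (*-identityˡ x)) , λ x → ≈⇒~ (*-identityʳ x)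
            ; distrib = (λ x y z → ≈⇒~ (distribˡ x y z)) , λ x y z → ≈⇒~ (distribʳ x y z)
            }
          ; *-comm = λ x y → ≈⇒~ (*-comm x y)
          }
        }
      ; ι = ι
      ; ι-isRingHomomorphism = record
        { isSemiringHomomorphism = record
          { isNearSemiringHomomorphism = record
            { +-isMonoidHomomorphism = record
              { isMagmaHomomorphism = record
                { isRelHomomorphism = record { cong = ≈⇒~ ∘ ι-cong }
                ; homo = λ j k → ≈⇒~ (+-homo j k)
                }
              ; ε-homo = ≈⇒~ ι-0
              }
            ; *-homo = λ j k → ≈⇒~ (*-homo j k)
            }
          ; 1#-homo = ≈⇒~ ι-1
          }
        ; -‿homo = λ k → ≈⇒~ (ι-neg k)
        }
      }
      where
      _~_ : Carrier → Carrier → Set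
      x ~ y = x - y ∈ Ideal

      ≈⇒~ : ∀ {x y} → x ≈ y → x ~ y
      ≈⇒~ {x} {y} p = respects (sym (trans (+-congʳ p) (-‿inverseʳ y))) null

      ~-sym : ∀ {x y} → x ~ y → y ~ x
      ~-sym {x} {y} p = respects (solve 2 (λ x y → :- con 1ℤ :* (x :- y) := y :- x) refl x y) (multiple (- 1#) p)

      ~-trans : ∀ {x y z} → x ~ y → y ~ z → x ~ z
      ~-trans {x} {y} {z} p q =
        respects (solve 3 (λ x y z → (x :- y) :+ (y :- z) := x :- z) refl x y z) (sum p q)

      ~-+-cong : ∀ {x x′ y y′} → x ~ x′ → y ~ y′ → (x + y) ~ (x′ + y′)
      ~-+-cong {x} {x′} {y} {y′} p q = respects
        (solve 4 (λ x x′ y y′ → (x :- x′) :+ (y :- y′) := (x :+ y) :- (x′ :+ y′)) refl x x′ y y′) (sum p q)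

      ~-neg-cong : ∀ {x y} → x ~ y → (- x) ~ (- y)
      ~-neg-cong {x} {y} p = respects
        (solve 2 (λ x y → :- con 1ℤ :* (x :- y) := :- x :- :- y) refl x y) (multiple (- 1#) p)

      ~-*-cong : ∀ {x x′ y y′} → x ~ x′ → y ~ y′ → (x * y) ~ (x′ * y′)
      ~-*-cong {x} {x′} {y} {y′} p q = respects
        (solve 4 (λ x x′ y y′ → y :* (x :- x′) :+ x′ :* (y :- y′) := x :* y :- x′ :* y′) refl x x′ y y′)
        (sum (multiple y p) (multiple x′ q))

module Sums (K : CommutativeRing 0ℓ 0ℓ) where
  open CommutativeRing K
  open IntegerMultiples K using (solve; _:=_; _:+_; _:*_; _:-_; :-_)
  open SetoidReasoning setoid

  Combination : Set → Set
  Combination X = List (Carrier × X)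

  private variable
    X Y : Set

  -- The linear extension of φ to formal linear combinations.
  ∑ : Combination X → (X → Carrier) → Carrier
  ∑ []            φ = 0#
  ∑ ((a , x) ∷ f) φ = a * φ x + ∑ f φ

  ∑-cong-∈ : ∀ (f : Combination X) {φ ψ} → (∀ {a x} → (a , x) ∈ˡ f → φ x ≈ ψ x) → ∑ f φ ≈ ∑ f ψ
  ∑-cong-∈ []      φ≈ψ = refl
  ∑-cong-∈ (_ ∷ f) φ≈ψ = +-cong (*-congˡ (φ≈ψ (here ≡.refl))) (∑-cong-∈ f (λ m → φ≈ψ (there m)))

  ∑-cong : ∀ (f : Combination X) {φ ψ} → (∀ x → φ x ≈ ψ x) → ∑ f φ ≈ ∑ f ψ
  ∑-cong f φ≈ψ = ∑-cong-∈ f (λ {_} {x} _ → φ≈ψ x)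

  ∑-++ : ∀ (f g : Combination X) φ → ∑ (f ++ g) φ ≈ ∑ f φ + ∑ g φ
  ∑-++ []            g φ = sym (+-identityˡ _)
  ∑-++ ((a , x) ∷ f) g φ = trans (+-congˡ (∑-++ f g φ)) (sym (+-assoc _ _ _))

  ∑-map : ∀ (f : Combination X) (c : Carrier) (h : X → Y) φ →
          ∑ (map (λ (a , x) → c * a , h x) f) φ ≈ c * ∑ f (λ x → φ (h x))
  ∑-map []            c h φ = sym (zeroʳ c)
  ∑-map ((a , x) ∷ f) c h φ = begin
    c * a * φ (h x) + ∑ (map (λ (a , x) → c * a , h x) f) φ  ≈⟨ +-congˡ (∑-map f c h φ) ⟩
    c * a * φ (h x) + c * ∑ f (λ x → φ (h x))
      ≈⟨ solve 4 (λ c a p s → c :* a :* p :+ c :* s := c :* (a :* p :+ s)) refl c a _ _ ⟩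
    c * (a * φ (h x) + ∑ f (λ x → φ (h x)))                  ∎

  ∑-neg : ∀ (f : Combination X) φ → ∑ (map (λ (a , x) → - a , x) f) φ ≈ - ∑ f φ
  ∑-neg []            φ = sym (RingProperties.-0#≈0# ring)
  ∑-neg ((a , x) ∷ f) φ = trans (+-congˡ (∑-neg f φ))
    (solve 3 (λ a p s → :- a :* p :+ :- s := :- (a :* p :+ s)) refl a (φ x) _)

  ∑-*ˡ : ∀ (f : Combination X) c φ → ∑ f (λ x → c * φ x) ≈ c * ∑ f φ
  ∑-*ˡ []            c φ = sym (zeroʳ c)
  ∑-*ˡ ((a , x) ∷ f) c φ = trans (+-congˡ (∑-*ˡ f c φ))
    (solve 4 (λ a c p s → a :* (c :* p) :+ c :* s := c :* (a :* p :+ s)) refl a c (φ x) _)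

  ∑-+ : ∀ (f : Combination X) φ ψ → ∑ f (λ x → φ x + ψ x) ≈ ∑ f φ + ∑ f ψ
  ∑-+ []            φ ψ = sym (+-identityˡ 0#)
  ∑-+ ((a , x) ∷ f) φ ψ = trans (+-congˡ (∑-+ f φ ψ))
    (solve 5 (λ a p q s t → a :* (p :+ q) :+ (s :+ t) := (a :* p :+ s) :+ (a :* q :+ t))
       refl a (φ x) (ψ x) _ _)

  ∑-0 : ∀ (f : Combination X) → ∑ f (λ _ → 0#) ≈ 0#
  ∑-0 []      = refl
  ∑-0 (_ ∷ f) = trans (+-cong (zeroʳ _) (∑-0 f)) (+-identityˡ 0#)

  ∑-swap : ∀ (f : Combination X) (g : Combination Y) (φ : X → Y → Carrier) →
           ∑ f (λ x → ∑ g (λ y → φ x y)) ≈ ∑ g (λ y → ∑ f (λ x → φ x y))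
  ∑-swap []            g φ = sym (∑-0 g)
  ∑-swap ((a , x) ∷ f) g φ = begin
    a * ∑ g (φ x) + ∑ f (λ x → ∑ g (φ x))              ≈⟨ +-cong (sym (∑-*ˡ g a (φ x))) (∑-swap f g φ) ⟩
    ∑ g (λ y → a * φ x y) + ∑ g (λ y → ∑ f (λ x → φ x y))  ≈⟨ ∑-+ g _ _ ⟨
    ∑ g (λ y → a * φ x y + ∑ f (λ x → φ x y))          ∎

-- Formal combinations of elements of X, each x standing for the function τ x
-- on T, with two combinations equal when they represent the same function.
-- This is the span of the functions τ x; _∙_ extends bilinearly to it as soon
-- as, for each y, x ↦ x ∙ y respects linear relations (τ-translate).
module CombinationRing
  (K : CommutativeRing 0ℓ 0ℓ) {X T : Set}
  (τ : X → T → CommutativeRing.Carrier K)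
  (_∙_ : Op₂ X) (ε : X)
  where

  open CommutativeRing K
  open Sums K
  open SetoidReasoning setoid

  infix  4 _≋_
  infixl 7 _⊛_
  infixl 6 _⊞_

  ⟦_⟧ : Combination X → T → Carrier
  ⟦ f ⟧ t = ∑ f (λ x → τ x t)

  record _≋_ (f g : Combination X) : Set where
    constructor pointwise
    field _at_ : ∀ t → ⟦ f ⟧ t ≈ ⟦ g ⟧ t

  open _≋_ public

  _⊞_ : Op₂ (Combination X)
  _⊞_ = _++_

  ⊟_ : Combination X → Combination X
  ⊟_ = map (λ (a , x) → - a , x)

  _⊛_ : Op₂ (Combination X)
  []            ⊛ g = []
  ((a , x) ∷ f) ⊛ g = map (λ (b , y) → a * b , x ∙ y) g ++ f ⊛ g

  ∑-⊛ : ∀ f g φ → ∑ (f ⊛ g) φ ≈ ∑ f (λ x → ∑ g (λ y → φ (x ∙ y)))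
  ∑-⊛ []            g φ = refl
  ∑-⊛ ((a , x) ∷ f) g φ = begin
    ∑ (map (λ (b , y) → a * b , x ∙ y) g ++ f ⊛ g) φ  ≈⟨ ∑-++ (map _ g) (f ⊛ g) φ ⟩
    ∑ (map (λ (b , y) → a * b , x ∙ y) g) φ + ∑ (f ⊛ g) φ  ≈⟨ +-cong (∑-map g a (x ∙_) φ) (∑-⊛ f g φ) ⟩
    a * ∑ g (λ y → φ (x ∙ y)) + ∑ f (λ x → ∑ g (λ y → φ (x ∙ y)))  ∎

  module _
    (τ-assoc     : ∀ x y z t → τ ((x ∙ y) ∙ z) t ≈ τ (x ∙ (y ∙ z)) t)
    (τ-comm      : ∀ x y t → τ (x ∙ y) t ≈ τ (y ∙ x) t)
    (τ-identityˡ : ∀ x t → τ (ε ∙ x) t ≈ τ x t)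
    (τ-translate : ∀ (f : Combination X) y → (∀ t → ⟦ f ⟧ t ≈ 0#) → ∀ t → ∑ f (λ x → τ (x ∙ y) t) ≈ 0#)
    where

    private
      ⊛-comm : ∀ f g → f ⊛ g ≋ g ⊛ f
      ⊛-comm f g = pointwise λ t → begin
        ⟦ f ⊛ g ⟧ t                             ≈⟨ ∑-⊛ f g _ ⟩
        ∑ f (λ x → ∑ g (λ y → τ (x ∙ y) t))    ≈⟨ ∑-swap f g _ ⟩
        ∑ g (λ y → ∑ f (λ x → τ (x ∙ y) t))    ≈⟨ ∑-cong g (λ y → ∑-cong f (λ x → τ-comm x y t)) ⟩
        ∑ g (λ y → ∑ f (λ x → τ (y ∙ x) t))    ≈⟨ ∑-⊛ g f _ ⟨
        ⟦ g ⊛ f ⟧ t                             ∎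

      ⊛-assoc : ∀ f g h → (f ⊛ g) ⊛ h ≋ f ⊛ (g ⊛ h)
      ⊛-assoc f g h = pointwise λ t → begin
        ⟦ (f ⊛ g) ⊛ h ⟧ t                                          ≈⟨ ∑-⊛ (f ⊛ g) h _ ⟩
        ∑ (f ⊛ g) (λ u → ∑ h (λ z → τ (u ∙ z) t))                  ≈⟨ ∑-⊛ f g _ ⟩
        ∑ f (λ x → ∑ g (λ y → ∑ h (λ z → τ ((x ∙ y) ∙ z) t)))
          ≈⟨ ∑-cong f (λ x → ∑-cong g (λ y → ∑-cong h (λ z → τ-assoc x y z t))) ⟩
        ∑ f (λ x → ∑ g (λ y → ∑ h (λ z → τ (x ∙ (y ∙ z)) t)))      ≈⟨ ∑-cong f (λ x → ∑-⊛ g h _) ⟨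
        ∑ f (λ x → ∑ (g ⊛ h) (λ u → τ (x ∙ u) t))                  ≈⟨ ∑-⊛ f (g ⊛ h) _ ⟨
        ⟦ f ⊛ (g ⊛ h) ⟧ t                                          ∎

      ⊛-identityˡ : ∀ f → [ 1# , ε ] ⊛ f ≋ f
      ⊛-identityˡ f = pointwise λ t → begin
        ⟦ [ 1# , ε ] ⊛ f ⟧ t                      ≈⟨ ∑-⊛ [ 1# , ε ] f _ ⟩
        1# * ∑ f (λ x → τ (ε ∙ x) t) + 0#         ≈⟨ trans (+-identityʳ _) (*-identityˡ _) ⟩
        ∑ f (λ x → τ (ε ∙ x) t)                   ≈⟨ ∑-cong f (λ x → τ-identityˡ x t) ⟩
        ⟦ f ⟧ t                                   ∎

      ⊛-distribʳ : ∀ h f g → (f ⊞ g) ⊛ h ≋ (f ⊛ h) ⊞ (g ⊛ h)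
      ⊛-distribʳ h f g = pointwise λ t → begin
        ⟦ (f ⊞ g) ⊛ h ⟧ t                         ≈⟨ ∑-⊛ (f ++ g) h _ ⟩
        ∑ (f ++ g) _                              ≈⟨ ∑-++ f g _ ⟩
        ∑ f _ + ∑ g _                             ≈⟨ +-cong (∑-⊛ f h _) (∑-⊛ g h _) ⟨
        ⟦ f ⊛ h ⟧ t + ⟦ g ⊛ h ⟧ t                 ≈⟨ ∑-++ (f ⊛ h) (g ⊛ h) _ ⟨
        ⟦ (f ⊛ h) ⊞ (g ⊛ h) ⟧ t                   ∎

      ⊛-congʳ : ∀ {f f′} g → f ≋ f′ → f ⊛ g ≋ f′ ⊛ g
      ⊛-congʳ {f} {f′} g p = pointwise λ t → x∙y⁻¹≈ε⇒x≈y _ _ (begin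
        ⟦ f ⊛ g ⟧ t - ⟦ f′ ⊛ g ⟧ t                          ≈⟨ +-cong (∑-⊛ f g _) (-‿cong (∑-⊛ f′ g _)) ⟩
        ∑ f _ - ∑ f′ _                                      ≈⟨ +-congˡ (∑-neg f′ _) ⟨
        ∑ f _ + ∑ (⊟ f′) _                                  ≈⟨ ∑-++ f (⊟ f′) _ ⟨
        ∑ (f ⊞ ⊟ f′) (λ x → ∑ g (λ y → τ (x ∙ y) t))        ≈⟨ ∑-swap (f ⊞ ⊟ f′) g _ ⟩
        ∑ g (λ y → ∑ (f ⊞ ⊟ f′) (λ x → τ (x ∙ y) t))
          ≈⟨ ∑-cong g (λ y → τ-translate (f ⊞ ⊟ f′) y difference≈0 t) ⟩
        ∑ g (λ _ → 0#)                                      ≈⟨ ∑-0 g ⟩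
        0#                                                  ∎)
        where
        open RingProperties ring using (x∙y⁻¹≈ε⇒x≈y)
        difference≈0 : ∀ t → ⟦ f ⊞ ⊟ f′ ⟧ t ≈ 0#
        difference≈0 t = trans (∑-++ f (⊟ f′) _)
          (trans (+-cong (p at t) (∑-neg f′ _)) (-‿inverseʳ _))

      ≋-trans : ∀ {f g h} → f ≋ g → g ≋ h → f ≋ h
      ≋-trans p q = pointwise λ t → trans (p at t) (q at t)

      ⊛-cong : ∀ {f f′ g g′} → f ≋ f′ → g ≋ g′ → f ⊛ g ≋ f′ ⊛ g′
      ⊛-cong {f} {f′} {g} {g′} p q = ≋-trans (⊛-congʳ g p)
        (≋-trans (⊛-comm f′ g) (≋-trans (⊛-congʳ f′ q) (⊛-comm g′ f′)))

      ⊞-cong : ∀ {f f′ g g′} → f ≋ f′ → g ≋ g′ → f ⊞ g ≋ f′ ⊞ g′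
      ⊞-cong {f} {f′} {g} {g′} p q = pointwise λ t →
        trans (∑-++ f g _) (trans (+-cong (p at t) (q at t)) (sym (∑-++ f′ g′ _)))

      ⊞-comm : ∀ f g → f ⊞ g ≋ g ⊞ f
      ⊞-comm f g = pointwise λ t → trans (∑-++ f g _) (trans (+-comm _ _) (sym (∑-++ g f _)))

      ⊞-identityʳ : ∀ f → f ⊞ [] ≋ f
      ⊞-identityʳ f = pointwise λ t → trans (∑-++ f [] _) (+-identityʳ _)

      ⊞-assoc : ∀ f g h → (f ⊞ g) ⊞ h ≋ f ⊞ (g ⊞ h)
      ⊞-assoc []      g h = pointwise λ t → refl
      ⊞-assoc (_ ∷ f) g h = pointwise λ t → +-congˡ (⊞-assoc f g h at t)

      ⊟-inverseʳ : ∀ f → f ⊞ ⊟ f ≋ []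
      ⊟-inverseʳ f = pointwise λ t →
        trans (∑-++ f (⊟ f) _) (trans (+-congˡ (∑-neg f _)) (-‿inverseʳ _))

      ⊟-cong : ∀ {f g} → f ≋ g → ⊟ f ≋ ⊟ g
      ⊟-cong {f} {g} p = pointwise λ t →
        trans (∑-neg f _) (trans (-‿cong (p at t)) (sym (∑-neg g _)))

    combinationRing : CommutativeRing 0ℓ 0ℓ
    combinationRing = record
      { Carrier = Combination X
      ; _≈_ = _≋_
      ; _+_ = _⊞_
      ; _*_ = _⊛_
      ; -_ = ⊟_
      ; 0# = []
      ; 1# = [ 1# , ε ]
      ; isCommutativeRing = record
        { isRing = record
          { +-isAbelianGroup = record
            { isGroup = record
              { isMonoid = record
                { isSemigroup = record
                  { isMagma = record
                    { isEquivalence = record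
                      { refl  = pointwise λ t → refl
                      ; sym   = λ p → pointwise λ t → sym (p at t)
                      ; trans = ≋-trans
                      }
                    ; ∙-cong = ⊞-cong
                    }
                  ; assoc = ⊞-assoc
                  }
                ; identity = (λ f → pointwise λ t → refl) , ⊞-identityʳ
                }
              ; inverse = (λ f → ≋-trans (⊞-comm (⊟ f) f) (⊟-inverseʳ f)) , ⊟-inverseʳ
              ; ⁻¹-cong = ⊟-cong
              }
            ; comm = ⊞-comm
            }
          ; *-cong = ⊛-cong
          ; *-assoc = ⊛-assoc
          ; *-identity = ⊛-identityˡ , λ f → ≋-trans (⊛-comm f _) (⊛-identityˡ f)
          ; distrib =
              (λ h f g → ≋-trans (⊛-comm h (f ⊞ g)) (≋-trans (⊛-distribʳ h f g)
                           (⊞-cong (⊛-comm f h) (⊛-comm g h)))) ,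
              ⊛-distribʳ
          }
        ; *-comm = ⊛-comm
        }
      }

    combinationAlgebra : CommutativeAlgebra K
    combinationAlgebra = record
      { commutativeRing = combinationRing
      ; ι = λ k → [ k , ε ]
      ; ι-isRingHomomorphism = record
        { isSemiringHomomorphism = record
          { isNearSemiringHomomorphism = record
            { +-isMonoidHomomorphism = record
              { isMagmaHomomorphism = record
                { isRelHomomorphism = record { cong = λ p → pointwise λ t → +-congʳ (*-congʳ p) }
                ; homo = λ j k → pointwise λ t →
                    trans (+-congʳ (distribʳ (τ ε t) j k)) (+-assoc _ _ _)
                }
              ; ε-homo = pointwise λ t → trans (+-congʳ (zeroˡ _)) (+-identityʳ 0#)
              }
            ; *-homo = λ j k → pointwise λ t → +-congʳ (*-congˡ (sym (τ-identityˡ ε t)))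
            }
          ; 1#-homo = pointwise λ t → refl
          }
        ; -‿homo = λ k → pointwise λ t → refl
        }
      }

module Indicators (K : CommutativeRing 0ℓ 0ℓ) where
  open CommutativeRing K

  𝟙 : {A : Set} → Dec A → Carrier
  𝟙 A? = if does A? then 1# else 0#

  𝟙-yes : ∀ {A : Set} (A? : Dec A) → A → 𝟙 A? ≈ 1#
  𝟙-yes (yes _) _ = refl
  𝟙-yes (no ¬a) a = ⊥-elim (¬a a)

  𝟙-no : ∀ {A : Set} (A? : Dec A) → ¬ A → 𝟙 A? ≈ 0#
  𝟙-no (yes a) ¬a = ⊥-elim (¬a a)
  𝟙-no (no _)  _  = refl

  𝟙-cong : ∀ {A B : Set} (A? : Dec A) (B? : Dec B) → (A → B) → (B → A) → 𝟙 A? ≈ 𝟙 B?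
  𝟙-cong (yes a) B? to from = sym (𝟙-yes B? (to a))
  𝟙-cong (no ¬a) B? to from = sym (𝟙-no B? (¬a ∘ from))

module Polyhedra (F : CompleteOrderedField) where
  open CompleteOrderedField F renaming (Carrier to ℝ)
  open OrderedFieldProperties F
  open IntegerMultiples commutativeRing

  private variable
    m n : ℕ

  infix  4 _≐_ _∈ᴴ_ _∈ᴾ_ _∈ᴾ?_
  infixl 6 _+ᵛ_ _-ᵛ_
  infixl 7 _·_

  _≐_ : Vec ℝ n → Vec ℝ n → Set
  _≐_ = Pointwise _≈_

  0ᵛ : Vec ℝ n
  0ᵛ = replicate _ 0#

  _+ᵛ_ _-ᵛ_ : Op₂ (Vec ℝ n)
  _+ᵛ_ = zipWith _+_
  _-ᵛ_ = zipWith _-_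

  _·_ : Vec ℝ n → Vec ℝ n → ℝ
  []       · []       = 0#
  (a ∷ as) · (x ∷ xs) = a * x + as · xs

  record HalfSpace (n : ℕ) : Set where
    constructor halfSpace
    field
      normal : Vec ℝ n
      bound  : ℝ

  -- A closed convex polyhedron: a finite intersection of closed half-spaces.
  -- Zero normals are allowed, so the empty set and the whole space are included.
  Polyhedron : ℕ → Set
  Polyhedron n = List (HalfSpace n)

  _∈ᴴ_ : Vec ℝ n → HalfSpace n → Set
  w ∈ᴴ halfSpace a b = a · w ≤ b

  _∈ᴾ_ : Vec ℝ n → Polyhedron n → Set
  w ∈ᴾ P = All (w ∈ᴴ_) P

  _∈ᴾ?_ : (w : Vec ℝ n) (P : Polyhedron n) → Dec (w ∈ᴾ P)
  w ∈ᴾ? P = all? (λ { (halfSpace a b) → a · w ≤? b }) P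

  -- Fourier–Motzkin elimination of the first coordinate: a constraint not
  -- involving it is kept, and each pair consisting of an upper and a lower
  -- bound for it is combined (eliminate₂ handles the pair in that order).

  eliminate₂ : HalfSpace (suc n) → HalfSpace (suc n) → Polyhedron n
  eliminate₂ (halfSpace (α ∷ a) b) (halfSpace (β ∷ c) d) with α ≤? 0# | 0# ≤? α | 0# ≤? β
  ... | yes _ | yes _ | _     = [ halfSpace a b ]
  ... | no  _ | _     | no  _ = [ halfSpace (zipWith (λ c a → α * c - β * a) c a) (α * d - β * b) ]
  ... | yes _ | no _  | _     = []
  ... | no _  | _     | yes _ = []

  eliminate : Polyhedron (suc n) → Polyhedron n
  eliminate P = concatMap (λ (H , H′) → eliminate₂ H H′) (cartesianProduct P P)

  project : ∀ m → Polyhedron (m ℕ.+ n) → Polyhedron n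
  project zero    P = P
  project (suc m) P = project m (eliminate P)

  ·-combination : ∀ α β (c a x : Vec ℝ n) →
    zipWith (λ c a → α * c - β * a) c a · x ≈ α * (c · x) - β * (a · x)
  ·-combination α β []      []      []      =
    solve 2 (λ α β → con 0ℤ := α :* con 0ℤ :- β :* con 0ℤ) refl α β
  ·-combination α β (c ∷ cs) (a ∷ as) (x ∷ xs) = trans (+-congˡ (·-combination α β cs as xs))
    (solve 7 (λ α β c a x s t →
       (α :* c :- β :* a) :* x :+ (α :* s :- β :* t) := α :* (c :* x :+ s) :- β :* (a :* x :+ t))
       refl α β c a x (cs · xs) (as · xs))

  ·-cong : ∀ (a : Vec ℝ n) {w v} → w ≐ v → a · w ≈ a · v
  ·-cong []       []       = refl
  ·-cong (a ∷ as) (p ∷ ps) = +-cong (*-congˡ p) (·-cong as ps)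

  ∈ᴾ-resp : ∀ {w v} (P : Polyhedron n) → w ≐ v → w ∈ᴾ P → v ∈ᴾ P
  ∈ᴾ-resp P p = All.map λ {H} → ≤-resp (·-cong (HalfSpace.normal H) p) refl

  private
    ≤-shift : ∀ {u v u′ v′} → v - u ≈ v′ - u′ → u ≤ v → u′ ≤ v′
    ≤-shift p q = 0≤y-x⇒x≤y (≤-resp refl p (x≤y⇒0≤y-x q))

    -x≤0⇒0≤x : ∀ {x} → - x ≤ 0# → 0# ≤ x
    -x≤0⇒0≤x {x} = ≤-shift (solve 1 (λ x → con 0ℤ :- :- x := x :- con 0ℤ) refl x)

    divide : ∀ {a} r → ¬ a ≈ 0# → ∃ λ e → a * e ≈ r
    divide {a} r a≉0 with inverse a a≉0
    ... | b , ab≈1 = b * r , trans (sym (*-assoc a b r)) (trans (*-congʳ ab≈1) (*-identityˡ r))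

  -- The part of a half-space lying over x is everything or nothing, a ray
  -- bounded below, or a ray bounded above.
  data Fibre (x : Vec ℝ n) : HalfSpace (suc n) → Set where
    flat  : ∀ {α a b} → α ≤ 0# → 0# ≤ α →
            (∀ t → a · x ≤ b ⇔ (t ∷ x) ∈ᴴ halfSpace (α ∷ a) b) →
            Fibre x (halfSpace (α ∷ a) b)
    above : ∀ {α a b} → ¬ 0# ≤ α → (e : ℝ) →
            (∀ t → e ≤ t ⇔ (t ∷ x) ∈ᴴ halfSpace (α ∷ a) b) →
            Fibre x (halfSpace (α ∷ a) b)
    below : ∀ {α a b} → ¬ α ≤ 0# → (e : ℝ) → α * e ≈ b - a · x →
            (∀ t → t ≤ e ⇔ (t ∷ x) ∈ᴴ halfSpace (α ∷ a) b) →
            Fibre x (halfSpace (α ∷ a) b)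

  fibre : ∀ (x : Vec ℝ n) H → Fibre x H
  fibre x (halfSpace (α ∷ a) b) with α ≤? 0# | 0# ≤? α
  ... | yes p | yes q = flat p q λ t → mk⇔ (≤-resp (sym (lemma t)) refl) (≤-resp (lemma t) refl)
    where
    lemma : ∀ t → α * t + a · x ≈ a · x
    lemma t = trans (+-congʳ (trans (*-congʳ (≤-antisym p q)) (zeroˡ t))) (+-identityˡ _)
  ... | no p | _ with divide (b - a · x) (p ∘ ≤-reflexive)
  ...   | e , αe≈ = below p e αe≈ λ t →
            mk⇔ (≤-shift (lemma t) ∘ *-monoˡ-≤ (≰⇒≥ p)) (*-cancelˡ-≤ p ∘ ≤-shift (sym (lemma t)))
    where
    lemma : ∀ t → α * e - α * t ≈ b - (α * t + a · x)
    lemma t = trans (+-congʳ αe≈)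
      (solve 3 (λ r b s → b :- s :- r := b :- (r :+ s)) refl (α * t) b (a · x))
  fibre x (halfSpace (α ∷ a) b) | yes p | no q with divide (a · x - b) (q ∘ -x≤0⇒0≤x ∘ ≤-reflexive)
  ...   | e , -αe≈ = above q e λ t →
            mk⇔ (≤-shift (lemma t) ∘ *-monoˡ-≤ (≰⇒≥ -α>0)) (*-cancelˡ-≤ -α>0 ∘ ≤-shift (sym (lemma t)))
    where
    -α>0 : ¬ - α ≤ 0#
    -α>0 = q ∘ -x≤0⇒0≤x
    lemma : ∀ t → - α * t - - α * e ≈ b - (α * t + a · x)
    lemma t = trans (+-congˡ (-‿cong -αe≈))
      (solve 4 (λ α t b s → :- α :* t :- (s :- b) := b :- (α :* t :+ s)) refl α t b (a · x))

  module FibreEndpoints where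
    low high : ∀ {x : Vec ℝ n} {H} → Fibre x H → List ℝ
    low (above _ e _) = [ e ]
    low _             = []
    high (below _ e _ _) = [ e ]
    high _               = []

    Consistent : ∀ {x : Vec ℝ n} {H} → Fibre x H → Set
    Consistent {x = x} (flat {_} {a} {b} _ _ _) = a · x ≤ b
    Consistent _                                = ⊤

    lows highs : Vec ℝ n → Polyhedron (suc n) → List ℝ
    lows  x P = concatMap (λ H → low  (fibre x H)) P
    highs x P = concatMap (λ H → high (fibre x H)) P

    module _ {x : Vec ℝ n} {t : ℝ} where
      low-sound : ∀ {H} (φ : Fibre x H) → (t ∷ x) ∈ᴴ H → All (_≤ t) (low φ)
      low-sound (flat _ _ _)    p = []
      low-sound (above _ e e⇔)  p = Equivalence.from (e⇔ t) p ∷ []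
      low-sound (below _ _ _ _) p = []

      high-sound : ∀ {H} (φ : Fibre x H) → (t ∷ x) ∈ᴴ H → All (t ≤_) (high φ)
      high-sound (flat _ _ _)     p = []
      high-sound (above _ _ _)    p = []
      high-sound (below _ e _ e⇔) p = Equivalence.from (e⇔ t) p ∷ []

      consistent-sound : ∀ {H} (φ : Fibre x H) → (t ∷ x) ∈ᴴ H → Consistent φ
      consistent-sound (flat _ _ e⇔)   p = Equivalence.from (e⇔ t) p
      consistent-sound (above _ _ _)   p = tt
      consistent-sound (below _ _ _ _) p = tt

      fibre-complete : ∀ {H} (φ : Fibre x H) → Consistent φ → All (_≤ t) (low φ) → All (t ≤_) (high φ) →
                       (t ∷ x) ∈ᴴ H
      fibre-complete (flat _ _ e⇔)    c _        _        = Equivalence.to (e⇔ t) c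
      fibre-complete (above _ _ e⇔)   _ (l ∷ []) _        = Equivalence.to (e⇔ t) l
      fibre-complete (below _ _ _ e⇔) _ _        (h ∷ []) = Equivalence.to (e⇔ t) h

      lows-sound : ∀ P → (t ∷ x) ∈ᴾ P → All (_≤ t) (lows x P)
      lows-sound P p = concat⁺ (map⁺ (All.map (λ {H} → low-sound (fibre x H)) p))

      highs-sound : ∀ P → (t ∷ x) ∈ᴾ P → All (t ≤_) (highs x P)
      highs-sound P p = concat⁺ (map⁺ (All.map (λ {H} → high-sound (fibre x H)) p))

      fibres-complete : ∀ P → All (λ H → Consistent (fibre x H)) P →
                        All (_≤ t) (lows x P) → All (t ≤_) (highs x P) → (t ∷ x) ∈ᴾ P
      fibres-complete P c l h = All.zipWith (λ {H} (c , l , h) → fibre-complete (fibre x H) c l h)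
        (c , All.zip (map⁻ (concat⁻ l) , map⁻ (concat⁻ h)))

    maximum : ∀ l L → ∃ λ m → m ∈ˡ (l ∷ L) × All (_≤ m) (l ∷ L)
    maximum l []       = l , here ≡.refl , ≤-refl ∷ []
    maximum l (l′ ∷ L) with maximum l′ L
    ... | m , m∈ , L≤m with total l m
    ...   | inj₁ l≤m = m , there m∈ , l≤m ∷ L≤m
    ...   | inj₂ m≤l = l , here ≡.refl , ≤-refl ∷ All.map (λ p → ≤-trans p m≤l) L≤m

    minimum : ∀ u U → ∃ λ m → m ∈ˡ (u ∷ U) × All (m ≤_) (u ∷ U)
    minimum u []       = u , here ≡.refl , ≤-refl ∷ []
    minimum u (u′ ∷ U) with minimum u′ U
    ... | m , m∈ , m≤U with total u m
    ...   | inj₁ u≤m = u , here ≡.refl , ≤-refl ∷ All.map (≤-trans u≤m) m≤U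
    ...   | inj₂ m≤u = m , there m∈ , m≤u ∷ m≤U

    Separated : List ℝ → List ℝ → Set
    Separated L U = All (λ l → All (l ≤_) U) L

    separate : ∀ {L U} → Separated L U →
               ∃ λ t → t ∈ˡ (0# ∷ L ++ U) × All (_≤ t) L × All (t ≤_) U
    separate {[]}    {[]}    s = 0# , here ≡.refl , [] , []
    separate {[]}    {u ∷ U} s with minimum u U
    ... | m , m∈ , m≤U = m , there m∈ , [] , m≤U
    separate {l ∷ L} {U} s with maximum l L
    ... | m , m∈ , L≤m = m , there (∈-++⁺ˡ m∈) , L≤m , All.lookup s m∈

    eliminate₂-sound : ∀ {t} {x : Vec ℝ n} H H′ → (t ∷ x) ∈ᴴ H → (t ∷ x) ∈ᴴ H′ → x ∈ᴾ eliminate₂ H H′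
    eliminate₂-sound {t = t} {x} (halfSpace (α ∷ a) b) (halfSpace (β ∷ c) d) p q
      with α ≤? 0# | 0# ≤? α | 0# ≤? β
    ... | yes u | yes v | _     = ≤-resp
            (trans (+-congʳ (trans (*-congʳ (≤-antisym u v)) (zeroˡ t))) (+-identityˡ _)) refl p ∷ []
    ... | no u  | _     | no v  = ≤-shift
            (trans (solve 7 (λ α b s β d r t →
                 α :* d :+ :- β :* b :- (α :* (β :* t :+ r) :+ :- β :* (α :* t :+ s)) :=
                 α :* d :- β :* b :- (α :* r :- β :* s)) refl α b (a · x) β d (c · x) t)
              (+-congˡ (-‿cong (sym (·-combination α β c a x)))))
            (+-mono-≤ (*-monoˡ-≤ (≰⇒≥ u) q) (*-monoˡ-≤ (≰⇒≥ (v ∘ -x≤0⇒0≤x)) p)) ∷ []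
    ... | yes _ | no _  | _     = []
    ... | no _  | _     | yes _ = []

    eliminate₂-flat : ∀ {x : Vec ℝ n} H H′ → x ∈ᴾ eliminate₂ H H′ → Consistent (fibre x H)
    eliminate₂-flat {x = x} H H′ p with fibre x H
    eliminate₂-flat (halfSpace (α ∷ a) b) (halfSpace (β ∷ c) d) p | flat u v _
      with α ≤? 0# | 0# ≤? α | p
    ... | yes _ | yes _ | q ∷ [] = q
    ... | no ¬u | _     | _      = ⊥-elim (¬u u)
    ... | yes _ | no ¬v | _      = ⊥-elim (¬v v)
    eliminate₂-flat _ _ _ | above _ _ _   = tt
    eliminate₂-flat _ _ _ | below _ _ _ _ = tt

    eliminate₂-separated : ∀ {x : Vec ℝ n} {H H′} (φ : Fibre x H) (φ′ : Fibre x H′) →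
                           x ∈ᴾ eliminate₂ H H′ → Separated (low φ′) (high φ)
    eliminate₂-separated φ (flat _ _ _)    p = []
    eliminate₂-separated φ (below _ _ _ _) p = []
    eliminate₂-separated (flat _ _ _)  (above _ _ _) p = [] ∷ []
    eliminate₂-separated (above _ _ _) (above _ _ _) p = [] ∷ []
    eliminate₂-separated {x = x} (below {α} {a} {b} α>0 e αe≈ _) (above {β} {c} {d} β<0 e′ e′⇔) p
      with α ≤? 0# | 0# ≤? β | p
    ... | yes u | _     | _      = ⊥-elim (α>0 u)
    ... | no _  | yes v | _      = ⊥-elim (β<0 v)
    ... | no _  | no _  | q ∷ [] = (Equivalence.from (e′⇔ e) (*-cancelˡ-≤ α>0 (≤-shift lemma q)) ∷ []) ∷ []
      where
      open SetoidReasoning setoid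
      lemma : α * d - β * b - zipWith (λ c a → α * c - β * a) c a · x ≈ α * d - α * (β * e + c · x)
      lemma = begin
        α * d - β * b - zipWith (λ c a → α * c - β * a) c a · x
          ≈⟨ +-congˡ (-‿cong (·-combination α β c a x)) ⟩
        α * d - β * b - (α * (c · x) - β * (a · x))
          ≈⟨ solve 6 (λ α β b d r s → α :* d :- β :* b :- (α :* r :- β :* s) :=
               α :* d :- (β :* (b :- s) :+ α :* r)) refl α β b d (c · x) (a · x) ⟩
        α * d - (β * (b - a · x) + α * (c · x))
          ≈⟨ +-congˡ (-‿cong (+-congʳ (*-congˡ αe≈))) ⟨
        α * d - (β * (α * e) + α * (c · x))
          ≈⟨ solve 5 (λ α β d e r → α :* d :- (β :* (α :* e) :+ α :* r) :=
               α :* d :- α :* (β :* e :+ r)) refl α β d e (c · x) ⟩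
        α * d - α * (β * e + c · x) ∎

  open FibreEndpoints public

  candidates : Vec ℝ n → Polyhedron (suc n) → List ℝ
  candidates x P = 0# ∷ lows x P ++ highs x P

  private
    pairs : ∀ {x : Vec ℝ n} P → x ∈ᴾ eliminate P → ∀ {H H′} → H ∈ˡ P → H′ ∈ˡ P → x ∈ᴾ eliminate₂ H H′
    pairs P p H∈ H′∈ = All.lookup (map⁻ (concat⁻ p)) (∈-cartesianProduct⁺ H∈ H′∈)

    candidate : ∀ {x : Vec ℝ n} P → All (λ H → Consistent (fibre x H)) P →
                Separated (lows x P) (highs x P) → ∃ λ t → t ∈ˡ candidates x P × (t ∷ x) ∈ᴾ P
    candidate P c s with separate s
    ... | t , t∈ , l , h = t , t∈ , fibres-complete P c l h

  ∈-eliminate⁻ : ∀ {x : Vec ℝ n} P → x ∈ᴾ eliminate P → ∃ λ t → (t ∷ x) ∈ᴾ P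
  ∈-eliminate⁻ {x = x} P p with candidate P
    (All.tabulate λ {H} H∈ → eliminate₂-flat H H (pairs P p H∈ H∈))
    (concat⁺ (map⁺ (All.tabulate λ {H′} H′∈ → separated H′∈ (fibre x H′) ≡.refl)))
    where
    separated : ∀ {H′} → H′ ∈ˡ P → (φ′ : Fibre x H′) → fibre x H′ ≡ φ′ → Separated (low φ′) (highs x P)
    separated H′∈ φ′ _ = All.tabulate λ {l} l∈ → concat⁺ (map⁺ (All.tabulate λ {H} H∈ →
      All.lookup (eliminate₂-separated (fibre x H) φ′ (pairs P p H∈ H′∈)) l∈))
  ... | t , _ , t∈P = t , t∈P

  ∈-eliminate⁺ : ∀ {x : Vec ℝ n} P {t} → (t ∷ x) ∈ᴾ P → x ∈ᴾ eliminate P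
  ∈-eliminate⁺ P p = concat⁺ (map⁺ {xs = cartesianProduct P P} (All.tabulate λ {(H , H′)} HH′∈ →
    let H∈ , H′∈ = ∈-cartesianProduct⁻ P P HH′∈
    in eliminate₂-sound H H′ (All.lookup p H∈) (All.lookup p H′∈)))

  ∈-candidates : ∀ {x : Vec ℝ n} P {t} → (t ∷ x) ∈ᴾ P → ∃ λ s → s ∈ˡ candidates x P × (s ∷ x) ∈ᴾ P
  ∈-candidates {x = x} P p = candidate P
    (All.map (λ {H} → consistent-sound (fibre x H)) p)
    (All.map (λ l≤t → All.map (≤-trans l≤t) (highs-sound P p)) (lows-sound P p))

module EulerCharacteristic (F : CompleteOrderedField) (K : CommutativeRing 0ℓ 0ℓ) where
  open CompleteOrderedField F using (_≤_) renaming (Carrier to ℝ)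
  open OrderedFieldProperties F
  open Polyhedra F
  open CommutativeRing K
  open IntegerMultiples K using (solve; _:=_; _:+_; _:*_; _:-_; :-_; con)
  open Sums K
  open Indicators K

  private variable
    m n : ℕ
    X : Set

  -- The Euler characteristic of a function on the line all of whose jumps are
  -- at the given points, listed in increasing order.
  euler : List ℝ → (ℝ → Carrier) → Carrier
  euler []           φ = 0#
  euler (p ∷ [])     φ = φ p
  euler (p ∷ q ∷ ps) φ = (φ p - φ (midpoint p q)) + euler (q ∷ ps) φ

  euler-cong : ∀ ps {φ ψ} → (∀ t → φ t ≈ ψ t) → euler ps φ ≈ euler ps ψ
  euler-cong []           e = refl
  euler-cong (p ∷ [])     e = e p
  euler-cong (p ∷ q ∷ ps) e = +-cong (+-cong (e p) (-‿cong (e _))) (euler-cong (q ∷ ps) e)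

  euler-0 : ∀ ps → euler ps (λ _ → 0#) ≈ 0#
  euler-0 []           = refl
  euler-0 (p ∷ [])     = refl
  euler-0 (p ∷ q ∷ ps) = trans (+-cong (-‿inverseʳ 0#) (euler-0 (q ∷ ps))) (+-identityˡ 0#)

  euler-∑ : ∀ ps (f : Combination X) (φ : X → ℝ → Carrier) →
            ∑ f (λ x → euler ps (φ x)) ≈ euler ps (λ t → ∑ f (λ x → φ x t))
  euler-∑ []           f φ = ∑-0 f
  euler-∑ (p ∷ [])     f φ = refl
  euler-∑ (p ∷ q ∷ ps) f φ = trans (∑-+ f _ _) (+-cong
    (trans (∑-+ f _ _) (+-congˡ ∑-‿)) (euler-∑ (q ∷ ps) f φ))
    where
    ∑-‿ : ∑ f (λ x → - φ x (midpoint p q)) ≈ - ∑ f (λ x → φ x (midpoint p q))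
    ∑-‿ = trans (∑-cong f (λ x → solve 1 (λ y → :- y := :- con 1ℤ :* y) refl _))
      (trans (∑-*ˡ f (- 1#) _) (solve 1 (λ y → :- con 1ℤ :* y := :- y) refl _))

  private
    Outside : ℝ → ℝ → ℝ → Set
    Outside p q e = e ≤ p ⊎ q ≤ e

    module _ {x : Vec ℝ n} where
      convexᴴ : ∀ {p t q} → p ≤ t → t ≤ q → ∀ {H} (φ : Fibre x H) →
                (p ∷ x) ∈ᴴ H → (q ∷ x) ∈ᴴ H → (t ∷ x) ∈ᴴ H
      convexᴴ p≤t t≤q (flat _ _ e⇔)    p∈ q∈ = Equivalence.to (e⇔ _) (Equivalence.from (e⇔ _) p∈)
      convexᴴ p≤t t≤q (above _ _ e⇔)   p∈ q∈ = Equivalence.to (e⇔ _) (≤-trans (Equivalence.from (e⇔ _) p∈) p≤t)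
      convexᴴ p≤t t≤q (below _ _ _ e⇔) p∈ q∈ = Equivalence.to (e⇔ _) (≤-trans t≤q (Equivalence.from (e⇔ _) q∈))

      convex : ∀ {p t q} P → p ≤ t → t ≤ q → (p ∷ x) ∈ᴾ P → (q ∷ x) ∈ᴾ P → (t ∷ x) ∈ᴾ P
      convex P p≤t t≤q p∈ q∈ = All.zipWith (λ {H} (p , q) → convexᴴ p≤t t≤q (fibre x H) p q) (p∈ , q∈)

      midpointᴴ : ∀ {p q} → p ≤ q → ∀ {H} (φ : Fibre x H) → All (Outside p q) (low φ) → All (Outside p q) (high φ) →
                  (midpoint p q ∷ x) ∈ᴴ H → (p ∷ x) ∈ᴴ H × (q ∷ x) ∈ᴴ H
      midpointᴴ p≤q (flat _ _ e⇔) _ _ m∈ = Equivalence.to (e⇔ _) c , Equivalence.to (e⇔ _) c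
        where c = Equivalence.from (e⇔ _) m∈
      midpointᴴ {p} {q} p≤q (above _ e e⇔) (o ∷ []) _ m∈ =
        Equivalence.to (e⇔ _) e≤p , Equivalence.to (e⇔ _) (≤-trans e≤p p≤q)
        where
        e≤m = Equivalence.from (e⇔ _) m∈
        e≤p : e ≤ p
        e≤p = [ id , (λ r → ≤-trans e≤m (≤-trans (midpoint-≤ p≤q) (≤-midpoint⇒≥ (≤-trans r e≤m)))) ]′ o
      midpointᴴ {p} {q} p≤q (below _ e _ e⇔) _ (o ∷ []) m∈ =
        Equivalence.to (e⇔ _) (≤-trans p≤q q≤e) , Equivalence.to (e⇔ _) q≤e
        where
        m≤e = Equivalence.from (e⇔ _) m∈
        q≤e : q ≤ e
        q≤e = [ (λ r → ≤-trans (midpoint-≤⇒≥ (≤-trans m≤e r)) (≤-trans (≤-midpoint p≤q) m≤e)) , id ]′ o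

      midpointᴾ : ∀ {p q} P → p ≤ q → All (Outside p q) (lows x P) → All (Outside p q) (highs x P) →
                  (midpoint p q ∷ x) ∈ᴾ P → (p ∷ x) ∈ᴾ P × (q ∷ x) ∈ᴾ P
      midpointᴾ P p≤q l h m∈ = All.unzip (All.zipWith
        (λ {H} (l , h , m) → midpointᴴ p≤q (fibre x H) l h m)
        (map⁻ (concat⁻ l) , All.zip (map⁻ (concat⁻ h) , m∈)))

    Reached : ℝ → List ℝ → ℝ → Set
    Reached p ps e = e ≤ p ⊎ e ∈ˡ ps

    reached⇒outside : ∀ {p q ps e} → All (q ≤_) ps → Reached p (q ∷ ps) e → Outside p q e
    reached⇒outside s (inj₁ e≤p)            = inj₁ e≤p
    reached⇒outside s (inj₂ (here ≡.refl))  = inj₂ ≤-refl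
    reached⇒outside s (inj₂ (there e∈))     = inj₂ (All.lookup s e∈)

    reached-step : ∀ {p q ps e} → p ≤ q → Reached p (q ∷ ps) e → Reached q ps e
    reached-step p≤q (inj₁ e≤p)           = inj₁ (≤-trans e≤p p≤q)
    reached-step p≤q (inj₂ (here ≡.refl)) = inj₁ ≤-refl
    reached-step p≤q (inj₂ (there e∈))    = inj₂ e∈

    module _ (x : Vec ℝ n) (P : Polyhedron (suc n)) where
      In : ℝ → Set
      In t = (t ∷ x) ∈ᴾ P

      in? : ∀ t → Dec (In t)
      in? t = (t ∷ x) ∈ᴾ? P

      euler-𝟙 : ∀ p ps → AllPairs _≤_ (p ∷ ps) →
                All (Reached p ps) (lows x P) → All (Reached p ps) (highs x P) →
                euler (p ∷ ps) (λ t → 𝟙 (in? t)) ≈ 𝟙 (any? in? (p ∷ ps))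
      euler-𝟙 p []       s l h = 𝟙-cong (in? p) (any? in? (p ∷ [])) here λ { (here i) → i }
      euler-𝟙 p (q ∷ ps) ((p≤q ∷ p≤ps) ∷ (q≤ps ∷ s)) l h = trans (+-congˡ rest) (step (in? p) (in? q))
        where
        rest = euler-𝟙 q ps (q≤ps ∷ s) (All.map (reached-step p≤q) l) (All.map (reached-step p≤q) h)
        mid = midpoint p q

        mid⇒ : In mid → In p × In q
        mid⇒ = midpointᴾ P p≤q (All.map (reached⇒outside q≤ps) l) (All.map (reached⇒outside q≤ps) h)

        q-first : In p → Any In (q ∷ ps) → In q
        q-first i (here j)  = j
        q-first i (there j) = let r , r∈ , k = find j in convex P p≤q (All.lookup q≤ps r∈) i k

        step : Dec (In p) → Dec (In q) →
               (𝟙 (in? p) - 𝟙 (in? mid)) + 𝟙 (any? in? (q ∷ ps)) ≈ 𝟙 (any? in? (p ∷ q ∷ ps))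
        step (yes i) (yes j) = trans
          (+-cong (trans (+-cong (𝟙-yes (in? p) i)
              (-‿cong (𝟙-yes (in? mid) (convex P (≤-midpoint p≤q) (midpoint-≤ p≤q) i j)))) (-‿inverseʳ 1#))
            (𝟙-yes (any? in? (q ∷ ps)) (here j)))
          (trans (+-identityˡ 1#) (sym (𝟙-yes (any? in? (p ∷ q ∷ ps)) (here i))))
        step (yes i) (no ¬j) = trans
          (+-cong (+-cong (𝟙-yes (in? p) i) (-‿cong (𝟙-no (in? mid) (¬j ∘ proj₂ ∘ mid⇒))))
            (𝟙-no (any? in? (q ∷ ps)) (¬j ∘ q-first i)))
          (trans (solve 0 (con 1ℤ :- con 0ℤ :+ con 0ℤ := con 1ℤ) refl)
            (sym (𝟙-yes (any? in? (p ∷ q ∷ ps)) (here i))))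
        step (no ¬i) _ = trans
          (+-cong (+-cong (𝟙-no (in? p) ¬i) (-‿cong (𝟙-no (in? mid) (¬i ∘ proj₁ ∘ mid⇒))))
            (𝟙-cong (any? in? (q ∷ ps)) (any? in? (p ∷ q ∷ ps)) there λ { (here i) → ⊥-elim (¬i i) ; (there j) → j }))
          (solve 1 (λ y → (con 0ℤ :- con 0ℤ) :+ y := y) refl _)

    module Sort = Sorting decTotalOrder

    euler-eliminate : ∀ (x : Vec ℝ n) P ps → AllPairs _≤_ ps → (∀ {t} → t ∈ˡ candidates x P → t ∈ˡ ps) →
                      euler ps (λ t → 𝟙 ((t ∷ x) ∈ᴾ? P)) ≈ 𝟙 (x ∈ᴾ? eliminate P)
    euler-eliminate x P []       s c with c (here ≡.refl)
    ... | ()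
    euler-eliminate x P (p ∷ ps) s c = trans
      (euler-𝟙 x P p ps s
        (All.tabulate (λ e∈ → reached (c (there (∈-++⁺ˡ e∈)))))
        (All.tabulate (λ e∈ → reached (c (there (∈-++⁺ʳ (lows x P) e∈))))))
      (𝟙-cong (any? (in? x P) (p ∷ ps)) (x ∈ᴾ? eliminate P)
        (λ a → let _ , _ , i = find a in ∈-eliminate⁺ P i)
        (λ i → let _ , j = ∈-eliminate⁻ P i
                   _ , t∈ , k = ∈-candidates P j
               in lose (c t∈) k))
      where
      reached : ∀ {e} → e ∈ˡ (p ∷ ps) → Reached p ps e
      reached (here ≡.refl) = inj₁ ≤-refl
      reached (there e∈)    = inj₂ e∈

  ∑-eliminate : ∀ (f : Combination X) (P : X → Polyhedron (suc n)) →
                (∀ w → ∑ f (λ y → 𝟙 (w ∈ᴾ? P y)) ≈ 0#) →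
                ∀ x → ∑ f (λ y → 𝟙 (x ∈ᴾ? eliminate (P y))) ≈ 0#
  ∑-eliminate f P f≈0 x = begin
    ∑ f (λ y → 𝟙 (x ∈ᴾ? eliminate (P y)))
      ≈⟨ ∑-cong-∈ f (λ {a} {y} y∈ → euler-eliminate x (P y) grid sorted (∈-grid y∈)) ⟨
    ∑ f (λ y → euler grid (λ t → 𝟙 ((t ∷ x) ∈ᴾ? P y)))
      ≈⟨ euler-∑ grid f (λ y t → 𝟙 ((t ∷ x) ∈ᴾ? P y)) ⟩
    euler grid (λ t → ∑ f (λ y → 𝟙 ((t ∷ x) ∈ᴾ? P y)))
      ≈⟨ euler-cong grid (λ t → f≈0 (t ∷ x)) ⟩
    euler grid (λ _ → 0#)
      ≈⟨ euler-0 grid ⟩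
    0# ∎
    where
    open SetoidReasoning setoid
    points = concatMap (λ (_ , y) → candidates x (P y)) f
    grid = Sort.sort points
    sorted : AllPairs _≤_ grid
    sorted = Sorted⇒AllPairs (DecTotalOrder.totalOrder decTotalOrder) (Sort.sort-↗ points)
    ∈-grid : ∀ {a y t} → (a , y) ∈ˡ f → t ∈ˡ candidates x (P y) → t ∈ˡ grid
    ∈-grid y∈ t∈ = ∈-resp-↭ (↭-sym (Sort.sort-↭ points))
      (∈-concatMap⁺ (λ (_ , y) → candidates x (P y)) (lose y∈ t∈))

  ∑-project : ∀ m (f : Combination X) (P : X → Polyhedron (m ℕ.+ n)) →
              (∀ w → ∑ f (λ y → 𝟙 (w ∈ᴾ? P y)) ≈ 0#) →
              ∀ x → ∑ f (λ y → 𝟙 (x ∈ᴾ? project m (P y))) ≈ 0#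
  ∑-project zero    f P f≈0 = f≈0
  ∑-project (suc m) f P f≈0 = ∑-project m f (eliminate ∘ P) (∑-eliminate f P f≈0)

module MinkowskiSum (F : CompleteOrderedField) where
  open CompleteOrderedField F renaming (Carrier to ℝ)
  open OrderedFieldProperties F
  open Polyhedra F
  open IntegerMultiples commutativeRing

  private variable
    m n : ℕ

  infixl 6 _⊕_

  -- Half-spaces of pairs (y , x): those with x - y in H, and those with y in H
  private
    differenceIn firstIn : HalfSpace n → HalfSpace (n ℕ.+ n)
    differenceIn (halfSpace a b) = halfSpace (Vec.map -_ a Vec.++ a) b
    firstIn      (halfSpace a b) = halfSpace (a Vec.++ 0ᵛ) b

    graph : Polyhedron n → Polyhedron n → Polyhedron (n ℕ.+ n)
    graph A B = map differenceIn A ++ map firstIn B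

  _⊕_ : Op₂ (Polyhedron n)
  _⊕_ {n} A B = project n (graph A B)

  ∈-project : ∀ m (P : Polyhedron (m ℕ.+ n)) x → x ∈ᴾ project m P ⇔ ∃ λ y → (y Vec.++ x) ∈ᴾ P
  ∈-project zero    P x = mk⇔ ([] ,_) λ { ([] , p) → p }
  ∈-project (suc m) P x = mk⇔
    (λ p → let y , q = Equivalence.to (∈-project m (eliminate P) x) p
               t , r = ∈-eliminate⁻ P q
           in t ∷ y , r)
    (λ { (t ∷ y , r) → Equivalence.from (∈-project m (eliminate P) x) (y , ∈-eliminate⁺ P r) })

  private
    ·-++ : ∀ (a : Vec ℝ m) (c : Vec ℝ n) y x → (a Vec.++ c) · (y Vec.++ x) ≈ a · y + c · x
    ·-++ []       c []       x = sym (+-identityˡ _)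
    ·-++ (a ∷ as) c (y ∷ ys) x = trans (+-congˡ (·-++ as c ys x)) (sym (+-assoc _ _ _))

    0ᵛ-· : ∀ (x : Vec ℝ n) → 0ᵛ · x ≈ 0#
    0ᵛ-· []       = refl
    0ᵛ-· (x ∷ xs) = trans (+-cong (zeroˡ x) (0ᵛ-· xs)) (+-identityˡ 0#)

    ·-difference : ∀ (a x y : Vec ℝ n) → Vec.map -_ a · y + a · x ≈ a · (x -ᵛ y)
    ·-difference []       []       []       = +-identityˡ 0#
    ·-difference (a ∷ as) (x ∷ xs) (y ∷ ys) = trans
      (solve 5 (λ a x y r s → (:- a :* y :+ r) :+ (a :* x :+ s) := a :* (x :- y) :+ (r :+ s)) refl a x y _ _)
      (+-congˡ (·-difference as xs ys))

    ∈-differenceIn : ∀ (x y : Vec ℝ n) H → (y Vec.++ x) ∈ᴴ differenceIn H ⇔ (x -ᵛ y) ∈ᴴ H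
    ∈-differenceIn x y (halfSpace a b) = mk⇔ (≤-resp e refl) (≤-resp (sym e) refl)
      where e = trans (·-++ (Vec.map -_ a) a y x) (·-difference a x y)

    ∈-firstIn : ∀ (x y : Vec ℝ n) H → (y Vec.++ x) ∈ᴴ firstIn H ⇔ y ∈ᴴ H
    ∈-firstIn x y (halfSpace a b) = mk⇔ (≤-resp e refl) (≤-resp (sym e) refl)
      where e = trans (·-++ a 0ᵛ y x) (trans (+-congˡ (0ᵛ-· x)) (+-identityʳ _))

  ∈-graph : ∀ (A B : Polyhedron n) x y → (y Vec.++ x) ∈ᴾ graph A B ⇔ ((x -ᵛ y) ∈ᴾ A × y ∈ᴾ B)
  ∈-graph A B x y = mk⇔
    (λ p → All.map (λ {H} → Equivalence.to (∈-differenceIn x y H)) (map⁻ (++⁻ˡ (map differenceIn A) p)) ,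
           All.map (λ {H} → Equivalence.to (∈-firstIn x y H)) (map⁻ (++⁻ʳ (map differenceIn A) p)))
    (λ (p , q) → ++⁺ (map⁺ (All.map (λ {H} → Equivalence.from (∈-differenceIn x y H)) p))
                     (map⁺ (All.map (λ {H} → Equivalence.from (∈-firstIn x y H)) q)))

  private
    -ᵛ-+ᵛ : ∀ (x y : Vec ℝ n) → x ≐ (x -ᵛ y) +ᵛ y
    -ᵛ-+ᵛ []       []       = []
    -ᵛ-+ᵛ (x ∷ xs) (y ∷ ys) = solve 2 (λ x y → x := x :- y :+ y) refl x y ∷ -ᵛ-+ᵛ xs ys

    +ᵛ⇒-ᵛ : ∀ {x a y : Vec ℝ n} → x ≐ a +ᵛ y → a ≐ x -ᵛ y
    +ᵛ⇒-ᵛ {x = []}    {[]}    {[]}    []       = []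
    +ᵛ⇒-ᵛ {x = _ ∷ _} {a ∷ _} {y ∷ _} (p ∷ ps) =
      trans (solve 2 (λ a y → a := a :+ y :- y) refl a y) (+-congʳ (sym p)) ∷ +ᵛ⇒-ᵛ ps

  -- _⊕_ is the Minkowski sum.
  ∈-⊕ : ∀ (A B : Polyhedron n) w → w ∈ᴾ A ⊕ B ⇔ ∃₂ λ a b → a ∈ᴾ A × b ∈ᴾ B × w ≐ a +ᵛ b
  ∈-⊕ {n} A B w = mk⇔
    (λ p → let y , q = Equivalence.to (∈-project n (graph A B) w) p
               a∈ , y∈ = Equivalence.to (∈-graph A B w y) q
           in w -ᵛ y , y , a∈ , y∈ , -ᵛ-+ᵛ w y)
    (λ (a , b , a∈ , b∈ , e) → Equivalence.from (∈-project n (graph A B) w)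
           (b , Equivalence.from (∈-graph A B w b) (∈ᴾ-resp A (+ᵛ⇒-ᵛ e) a∈ , b∈)))

  box : (l u : Vec ℝ n) → Polyhedron n
  box []       []       = []
  box (l ∷ ls) (u ∷ us) =
    halfSpace (1# ∷ 0ᵛ) u ∷ halfSpace (- 1# ∷ 0ᵛ) (- l) ∷
    map (λ (halfSpace a b) → halfSpace (0# ∷ a) b) (box ls us)

  ∈-box : ∀ (l u w : Vec ℝ n) → w ∈ᴾ box l u ⇔ (Pointwise _≤_ l w × Pointwise _≤_ w u)
  ∈-box []       []       []       = mk⇔ (λ _ → [] , []) (λ _ → [])
  ∈-box (l ∷ ls) (u ∷ us) (w ∷ ws) = mk⇔
    (λ { (p ∷ q ∷ r) →
      let l≤ , ≤u = Equivalence.to (∈-box ls us ws) (All.map (≤-resp (0*+ _) refl) (map⁻ r))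
      in 0≤y-x⇒x≤y (≤-resp refl (solve 2 (λ l w → :- l :- :- w := w :- l) refl l w) (x≤y⇒0≤y-x (≤-resp -1*+ refl q))) ∷ l≤ ,
         ≤-resp 1*+ refl p ∷ ≤u })
    (λ { (p ∷ ps , q ∷ qs) →
      ≤-resp (sym 1*+) refl q ∷ ≤-resp (sym -1*+) refl (-‿anti-≤ p) ∷
      map⁺ (All.map (≤-resp (sym (0*+ _)) refl) (Equivalence.from (∈-box ls us ws) (ps , qs))) })
    where
    1*+ : 1# * w + 0ᵛ · ws ≈ w
    1*+ = trans (+-cong (*-identityˡ w) (0ᵛ-· ws)) (+-identityʳ w)
    -1*+ : - 1# * w + 0ᵛ · ws ≈ - w
    -1*+ = trans (+-congˡ (0ᵛ-· ws)) (solve 1 (λ w → :- con 1ℤ :* w :+ con 0ℤ := :- w) refl w)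
    0*+ : ∀ s → 0# * w + s ≈ s
    0*+ s = trans (+-congʳ (zeroˡ w)) (+-identityˡ s)

  origin : Polyhedron n
  origin = box 0ᵛ 0ᵛ

  private
    to : ∀ {A B : Set} → A ⇔ B → A → B
    to = Equivalence.to
    from : ∀ {A B : Set} → A ⇔ B → B → A
    from = Equivalence.from

    ≐-refl : {x : Vec ℝ n} → x ≐ x
    ≐-refl = Pointwise.refl refl

    ≐-trans : {x y z : Vec ℝ n} → x ≐ y → y ≐ z → x ≐ z
    ≐-trans = Pointwise.trans trans

    ≐-sym : {x y : Vec ℝ n} → x ≐ y → y ≐ x
    ≐-sym = Pointwise.sym sym

    +ᵛ-cong : ∀ {x x′ y y′ : Vec ℝ n} → x ≐ x′ → y ≐ y′ → x +ᵛ y ≐ x′ +ᵛ y′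
    +ᵛ-cong []       []       = []
    +ᵛ-cong (p ∷ ps) (q ∷ qs) = +-cong p q ∷ +ᵛ-cong ps qs

    +ᵛ-assoc : ∀ (x y z : Vec ℝ n) → (x +ᵛ y) +ᵛ z ≐ x +ᵛ (y +ᵛ z)
    +ᵛ-assoc []       []       []       = []
    +ᵛ-assoc (x ∷ xs) (y ∷ ys) (z ∷ zs) = +-assoc x y z ∷ +ᵛ-assoc xs ys zs

    +ᵛ-comm : ∀ (x y : Vec ℝ n) → x +ᵛ y ≐ y +ᵛ x
    +ᵛ-comm []       []       = []
    +ᵛ-comm (x ∷ xs) (y ∷ ys) = +-comm x y ∷ +ᵛ-comm xs ys

    +ᵛ-identityˡ : ∀ (x : Vec ℝ n) → 0ᵛ +ᵛ x ≐ x
    +ᵛ-identityˡ []       = []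
    +ᵛ-identityˡ (x ∷ xs) = +-identityˡ x ∷ +ᵛ-identityˡ xs

    antisym : ∀ {x y : Vec ℝ n} → Pointwise _≤_ x y → Pointwise _≤_ y x → x ≐ y
    antisym []       []       = []
    antisym (p ∷ ps) (q ∷ qs) = ≤-antisym p q ∷ antisym ps qs

  ∈-origin : ∀ (w : Vec ℝ n) → w ∈ᴾ origin ⇔ w ≐ 0ᵛ
  ∈-origin w = mk⇔
    (λ p → let l , u = to (∈-box 0ᵛ 0ᵛ w) p in antisym u l)
    (λ e → from (∈-box 0ᵛ 0ᵛ w) (Pointwise.map (≤-reflexive ∘ sym) (≐-sym′ e) , Pointwise.map ≤-reflexive e))
    where
    ≐-sym′ : ∀ {x y : Vec ℝ n} → x ≐ y → Pointwise (λ a b → b ≈ a) y x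
    ≐-sym′ []       = []
    ≐-sym′ (p ∷ ps) = p ∷ ≐-sym′ ps

  ⊕-comm : ∀ (A B : Polyhedron n) w → w ∈ᴾ A ⊕ B → w ∈ᴾ B ⊕ A
  ⊕-comm A B w p =
    let a , b , a∈ , b∈ , e = to (∈-⊕ A B w) p
    in from (∈-⊕ B A w) (b , a , b∈ , a∈ , ≐-trans e (+ᵛ-comm a b))

  ⊕-assoc⇒ : ∀ (A B C : Polyhedron n) w → w ∈ᴾ (A ⊕ B) ⊕ C → w ∈ᴾ A ⊕ (B ⊕ C)
  ⊕-assoc⇒ A B C w p =
    let s , c , s∈ , c∈ , e = to (∈-⊕ (A ⊕ B) C w) p
        a , b , a∈ , b∈ , e′ = to (∈-⊕ A B s) s∈
    in from (∈-⊕ A (B ⊕ C) w)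
         (a , b +ᵛ c , a∈ , from (∈-⊕ B C (b +ᵛ c)) (b , c , b∈ , c∈ , ≐-refl) ,
          ≐-trans e (≐-trans (+ᵛ-cong e′ ≐-refl) (+ᵛ-assoc a b c)))

  ⊕-assoc⇐ : ∀ (A B C : Polyhedron n) w → w ∈ᴾ A ⊕ (B ⊕ C) → w ∈ᴾ (A ⊕ B) ⊕ C
  ⊕-assoc⇐ A B C w p =
    let a , s , a∈ , s∈ , e = to (∈-⊕ A (B ⊕ C) w) p
        b , c , b∈ , c∈ , e′ = to (∈-⊕ B C s) s∈
    in from (∈-⊕ (A ⊕ B) C w)
         (a +ᵛ b , c , from (∈-⊕ A B (a +ᵛ b)) (a , b , a∈ , b∈ , ≐-refl) , c∈ ,
          ≐-trans e (≐-trans (+ᵛ-cong ≐-refl e′) (≐-sym (+ᵛ-assoc a b c))))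

  ⊕-identityˡ⇒ : ∀ (A : Polyhedron n) w → w ∈ᴾ origin ⊕ A → w ∈ᴾ A
  ⊕-identityˡ⇒ A w p =
    let o , a , o∈ , a∈ , e = to (∈-⊕ origin A w) p
    in ∈ᴾ-resp A (≐-sym (≐-trans e (≐-trans (+ᵛ-cong (to (∈-origin o) o∈) ≐-refl) (+ᵛ-identityˡ a)))) a∈

  ⊕-identityˡ⇐ : ∀ (A : Polyhedron n) w → w ∈ᴾ A → w ∈ᴾ origin ⊕ A
  ⊕-identityˡ⇐ A w p = from (∈-⊕ origin A w)
    (0ᵛ , w , from (∈-origin 0ᵛ) ≐-refl , p , ≐-sym (+ᵛ-identityˡ w))

  module Bilinearity (K : CommutativeRing 0ℓ 0ℓ) where
    private module K = CommutativeRing K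
    open Sums K
    open Indicators K
    open EulerCharacteristic F K

    -- The Minkowski product is well defined: a linear relation between
    -- indicator functions persists after adding B to every polyhedron.
    ∑-⊕ : ∀ (f : Combination (Polyhedron n)) B → (∀ w → ∑ f (λ A → 𝟙 (w ∈ᴾ? A)) K.≈ K.0#) →
          ∀ w → ∑ f (λ A → 𝟙 (w ∈ᴾ? A ⊕ B)) K.≈ K.0#
    ∑-⊕ {n} f B f≈0 = ∑-project n f (λ A → graph A B) λ yx → vanish yx (Vec.splitAt n yx)
      where
      vanish : ∀ yx → (∃₂ λ y x → yx ≡ y Vec.++ x) → ∑ f (λ A → 𝟙 (yx ∈ᴾ? graph A B)) K.≈ K.0#
      vanish _ (y , x , ≡.refl) with y ∈ᴾ? B
      ... | yes y∈ = K.trans (∑-cong f λ A → 𝟙-cong ((y Vec.++ x) ∈ᴾ? graph A B) ((x -ᵛ y) ∈ᴾ? A)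
                       (proj₁ ∘ to (∈-graph A B x y)) (λ p → from (∈-graph A B x y) (p , y∈))) (f≈0 (x -ᵛ y))
      ... | no y∉  = K.trans (∑-cong f λ A → 𝟙-no ((y Vec.++ x) ∈ᴾ? graph A B)
                       (y∉ ∘ proj₂ ∘ to (∈-graph A B x y))) (∑-0 f)

-- K[x₁^±1 , … , x_d^±1 , y₁^±1 , … , y_d^±1] as the algebra of formal
-- combinations of monomials, compared coefficient by coefficient; the monomial
-- x^α y^β is the pair (α , β).
module LaurentPolynomials (K : CommutativeRing 0ℓ 0ℓ) (d : ℕ) where
  open CommutativeRing K using (Carrier; _≈_; 1#; trans; reflexive)
  open Sums K
  open Indicators K

  Monomial : Set
  Monomial = Vec ℤ d × Vec ℤ d

  infix 4 _≟ᵐ_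
  _≟ᵐ_ : (u v : Monomial) → Dec (u ≡ v)
  _≟ᵐ_ = ×-≡-dec (Vec.≡-dec ℤ._≟_) (Vec.≡-dec ℤ._≟_)

  infixl 7 _∙_
  _∙_ : Op₂ Monomial
  (α , β) ∙ (α′ , β′) = zipWith ℤ._+_ α α′ , zipWith ℤ._+_ β β′

  𝟘 : Vec ℤ d
  𝟘 = replicate d 0ℤ

  coefficient : Monomial → Monomial → Carrier
  coefficient u v = 𝟙 (u ≟ᵐ v)

  module LaurentCombination = CombinationRing K coefficient _∙_ (𝟘 , 𝟘)

  infix 8 _⁻
  _⁻ : Monomial → Monomial
  (α , β) ⁻ = Vec.map ℤ.-_ α , Vec.map ℤ.-_ β

  ∙-assoc : ∀ u v w → (u ∙ v) ∙ w ≡ u ∙ (v ∙ w)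
  ∙-assoc (α , β) (α′ , β′) (α″ , β″) =
    ≡.cong₂ _,_ (Vec.zipWith-assoc ℤ.+-assoc α α′ α″) (Vec.zipWith-assoc ℤ.+-assoc β β′ β″)

  ∙-comm : ∀ u v → u ∙ v ≡ v ∙ u
  ∙-comm (α , β) (α′ , β′) =
    ≡.cong₂ _,_ (Vec.zipWith-comm ℤ.+-comm α α′) (Vec.zipWith-comm ℤ.+-comm β β′)

  ∙-identityˡ : ∀ u → (𝟘 , 𝟘) ∙ u ≡ u
  ∙-identityˡ (α , β) =
    ≡.cong₂ _,_ (Vec.zipWith-identityˡ ℤ.+-identityˡ α) (Vec.zipWith-identityˡ ℤ.+-identityˡ β)

  ∙-identityʳ : ∀ u → u ∙ (𝟘 , 𝟘) ≡ u
  ∙-identityʳ u = ≡.trans (∙-comm u _) (∙-identityˡ u)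

  ∙-inverseˡ : ∀ u → u ⁻ ∙ u ≡ (𝟘 , 𝟘)
  ∙-inverseˡ (α , β) =
    ≡.cong₂ _,_ (Vec.zipWith-inverseˡ ℤ.+-inverseˡ α) (Vec.zipWith-inverseˡ ℤ.+-inverseˡ β)

  ∙-inverseʳ : ∀ u → u ∙ u ⁻ ≡ (𝟘 , 𝟘)
  ∙-inverseʳ u = ≡.trans (∙-comm u _) (∙-inverseˡ u)

  coefficient-translate : ∀ u v w → coefficient (u ∙ v) w ≈ coefficient u (w ∙ v ⁻)
  coefficient-translate u v w = 𝟙-cong (u ∙ v ≟ᵐ w) (u ≟ᵐ w ∙ v ⁻)
    (λ { ≡.refl → ≡.sym (undo u v (v ⁻) (∙-inverseʳ v)) })
    (λ { ≡.refl → undo w (v ⁻) v (∙-inverseˡ v) })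
    where
    undo : ∀ a b c → b ∙ c ≡ (𝟘 , 𝟘) → (a ∙ b) ∙ c ≡ a
    undo a b c bc≡𝟘 = ≡.trans (∙-assoc a b c) (≡.trans (≡.cong (a ∙_) bc≡𝟘) (∙-identityʳ a))

  Laurent : CommutativeAlgebra K
  Laurent = LaurentCombination.combinationAlgebra
    (λ u v w t → reflexive (≡.cong (λ m → coefficient m t) (∙-assoc u v w)))
    (λ u v t → reflexive (≡.cong (λ m → coefficient m t) (∙-comm u v)))
    (λ u t → reflexive (≡.cong (λ m → coefficient m t) (∙-identityˡ u)))
    (λ f v f≈0 t → trans (∑-cong f (λ u → coefficient-translate u v t)) (f≈0 (t ∙ v ⁻)))

  x y : Fin d → CommutativeAlgebra.Carrier Laurent
  x i = [ 1# , 𝟘 [ i ]≔ 1ℤ , 𝟘 ]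
  y i = [ 1# , 𝟘 , 𝟘 [ i ]≔ 1ℤ ]

  relation : Fin d → CommutativeAlgebra.Carrier Laurent
  relation i = (y i - 1ᴸ) * (y i - x i)
    where open CommutativeAlgebra Laurent using (_-_; _*_) renaming (1# to 1ᴸ)

module MinkowskiRings (F : CompleteOrderedField) (d : ℕ) where
  open CompleteOrderedField F using (_≤_) renaming (Carrier to ℝ; 0# to 0ℝ; 1# to 1ℝ)
  open IntegerMultiples (CompleteOrderedField.commutativeRing F) using (fromℤ)
  open Polyhedra F
  open MinkowskiSum F

  ℂ : CommutativeRing 0ℓ 0ℓ
  ℂ = complexNumbers (CompleteOrderedField.commutativeRing F)

  open CommutativeRing ℂ using () renaming (_≈_ to _≈ᶜ_; 0# to 0ᶜ; 1# to 1ᶜ)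
  open Indicators ℂ

  W : Set
  W = Vec ℝ d

  module PolyhedralCombination =
    CombinationRing ℂ {Polyhedron d} {W} (λ P w → 𝟙 (w ∈ᴾ? P)) _⊕_ origin

  -- M(𝒫(W)).  The formula [A] · [B] = [A + B] holds for empty polyhedra as
  -- well, since [∅] = 0 and ∅ + B = ∅.
  polyhedralAlgebra : CommutativeAlgebra ℂ
  polyhedralAlgebra = PolyhedralCombination.combinationAlgebra
    (λ A B C w → 𝟙-cong (w ∈ᴾ? (A ⊕ B) ⊕ C) (w ∈ᴾ? A ⊕ (B ⊕ C)) (⊕-assoc⇒ A B C w) (⊕-assoc⇐ A B C w))
    (λ A B w → 𝟙-cong (w ∈ᴾ? A ⊕ B) (w ∈ᴾ? B ⊕ A) (⊕-comm A B w) (⊕-comm B A w))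
    (λ A w → 𝟙-cong (w ∈ᴾ? origin ⊕ A) (w ∈ᴾ? A) (⊕-identityˡ⇒ A w) (⊕-identityˡ⇐ A w))
    (Bilinearity.∑-⊕ ℂ)

  indicator : Polyhedron d → CommutativeAlgebra.Carrier polyhedralAlgebra
  indicator P = [ 1ᶜ , P ]

  -- M(𝒟), for a set 𝒟 of polyhedra.
  minkowskiRing : Pred (Polyhedron d) 0ℓ → CommutativeAlgebra ℂ
  minkowskiRing 𝒟 = subalgebra polyhedralAlgebra {Σ (Polyhedron d) 𝒟} (λ (P , _) → indicator P)

  -- f = [S], for a set S that need not be given by inequalities.
  _isIndicatorOf_ : ∀ {𝒟} → CommutativeAlgebra.Carrier (minkowskiRing 𝒟) → Pred W 0ℓ → Set
  (f , _) isIndicatorOf S = ∀ w → (w ∈ S → ⟦ f ⟧ w ≈ᶜ 1ᶜ) × (¬ w ∈ S → ⟦ f ⟧ w ≈ᶜ 0ᶜ)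
    where open PolyhedralCombination using (⟦_⟧)

  LatticeBox : Pred (Polyhedron d) 0ℓ
  LatticeBox P = ∃₂ λ (a b : Vec ℤ d) → (∀ i → lookup a i ℤ.≤ lookup b i) ×
    ∀ w → w ∈ᴾ P ⇔ (∀ i → fromℤ (lookup a i) ≤ lookup w i × lookup w i ≤ fromℤ (lookup b i))

  ẽ : Fin d → W
  ẽ i = 0ᵛ [ i ]≔ 1ℝ

  π : Fin d → W → W
  π i w = 0ᵛ [ i ]≔ lookup w i

  ｛ẽ_｝ : Fin d → Pred W 0ℓ
  ｛ẽ i ｝ w = w ≐ ẽ i

  unitCube : Pred W 0ℓ
  unitCube c = ∀ i → 0ℝ ≤ lookup c i × lookup c i ≤ 1ℝ

  π[unitCube] : Fin d → Pred W 0ℓ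
  π[unitCube] i w = ∃ λ c → c ∈ unitCube × w ≐ π i c

module Boxes (F : CompleteOrderedField) (d : ℕ) where
  open MinkowskiRings F d public
  open LaurentPolynomials ℂ d public using (Laurent; x; y; relation)

  M𝓑 : CommutativeAlgebra ℂ
  M𝓑 = minkowskiRing LatticeBox

  module M𝓑 = CommutativeAlgebra M𝓑
  module Laurent = CommutativeAlgebra Laurent

  record IsBoxHomomorphism (φ : Laurent.Carrier → M𝓑.Carrier) : Set where
    field
      isAlgebraHomomorphism : IsAlgebraHomomorphism Laurent M𝓑 φ
      φx : ∀ i → φ (x i) isIndicatorOf ｛ẽ i ｝
      φy : ∀ i → φ (y i) isIndicatorOf π[unitCube] i

{-# OPTIONS --safe #-}
-- Write x and y for the point {1} and the interval [0,1] on one axis.  The relation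
-- (y - 1) (y - x) = 0 says that [0,2] is the union of [0,1] and [1,2], which meet
-- in {1}; it makes y invertible, with y⁻¹ = x⁻¹ (1 + x - y), so φ exists, and it is
-- surjective since a box is a product over the axes of the x^a y^n with n ≥ 0.
-- Modulo the relations every monomial is a combination of products over the axes
-- of the x^a and the x^a (y - 1 - x).  Under φ these products become the indicator
-- functions of the relatively open cells into which the lattice divides ℝ^d.
-- Evaluating at one sample point of each cell (integral or half-integral
-- coordinates) shows that a combination of them which φ kills has zero
-- coefficients; hence the kernel is generated by the relations.
module Submission where

open import Defs
open import Data.Nat.Base using (ℕ; _≤_)
open import Data.Product.Base using (_×_; ∃)
open import Function.Bundles using (_⇔_)
open import Function.Definitions using (Surjective)

open import Level using (0ℓ)
open import Algebra.Bundles using (CommutativeRing)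
open import Algebra.Morphism.Structures using (IsRingHomomorphism)
import Algebra.Properties.CommutativeMonoid.Sum as FiniteProducts
open import Algebra.Properties.CommutativeSemigroup using (interchange)
import Algebra.Properties.Ring as RingProperties
import Algebra.Properties.Semiring.Mult.TCOptimised as Multiples
open import Data.Bool.Base using (Bool; true; false)
open import Data.Bool.Properties using () renaming (_≟_ to _≟ᵇ_)
open import Data.Empty using (⊥-elim)
open import Data.Fin.Base using (Fin; zero; suc)
open import Data.Fin.Properties using () renaming (_≟_ to _≟ᶠ_)
open import Data.Integer.Base as ℤ using (ℤ; -[1+_]; 0ℤ; 1ℤ; -1ℤ)
import Data.Integer.Properties as ℤ
open import Data.List.Base using ([]; _∷_; [_]; map; _++_; deduplicate)
open import Data.List.Membership.Propositional using () renaming (_∈_ to _∈ˡ_)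
open import Data.List.Membership.Propositional.Properties using (∈-map⁺; ∈-deduplicate⁺)
import Data.List.Properties as List
open import Data.List.Relation.Unary.All as All using (All; []; _∷_)
open import Data.List.Relation.Unary.AllPairs using ([]; _∷_)
open import Data.List.Relation.Unary.Any using (here; there)
import Data.List.Relation.Unary.Unique.DecPropositional.Properties as Unique
open import Data.List.Relation.Unary.Unique.Propositional using (Unique)
open import Data.Nat.Base as ℕ using (zero; suc)
import Data.Nat.Properties as ℕ
open import Data.Product.Base using (Σ; _,_; proj₁; proj₂; map₁)
open import Data.Product.Properties using () renaming (≡-dec to ×-≡-dec)
open import Data.Sum.Base using (_⊎_; inj₁; inj₂; [_,_]′)
open import Data.Vec.Base as Vec using (Vec; []; _∷_; zipWith; replicate; lookup; tabulate; _[_]≔_)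
import Data.Vec.Properties as Vec
import Data.Vec.Relation.Binary.Pointwise.Extensional as Extensional
open import Data.Vec.Relation.Binary.Pointwise.Inductive as Pointwise using (Pointwise)
open import Function.Base using (_∘_; id)
open import Function.Bundles using (mk⇔; Equivalence)
open import Relation.Binary.Definitions using (DecidableEquality)
open import Relation.Binary.PropositionalEquality as ≡ using (_≡_)
import Relation.Binary.Reasoning.Setoid as SetoidReasoning
open import Relation.Nullary.Decidable using (Dec; yes; no; _×-dec_)
open import Relation.Nullary.Negation using (¬_)
open import Relation.Unary using (Pred; _∈_)

-- The formula for y⁻¹ is the general inverse (-1)^dim [-interior]: x⁻¹ (1 + x - y) is minus the
-- open interval from -1 to 0. In other words y (y - 1 - x) = -x modulo the relation, and this
-- identity is why points and open unit intervals together stay stable under multiplication by y and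
-- by y⁻¹. The products x^a and x^a y would span as well, but the cells are disjoint: their values
-- at the sample points form an identity matrix, so coefficients can be read off directly. The
-- obstacle is that a combination is a list which may repeat its terms, while Laurent polynomials
-- are compared by total coefficients and elements of M(B_d) by their values on W. Whatever is
-- computed from a list must therefore be shown to depend on the total coefficients alone. Reduction
-- and evaluation are both settled on one axis. They pass to d axes because monomials, boxes and
-- cells are all products over the axes, and a product of sums expands into a sum over tuples.

private variable
  X Y Z : Set
  n : ℕ

-- Formal linear combinations grouped by value.

module SumsByValue (K : CommutativeRing 0ℓ 0ℓ) {X : Set} (_≟_ : DecidableEquality X) where
  open CommutativeRing K
  open Sums K
  open Indicators K
  open SetoidReasoning setoid

  ∑-𝟙-∉ : ∀ (h : X → Carrier) {x} L → All (λ v → ¬ x ≡ v) L →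
          ∑ (map (λ v → h v , v) L) (λ v → 𝟙 (x ≟ v)) ≈ 0#
  ∑-𝟙-∉ h         []      []       = refl
  ∑-𝟙-∉ h {x}     (v ∷ L) (p ∷ ps) = trans
    (+-cong (trans (*-congˡ (𝟙-no (x ≟ v) p)) (zeroʳ (h v))) (∑-𝟙-∉ h L ps)) (+-identityˡ 0#)

  ∑-𝟙-∈ : ∀ (h : X → Carrier) {x} L → Unique L → x ∈ˡ L →
          ∑ (map (λ v → h v , v) L) (λ v → 𝟙 (x ≟ v)) ≈ h x
  ∑-𝟙-∈ h {x} (_ ∷ L) (x∉ ∷ _) (here ≡.refl) = trans
    (+-cong (trans (*-congˡ (𝟙-yes (x ≟ x) ≡.refl)) (*-identityʳ (h x))) (∑-𝟙-∉ h L x∉)) (+-identityʳ (h x))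
  ∑-𝟙-∈ h {x} (v ∷ L) (v∉ ∷ u) (there x∈) = trans
    (+-cong (trans (*-congˡ (𝟙-no (x ≟ v) λ { ≡.refl → All.lookup v∉ x∈ ≡.refl })) (zeroʳ (h v))) (∑-𝟙-∈ h L u x∈))
    (+-identityˡ (h x))

  -- Over the support without repetitions, h x is the sum of h v times the delta of x and v. After
  -- the two sums are exchanged, the inner one is the total coefficient of v, which is zero.
  ∑-vanishes : ∀ (f : Combination X) h → (∀ v → ∑ f (λ x → 𝟙 (x ≟ v)) ≈ 0#) → ∑ f h ≈ 0#
  ∑-vanishes f h f≈0 = begin
    ∑ f h                                ≈⟨ ∑-cong-∈ f (λ x∈ → ∑-𝟙-∈ h support unique (∈-deduplicate⁺ _≟_ (∈-map⁺ proj₂ x∈))) ⟨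
    ∑ f (λ x → ∑ values λ v → 𝟙 (x ≟ v))  ≈⟨ ∑-swap f values (λ x v → 𝟙 (x ≟ v)) ⟩
    ∑ values (λ v → ∑ f λ x → 𝟙 (x ≟ v))  ≈⟨ ∑-cong values f≈0 ⟩
    ∑ values (λ _ → 0#)                  ≈⟨ ∑-0 values ⟩
    0#                                   ∎
    where
    support = deduplicate _≟_ (map proj₂ f)
    unique = Unique.deduplicate-! _≟_ (map proj₂ f)
    values = map (λ v → h v , v) support

module _ (K : CommutativeRing 0ℓ 0ℓ) where
  open CommutativeRing K

  -- Lets statements about sums in an algebra, such as the expansion of a product of sums, be
  -- applied to the scalars themselves.
  selfAlgebra : CommutativeAlgebra K
  selfAlgebra = record
    { commutativeRing = K
    ; ι = id
    ; ι-isRingHomomorphism = record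
      { isSemiringHomomorphism = record
        { isNearSemiringHomomorphism = record
          { +-isMonoidHomomorphism = record
            { isMagmaHomomorphism = record
              { isRelHomomorphism = record { cong = id }
              ; homo = λ _ _ → refl
              }
            ; ε-homo = refl
            }
          ; *-homo = λ _ _ → refl
          }
        ; 1#-homo = refl
        }
      ; -‿homo = λ _ → refl
      }
    }

-- Products of sums, and integer powers.

module Tensors (K : CommutativeRing 0ℓ 0ℓ) where
  open CommutativeRing K using (Carrier; _*_; 1#)
  open Sums K using (Combination)

  combine : (X → Y → Z) → Combination X → Combination Y → Combination Z
  combine op []            g = []
  combine op ((a , x) ∷ f) g = map (λ (b , y) → a * b , op x y) g ++ combine op f g

  tensor : (Fin n → Combination X) → Combination (Vec X n)
  tensor {zero}  g = [ 1# , [] ]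
  tensor {suc n} g = combine _∷_ (g zero) (tensor (g ∘ suc))

module Products (R : CommutativeRing 0ℓ 0ℓ) where
  open CommutativeRing R hiding (zero)
  open FiniteProducts *-commutativeMonoid public
    renaming (sum to ∏; sum-cong-≋ to ∏-cong; ∑-distrib-+ to ∏-distrib-*; sum-replicate-zero to ∏-1)
    using ()
  open Indicators R

  ∏-𝟙 : ∀ {A : Set} {Q : Fin n → Set} (A? : Dec A) (Q? : ∀ i → Dec (Q i)) →
        (A → ∀ i → Q i) → ((∀ i → Q i) → A) → 𝟙 A? ≈ ∏ (λ i → 𝟙 (Q? i))
  ∏-𝟙 {zero}  A? Q? to from = 𝟙-yes A? (from λ ())
  ∏-𝟙 {suc n} {A} {Q} A? Q? to from with Q? zero
  ... | no ¬q = trans (𝟙-no A? (λ a → ¬q (to a zero))) (sym (zeroˡ _))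
  ... | yes q = trans (∏-𝟙 A? (Q? ∘ suc) (λ a i → to a (suc i)) λ r → from λ { zero → q ; (suc i) → r i })
                  (sym (*-identityˡ _))

  ∏-axis : ∀ {S : Set} (s₀ : S) (h : Fin n → S → Carrier) → (∀ i → h i s₀ ≈ 1#) →
           ∀ i s → ∏ (λ j → h j (lookup (replicate n s₀ [ i ]≔ s) j)) ≈ h i s
  ∏-axis {suc n} s₀ h h₀≈1 zero s = trans (*-congˡ (trans (∏-cong others) (∏-1 n))) (*-identityʳ _)
    where
    others : ∀ j → h (suc j) (lookup (replicate n s₀) j) ≈ 1#
    others j = trans (reflexive (≡.cong (h (suc j)) (Vec.lookup-replicate j s₀))) (h₀≈1 (suc j))
  ∏-axis {suc n} s₀ h h₀≈1 (suc i) s =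
    trans (*-cong (h₀≈1 zero) (∏-axis s₀ (h ∘ suc) (h₀≈1 ∘ suc) i s)) (*-identityˡ _)

  module _ {S : Set} (_∙_ : S → S → S) (s₀ : S)
    (identityˡ : ∀ s → s₀ ∙ s ≡ s) (identityʳ : ∀ s → s ∙ s₀ ≡ s) where

    -- A vector is the sum of its coordinate vectors. The first one is split off by writing `s ∷ v`
    -- as the sum of `s ∷ replicate n s₀` and `s₀ ∷ v`; then `h ∘ (s₀ ∷_)` is multiplicative again.
    -- This factors monomials into powers of single variables and boxes into segments on the axes.
    homomorphism-axes : (h : Vec S n → Carrier) → h (replicate n s₀) ≈ 1# →
      (∀ u v → h (zipWith _∙_ u v) ≈ h u * h v) →
      ∀ v → h v ≈ ∏ (λ i → h (replicate n s₀ [ i ]≔ lookup v i))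
    homomorphism-axes {zero}  h h-1 h-* []       = h-1
    homomorphism-axes {suc n} h h-1 h-* (s ∷ v) = trans
      (trans (reflexive (≡.cong h (≡.cong₂ _∷_ (≡.sym (identityʳ s)) (≡.sym (Vec.zipWith-identityˡ identityˡ v)))))
             (h-* (s ∷ replicate n s₀) (s₀ ∷ v)))
      (*-congˡ (homomorphism-axes (h ∘ (s₀ ∷_)) h-1
        (λ u v → trans (reflexive (≡.cong (λ t → h (t ∷ zipWith _∙_ u v)) (≡.sym (identityˡ s₀)))) (h-* (s₀ ∷ u) (s₀ ∷ v))) v))

module IntegerPowers (R : CommutativeRing 0ℓ 0ℓ) where
  open CommutativeRing R hiding (zero)
  open IntegerMultiples R using (solve; _:=_; _:*_)
  open SetoidReasoning setoid

  -- Powers are characterised rather than constructed, because they arise in several ways: as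
  -- monomials, as indicator functions of points, as images under a homomorphism, and from an
  -- element with a given inverse.
  record IsPowerFunction (h : ℤ → Carrier) : Set where
    field
      0-homo : h 0ℤ ≈ 1#
      +-homo : ∀ a b → h (a ℤ.+ b) ≈ h a * h b

    inverse : h 1ℤ * h -1ℤ ≈ 1#
    inverse = trans (sym (+-homo 1ℤ -1ℤ)) 0-homo

  inverse-unique : ∀ {x x′ y y′} → x ≈ y → x * x′ ≈ 1# → y * y′ ≈ 1# → x′ ≈ y′
  inverse-unique {x} {x′} {y} {y′} x≈y p q = begin
    x′             ≈⟨ *-identityʳ x′ ⟨
    x′ * 1#        ≈⟨ *-congˡ q ⟨
    x′ * (y * y′)  ≈⟨ *-congˡ (*-congʳ x≈y) ⟨
    x′ * (x * y′)  ≈⟨ solve 3 (λ x x′ y′ → x′ :* (x :* y′) := x :* x′ :* y′) refl x x′ y′ ⟩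
    x * x′ * y′    ≈⟨ *-congʳ p ⟩
    1# * y′        ≈⟨ *-identityˡ y′ ⟩
    y′             ∎

  module _ {h k : ℤ → Carrier} (h-power : IsPowerFunction h) (k-power : IsPowerFunction k) (h≈k : h 1ℤ ≈ k 1ℤ) where
    private
      module h = IsPowerFunction h-power
      module k = IsPowerFunction k-power

      h≈k⁻ : h -1ℤ ≈ k -1ℤ
      h≈k⁻ = inverse-unique h≈k h.inverse k.inverse

    powers-unique : ∀ a → h a ≈ k a
    powers-unique (ℤ.+ zero)     = trans h.0-homo (sym k.0-homo)
    powers-unique (ℤ.+ suc n)    = trans (h.+-homo 1ℤ (ℤ.+ n))
      (trans (*-cong h≈k (powers-unique (ℤ.+ n))) (sym (k.+-homo 1ℤ (ℤ.+ n))))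
    powers-unique -[1+ zero ]    = h≈k⁻
    powers-unique -[1+ suc n ]   = trans (h.+-homo -1ℤ -[1+ n ])
      (trans (*-cong h≈k⁻ (powers-unique -[1+ n ])) (sym (k.+-homo -1ℤ -[1+ n ])))

  module _ (y y⁻¹ : Carrier) (yy⁻¹≈1 : y * y⁻¹ ≈ 1#) where
    infix 8 _^⁺_
    _^⁺_ : Carrier → ℕ → Carrier
    z ^⁺ zero  = 1#
    z ^⁺ suc n = z * z ^⁺ n

    power : ℤ → Carrier
    power (ℤ.+ n)  = y ^⁺ n
    power -[1+ n ] = y⁻¹ ^⁺ suc n

    private
      ^⁺-+ : ∀ z m n → z ^⁺ (m ℕ.+ n) ≈ z ^⁺ m * z ^⁺ n
      ^⁺-+ z zero    n = sym (*-identityˡ _)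
      ^⁺-+ z (suc m) n = trans (*-congˡ (^⁺-+ z m n)) (sym (*-assoc _ _ _))

      power-⊖ : ∀ m n → power (m ℤ.⊖ n) ≈ y ^⁺ m * y⁻¹ ^⁺ n
      power-⊖ zero    zero    = sym (*-identityˡ 1#)
      power-⊖ zero    (suc n) = sym (*-identityˡ _)
      power-⊖ (suc m) zero    = sym (*-identityʳ _)
      power-⊖ (suc m) (suc n) = begin
        power (suc m ℤ.⊖ suc n)                  ≡⟨ ≡.cong power (ℤ.[1+m]⊖[1+n]≡m⊖n m n) ⟩
        power (m ℤ.⊖ n)                          ≈⟨ power-⊖ m n ⟩
        y ^⁺ m * y⁻¹ ^⁺ n                        ≈⟨ *-identityˡ _ ⟨
        1# * (y ^⁺ m * y⁻¹ ^⁺ n)                 ≈⟨ *-congʳ yy⁻¹≈1 ⟨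
        y * y⁻¹ * (y ^⁺ m * y⁻¹ ^⁺ n)
          ≈⟨ solve 4 (λ y z p q → y :* z :* (p :* q) := y :* p :* (z :* q)) refl y y⁻¹ _ _ ⟩
        y * y ^⁺ m * (y⁻¹ * y⁻¹ ^⁺ n)            ∎

      power-+ : ∀ a b → power (a ℤ.+ b) ≈ power a * power b
      power-+ (ℤ.+ m)  (ℤ.+ n)  = ^⁺-+ y m n
      power-+ (ℤ.+ m)  -[1+ n ] = power-⊖ m (suc n)
      power-+ -[1+ m ] (ℤ.+ n)  = trans (power-⊖ n (suc m)) (*-comm _ _)
      power-+ -[1+ m ] -[1+ n ] = trans
        (reflexive (≡.cong (λ k → y⁻¹ ^⁺ suc k) (≡.sym (ℕ.+-suc m n)))) (^⁺-+ y⁻¹ (suc m) (suc n))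

    power-isPowerFunction : IsPowerFunction power
    power-isPowerFunction = record { 0-homo = refl ; +-homo = power-+ }

-- Sums and spans in a commutative algebra.

module AlgebraSums {K : CommutativeRing 0ℓ 0ℓ} (A : CommutativeAlgebra K) where
  private module K = CommutativeRing K
  open Sums K using (Combination) renaming (∑ to ∑ᴷ)
  open Tensors K
  open CommutativeAlgebra A hiding (zero)
  open IsRingHomomorphism ι-isRingHomomorphism using ()
    renaming (*-homo to ι-*; 1#-homo to ι-1; 0#-homo to ι-0; ⟦⟧-cong to ι-cong; +-homo to ι-+; -‿homo to ι-neg)
  private module S = Sums commutativeRing
  open Products commutativeRing
  open IntegerMultiples commutativeRing using (solve; _:=_; _:*_; _:+_; :-_; con)
  open SetoidReasoning setoid

  -- Formal coefficients stay in K, so that one combination can be evaluated in several algebras;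
  -- only at evaluation are they sent into A, where the results on sums over a ring apply.
  scalars : Combination X → S.Combination X
  scalars = map (map₁ ι)

  ∑ : Combination X → (X → Carrier) → Carrier
  ∑ f = S.∑ (scalars f)

  ∑-cong : ∀ (f : Combination X) {h k} → (∀ x → h x ≈ k x) → ∑ f h ≈ ∑ f k
  ∑-cong f = S.∑-cong (scalars f)

  ∑-++ : ∀ (f g : Combination X) h → ∑ (f ++ g) h ≈ ∑ f h + ∑ g h
  ∑-++ f g h = trans (reflexive (≡.cong (λ l → S.∑ l h) (List.map-++ (map₁ ι) f g))) (S.∑-++ (scalars f) (scalars g) h)

  ∑-*ˡ : ∀ (f : Combination X) z h → ∑ f (λ x → z * h x) ≈ z * ∑ f h
  ∑-*ˡ f = S.∑-*ˡ (scalars f)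

  ∑-*ʳ : ∀ (f : Combination X) z h → ∑ f (λ x → h x * z) ≈ ∑ f h * z
  ∑-*ʳ f z h = trans (∑-cong f (λ x → *-comm (h x) z)) (trans (∑-*ˡ f z h) (*-comm z _))

  ∑-map : ∀ (f : Combination X) c (k : X → Y) h →
          ∑ (map (λ (a , x) → c K.* a , k x) f) h ≈ ι c * ∑ f (h ∘ k)
  ∑-map []            c k h = sym (zeroʳ _)
  ∑-map ((a , x) ∷ f) c k h = begin
    ι (c K.* a) * h (k x) + ∑ (map (λ (a , x) → c K.* a , k x) f) h  ≈⟨ +-cong (*-congʳ (ι-* c a)) (∑-map f c k h) ⟩
    ι c * ι a * h (k x) + ι c * ∑ f (h ∘ k)
      ≈⟨ solve 4 (λ c a p s → c :* a :* p :+ c :* s := c :* (a :* p :+ s)) refl (ι c) (ι a) _ _ ⟩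
    ι c * (ι a * h (k x) + ∑ f (h ∘ k))                              ∎

  ∑-combine : ∀ (op : X → Y → Z) f g h → ∑ (combine op f g) h ≈ ∑ f (λ x → ∑ g (λ y → h (op x y)))
  ∑-combine op []            g h = refl
  ∑-combine op ((a , x) ∷ f) g h = trans (∑-++ (map _ g) (combine op f g) h)
    (+-cong (∑-map g a (op x) h) (∑-combine op f g h))

  ∑-[] : ∀ (x : X) h → ∑ [ K.1# , x ] h ≈ h x
  ∑-[] x h = trans (+-identityʳ _) (trans (*-congʳ ι-1) (*-identityˡ _))

  ∏-∑ : ∀ (g : Fin n → Combination X) (h : Fin n → X → Carrier) →
        ∏ (λ i → ∑ (g i) (h i)) ≈ ∑ (tensor g) (λ c → ∏ (λ i → h i (lookup c i)))
  ∏-∑ {zero} {X = X} g h = sym (∑-[] {X = Vec X 0} [] (λ _ → 1#))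
  ∏-∑ {suc n} g h = begin
    ∑ (g zero) (h zero) * ∏ (λ i → ∑ (g (suc i)) (h (suc i)))        ≈⟨ *-congˡ (∏-∑ (g ∘ suc) (h ∘ suc)) ⟩
    ∑ (g zero) (h zero) * ∑ (tensor (g ∘ suc)) rest                  ≈⟨ ∑-*ʳ (g zero) _ (h zero) ⟨
    ∑ (g zero) (λ x → h zero x * ∑ (tensor (g ∘ suc)) rest)          ≈⟨ ∑-cong (g zero) (λ x → ∑-*ˡ (tensor (g ∘ suc)) (h zero x) rest) ⟨
    ∑ (g zero) (λ x → ∑ (tensor (g ∘ suc)) (λ c → h zero x * rest c))  ≈⟨ ∑-combine _∷_ (g zero) (tensor (g ∘ suc)) _ ⟨
    ∑ (tensor g) (λ c → ∏ (λ i → h i (lookup c i)))                  ∎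
    where
    rest = λ c → ∏ (λ i → h (suc i) (lookup c i))

  ι-neg-* : ∀ p → ι (K.- K.1#) * p ≈ - p
  ι-neg-* p = trans (*-congʳ (trans (ι-neg K.1#) (-‿cong ι-1))) (solve 1 (λ p → :- con 1ℤ :* p := :- p) refl p)

  ι-∑ : ∀ (f : Combination X) h → ι (∑ᴷ f h) ≈ ∑ f (ι ∘ h)
  ι-∑ []            h = ι-0
  ι-∑ ((a , x) ∷ f) h = trans (ι-+ _ _) (+-cong (ι-* a (h x)) (ι-∑ f h))

  module _ (_≟_ : DecidableEquality X) where
    open Indicators K
    open Indicators commutativeRing using () renaming (𝟙 to 𝟙ᴬ)

    ι-𝟙 : {P : Set} (P? : Dec P) → ι (𝟙 P?) ≈ 𝟙ᴬ P?
    ι-𝟙 (yes _) = ι-1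
    ι-𝟙 (no _)  = ι-0

    ∑-vanishes : ∀ (f : Combination X) h → (∀ v → ∑ᴷ f (λ x → 𝟙 (x ≟ v)) K.≈ K.0#) → ∑ f h ≈ 0#
    ∑-vanishes f h f≈0 = SumsByValue.∑-vanishes commutativeRing _≟_ (scalars f) h λ v →
      trans (∑-cong f (λ x → sym (ι-𝟙 (x ≟ v))))
        (trans (sym (ι-∑ f (λ x → 𝟙 (x ≟ v)))) (trans (ι-cong (f≈0 v)) ι-0))

  -- Meant for evaluation at a point of W, which is linear but in general not multiplicative for the
  -- Minkowski product, so that homomorphism results do not cover it.
  linear-∑ : (ℓ : Carrier → K.Carrier) → ℓ 0# K.≈ K.0# → (∀ p q → ℓ (p + q) K.≈ ℓ p K.+ ℓ q) →
             (∀ a p → ℓ (ι a * p) K.≈ a K.* ℓ p) →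
             ∀ (f : Combination X) h → ℓ (∑ f h) K.≈ ∑ᴷ f (ℓ ∘ h)
  linear-∑ ℓ ℓ-0 ℓ-+ ℓ-ι []            h = ℓ-0
  linear-∑ ℓ ℓ-0 ℓ-+ ℓ-ι ((a , x) ∷ f) h =
    K.trans (ℓ-+ (ι a * h x) (∑ f h)) (K.+-cong (ℓ-ι a (h x)) (linear-∑ ℓ ℓ-0 ℓ-+ ℓ-ι f h))

  module Span (e : X → Carrier) where
    Spanned : Carrier → Set
    Spanned p = ∃ λ g → p ≈ ∑ g e

    spanned-resp : ∀ {p q} → p ≈ q → Spanned q → Spanned p
    spanned-resp p≈q (g , e) = g , trans p≈q e

    spanned : ∀ x → Spanned (e x)
    spanned x = [ K.1# , x ] , sym (∑-[] x e)

    spanned-+ : ∀ {p q} → Spanned p → Spanned q → Spanned (p + q)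
    spanned-+ (f , p) (g , q) = f ++ g , trans (+-cong p q) (sym (∑-++ f g e))

    spanned-ι : ∀ c {p} → Spanned p → Spanned (ι c * p)
    spanned-ι c (f , p) = map (λ (a , x) → c K.* a , x) f , trans (*-congˡ p) (sym (∑-map f c id e))

    spanned-neg : ∀ {p} → Spanned p → Spanned (- p)
    spanned-neg s = spanned-resp (sym (ι-neg-* _)) (spanned-ι (K.- K.1#) s)

    spanned-∑ : ∀ (f : Combination Y) {h} → (∀ y → Spanned (h y)) → Spanned (∑ f h)
    spanned-∑ []            s = [] , refl
    spanned-∑ ((a , y) ∷ f) s = spanned-+ (spanned-ι a (s y)) (spanned-∑ f s)

    -- Multiplication by z is linear, so stability of the span needs checking only on the spanning
    -- elements.
    spanned-* : ∀ z → (∀ x → Spanned (z * e x)) → ∀ {p} → Spanned p → Spanned (z * p)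
    spanned-* z s (f , p) = spanned-resp (trans (*-congˡ p) (sym (∑-*ˡ f z e))) (spanned-∑ f s)

-- Algebra homomorphisms and the first isomorphism theorem.

module _ {K : CommutativeRing 0ℓ 0ℓ} {A B : CommutativeAlgebra K} where
  private
    module A = CommutativeAlgebra A
    module B = CommutativeAlgebra B
  open Sums K using (Combination)

  module HomomorphismProperties {φ : A.Carrier → B.Carrier} (φ-homo : IsAlgebraHomomorphism A B φ) where
    open IsAlgebraHomomorphism φ-homo
    open IsRingHomomorphism isRingHomomorphism
    open B using (_≈_; trans; sym; +-cong; *-cong; *-congʳ; *-congˡ; +-congʳ; +-congˡ; -‿cong; -‿inverseʳ)

    ∑-homo : ∀ (f : Combination X) h → φ (AlgebraSums.∑ A f h) ≈ AlgebraSums.∑ B f (φ ∘ h)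
    ∑-homo []            h = 0#-homo
    ∑-homo ((a , x) ∷ f) h = trans (+-homo _ _)
      (+-cong (trans (*-homo _ _) (*-congʳ (ι-homo a))) (∑-homo f h))

    ∏-homo : ∀ (h : Fin n → A.Carrier) →
             φ (Products.∏ A.commutativeRing h) ≈ Products.∏ B.commutativeRing (φ ∘ h)
    ∏-homo {zero}  h = 1#-homo
    ∏-homo {suc n} h = trans (*-homo _ _) (*-congˡ (∏-homo (h ∘ suc)))

    minus-homo : ∀ p q → φ (p A.- q) ≈ φ p B.- φ q
    minus-homo p q = trans (+-homo _ _) (+-congˡ (-‿homo q))

    module _ {I : Set} (g : I → A.Carrier) where

      ideal⊆kernel : (∀ i → φ (g i) ≈ B.0#) → ∀ {p} → Ideal A g p → φ p ≈ B.0#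
      ideal⊆kernel φg≈0 (generator i)  = φg≈0 i
      ideal⊆kernel φg≈0 null           = 0#-homo
      ideal⊆kernel φg≈0 (sum p q)      = trans (+-homo _ _)
        (trans (+-cong (ideal⊆kernel φg≈0 p) (ideal⊆kernel φg≈0 q)) (B.+-identityˡ _))
      ideal⊆kernel φg≈0 (multiple r p) = trans (*-homo _ _)
        (trans (*-congˡ (ideal⊆kernel φg≈0 p)) (B.zeroʳ _))
      ideal⊆kernel φg≈0 (respects e p) = trans (⟦⟧-cong (A.sym e)) (ideal⊆kernel φg≈0 p)

      module _ (surjective : Surjective A._≈_ B._≈_ φ) (kernel : ∀ p → φ p ≈ B.0# ⇔ Ideal A g p) where
        private
          module Q = CommutativeAlgebra (quotient A g)

          lift : B.Carrier → A.Carrier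
          lift b = proj₁ (surjective b)

          φ-lift : ∀ b → φ (lift b) ≈ b
          φ-lift b = proj₂ (surjective b) A.refl

          φ-injective : ∀ {p q} → φ p ≈ φ q → p Q.≈ q
          φ-injective {p} {q} e = Equivalence.to (kernel _)
            (trans (minus-homo p q) (trans (+-congʳ e) (-‿inverseʳ (φ q))))

          φ-cong : ∀ {p q} → p Q.≈ q → φ p ≈ φ q
          φ-cong {p} {q} e = RingProperties.x∙y⁻¹≈ε⇒x≈y B.ring _ _
            (trans (sym (minus-homo p q)) (Equivalence.from (kernel _) e))

        -- The map runs from B and picks a preimage by surjectivity. By the kernel condition φ
        -- reflects equality in the quotient, so every law is verified after applying φ, where the
        -- chosen preimages disappear.
        firstIsomorphism : B ≅ quotient A g
        firstIsomorphism = lift , record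
          { isRingIsomorphism = record
            { isRingMonomorphism = record
              { isRingHomomorphism = record
                { isSemiringHomomorphism = record
                  { isNearSemiringHomomorphism = record
                    { +-isMonoidHomomorphism = record
                      { isMagmaHomomorphism = record
                        { isRelHomomorphism = record
                          { cong = λ {b} {c} e → φ-injective (trans (φ-lift b) (trans e (sym (φ-lift c)))) }
                        ; homo = λ b c → φ-injective (trans (φ-lift _)
                            (sym (trans (+-homo _ _) (+-cong (φ-lift b) (φ-lift c)))))
                        }
                      ; ε-homo = φ-injective (trans (φ-lift _) (sym 0#-homo))
                      }
                    ; *-homo = λ b c → φ-injective (trans (φ-lift _)
                        (sym (trans (*-homo _ _) (*-cong (φ-lift b) (φ-lift c)))))
                    }
                  ; 1#-homo = φ-injective (trans (φ-lift _) (sym 1#-homo))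
                  }
                ; -‿homo = λ b → φ-injective (trans (φ-lift _)
                    (sym (trans (-‿homo _) (-‿cong (φ-lift b)))))
                }
              ; injective = λ {b} {c} e → trans (sym (φ-lift b)) (trans (φ-cong e) (φ-lift c))
              }
            ; surjective = λ p → φ p , λ {b} e → φ-injective (trans (φ-lift b) e)
            }
          ; ι-homo = λ k → φ-injective (trans (φ-lift _) (sym (ι-homo k)))
          }

-- Cells of the line, and the reduction of monomials on one axis.

-- x^a stands for the point a and x^a (y - 1 - x) for the open interval from a
-- to a + 1: the cells into which the integers divide the line.
Cell : Set
Cell = ℤ × Bool

module SpanOfCells {K : CommutativeRing 0ℓ 0ℓ} (A : CommutativeAlgebra K) where
  open CommutativeAlgebra A hiding (zero)
  open IntegerPowers commutativeRing
  open IntegerMultiples commutativeRing using (solve; _:=_; _:*_; _:+_; _:-_; :-_; con)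
  open AlgebraSums A using (module Span)
  open SetoidReasoning setoid

  module _ (X Y : ℤ → Carrier) where
    private
      x = X 1ℤ
      y = Y 1ℤ
      y′ = Y -1ℤ

    cell : Cell → Carrier
    cell (a , false) = X a
    cell (a , true)  = X a * (y - 1# - x)

    module _ (X-power : IsPowerFunction X) (Y-power : IsPowerFunction Y) (relation≈0 : (y - 1#) * (y - x) ≈ 0#) where
      private
        module X = IsPowerFunction X-power
        module Y = IsPowerFunction Y-power
      open Span cell

      private
        X-pred : ∀ a → X a ≈ X (a ℤ.- 1ℤ) * x
        X-pred a = trans (reflexive (≡.cong X (≡.sym
          (≡.trans (ℤ.+-assoc a -1ℤ 1ℤ) (ℤ.+-identityʳ a))))) (X.+-homo (a ℤ.- 1ℤ) 1ℤ)

        -- For a point, the closed interval is the open one together with its two ends. For an open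
        -- interval, y (y - 1 - x) differs from (y - 1) (y - x) by x, so modulo the relation the
        -- product is minus the right end.
        y*cell : ∀ c → Spanned (y * cell c)
        y*cell (a , false) = spanned-resp (begin
          y * X a                                  ≈⟨ solve 3 (λ p x y → y :* p := p :* (y :- con 1ℤ :- x) :+ (p :+ p :* x)) refl (X a) x y ⟩
          X a * (y - 1# - x) + (X a + X a * x)     ≈⟨ +-congˡ (+-congˡ (X.+-homo a 1ℤ)) ⟨
          X a * (y - 1# - x) + (X a + X (a ℤ.+ 1ℤ))  ∎)
          (spanned-+ (spanned (a , true)) (spanned-+ (spanned (a , false)) (spanned (a ℤ.+ 1ℤ , false))))
        y*cell (a , true) = spanned-resp (begin
          y * (X a * (y - 1# - x))
            ≈⟨ solve 3 (λ p x y → y :* (p :* (y :- con 1ℤ :- x)) := p :* ((y :- con 1ℤ) :* (y :- x)) :- p :* x) refl (X a) x y ⟩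
          X a * ((y - 1#) * (y - x)) - X a * x     ≈⟨ +-cong (*-congˡ relation≈0) (-‿cong (sym (X.+-homo a 1ℤ))) ⟩
          X a * 0# - X (a ℤ.+ 1ℤ)                  ≈⟨ trans (+-congʳ (zeroʳ (X a))) (+-identityˡ _) ⟩
          - X (a ℤ.+ 1ℤ)                           ∎)
          (spanned-neg (spanned (a ℤ.+ 1ℤ , false)))

        -- The identity y (y - 1 - x) = -x divided by y. Hence y⁻¹ turns a point into minus the open
        -- unit interval that ends there.
        y′*x : y′ * x ≈ - (y - 1# - x)
        y′*x = begin
          y′ * x
            ≈⟨ solve 3 (λ x y y′ → y′ :* x := y′ :* ((y :- con 1ℤ) :* (y :- x)) :- y :* y′ :* (y :- con 1ℤ :- x)) refl x y y′ ⟩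
          y′ * ((y - 1#) * (y - x)) - y * y′ * (y - 1# - x)
            ≈⟨ +-cong (trans (*-congˡ relation≈0) (zeroʳ y′)) (-‿cong (trans (*-congʳ Y.inverse) (*-identityˡ _))) ⟩
          0# - (y - 1# - x)                        ≈⟨ +-identityˡ _ ⟩
          - (y - 1# - x)                           ∎

        y′*X : ∀ a → Spanned (y′ * X a)
        y′*X a = spanned-resp (begin
          y′ * X a                                 ≈⟨ *-congˡ (X-pred a) ⟩
          y′ * (X (a ℤ.- 1ℤ) * x)                  ≈⟨ solve 3 (λ p x y′ → y′ :* (p :* x) := p :* (y′ :* x)) refl _ x y′ ⟩
          X (a ℤ.- 1ℤ) * (y′ * x)                  ≈⟨ *-congˡ y′*x ⟩
          X (a ℤ.- 1ℤ) * - (y - 1# - x)            ≈⟨ solve 2 (λ p q → p :* :- q := :- (p :* q)) refl _ _ ⟩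
          - (X (a ℤ.- 1ℤ) * (y - 1# - x))          ∎)
          (spanned-neg (spanned (a ℤ.- 1ℤ , true)))

        y′*cell : ∀ c → Spanned (y′ * cell c)
        y′*cell (a , false) = y′*X a
        -- Multiplying out is enough: the term with y gives the point a, and the other two are y⁻¹
        -- times points, already treated.
        y′*cell (a , true)  = spanned-resp (begin
          y′ * (X a * (y - 1# - x))
            ≈⟨ solve 4 (λ p x y y′ → y′ :* (p :* (y :- con 1ℤ :- x)) := p :* (y :* y′) :+ (:- (y′ :* p) :+ :- (y′ :* (p :* x)))) refl (X a) x y y′ ⟩
          X a * (y * y′) + (- (y′ * X a) + - (y′ * (X a * x)))
            ≈⟨ +-cong (trans (*-congˡ Y.inverse) (*-identityʳ (X a))) (+-congˡ (-‿cong (*-congˡ (sym (X.+-homo a 1ℤ))))) ⟩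
          X a + (- (y′ * X a) + - (y′ * X (a ℤ.+ 1ℤ)))  ∎)
          (spanned-+ (spanned (a , false)) (spanned-+ (spanned-neg (y′*X a)) (spanned-neg (y′*X (a ℤ.+ 1ℤ)))))

      monomial-spanned : ∀ a b → Spanned (Y b * X a)
      monomial-spanned a (ℤ.+ zero)   = spanned-resp (trans (*-congʳ Y.0-homo) (*-identityˡ _)) (spanned (a , false))
      monomial-spanned a (ℤ.+ suc n)  = spanned-resp (trans (*-congʳ (Y.+-homo 1ℤ (ℤ.+ n))) (*-assoc _ _ _))
        (spanned-* y y*cell (monomial-spanned a (ℤ.+ n)))
      monomial-spanned a -[1+ zero ]  = y′*X a
      monomial-spanned a -[1+ suc n ] = spanned-resp (trans (*-congʳ (Y.+-homo -1ℤ -[1+ n ])) (*-assoc _ _ _))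
        (spanned-* y′ y′*cell (monomial-spanned a -[1+ n ]))

-- Lattice intervals under Minkowski addition.

-- (a , n) is the interval from a to a + n, so that no proof of a ≤ b is carried along.
Interval : Set
Interval = ℤ × ℕ

lower upper : Interval → ℤ
lower (a , n) = a
upper (a , n) = a ℤ.+ ℤ.+ n

point : Interval
point = 0ℤ , 0

infixl 6 _⊞ᴵ_
_⊞ᴵ_ : Interval → Interval → Interval
(a , m) ⊞ᴵ (b , n) = a ℤ.+ b , m ℕ.+ n

⊞ᴵ-identityˡ : ∀ s → point ⊞ᴵ s ≡ s
⊞ᴵ-identityˡ (a , n) = ≡.cong (_, n) (ℤ.+-identityˡ a)

⊞ᴵ-identityʳ : ∀ s → s ⊞ᴵ point ≡ s
⊞ᴵ-identityʳ (a , n) = ≡.cong₂ _,_ (ℤ.+-identityʳ a) (ℕ.+-identityʳ n)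

upper-⊞ᴵ : ∀ s t → upper (s ⊞ᴵ t) ≡ upper s ℤ.+ upper t
upper-⊞ᴵ (a , m) (b , n) = begin
  a ℤ.+ b ℤ.+ ℤ.+ (m ℕ.+ n)          ≡⟨ ≡.cong (λ k → a ℤ.+ b ℤ.+ k) (ℤ.pos-+ m n) ⟩
  a ℤ.+ b ℤ.+ (ℤ.+ m ℤ.+ ℤ.+ n)      ≡⟨ interchange ℤ.+-commutativeSemigroup a b (ℤ.+ m) (ℤ.+ n) ⟩
  (a ℤ.+ ℤ.+ m) ℤ.+ (b ℤ.+ ℤ.+ n)    ∎
  where open ≡.≡-Reasoning

i+∣j-i∣≡j : ∀ {i j} → i ℤ.≤ j → i ℤ.+ ℤ.+ ℤ.∣ j ℤ.- i ∣ ≡ j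
i+∣j-i∣≡j {i} {j} i≤j = begin
  i ℤ.+ ℤ.+ ℤ.∣ j ℤ.- i ∣  ≡⟨ ≡.cong (λ k → i ℤ.+ k) (ℤ.0≤i⇒+∣i∣≡i (ℤ.i≤j⇒0≤j-i i≤j)) ⟩
  i ℤ.+ (j ℤ.- i)          ≡⟨ ℤ.+-comm i _ ⟩
  j ℤ.- i ℤ.+ i            ≡⟨ ℤ.+-assoc j (ℤ.- i) i ⟩
  j ℤ.+ (ℤ.- i ℤ.+ i)      ≡⟨ ≡.cong (λ k → j ℤ.+ k) (ℤ.+-inverseˡ i) ⟩
  j ℤ.+ 0ℤ                 ≡⟨ ℤ.+-identityʳ j ⟩
  j                        ∎
  where open ≡.≡-Reasoning

+1-cancel-≤ : ∀ {i j} → i ℤ.+ 1ℤ ℤ.≤ j ℤ.+ 1ℤ → i ℤ.≤ j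
+1-cancel-≤ {i} {j} p = ≡.subst₂ ℤ._≤_ (cancel i) (cancel j) (ℤ.+-monoˡ-≤ -1ℤ p)
  where
  cancel : ∀ i → i ℤ.+ 1ℤ ℤ.+ -1ℤ ≡ i
  cancel i = ≡.trans (ℤ.+-assoc i 1ℤ -1ℤ) (ℤ.+-identityʳ i)

replicate-[]≔ : ∀ {S : Set} (s : S) (i : Fin n) → replicate n s [ i ]≔ s ≡ replicate n s
replicate-[]≔ s zero    = ≡.refl
replicate-[]≔ s (suc i) = ≡.cong (s ∷_) (replicate-[]≔ s i)

zipWith-[]≔ : ∀ {S : Set} (_∙_ : S → S → S) {s₀} → s₀ ∙ s₀ ≡ s₀ → ∀ (i : Fin n) s t →
              zipWith _∙_ (replicate n s₀ [ i ]≔ s) (replicate n s₀ [ i ]≔ t) ≡ replicate n s₀ [ i ]≔ s ∙ t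
zipWith-[]≔ {suc n} _∙_ {s₀} e zero    s t = ≡.cong (s ∙ t ∷_) (≡.trans (Vec.zipWith-replicate _∙_ s₀ s₀) (≡.cong (replicate n) e))
zipWith-[]≔         _∙_      e (suc i) s t = ≡.cong₂ _∷_ e (zipWith-[]≔ _∙_ e i s t)

_≟ᶜ_ : DecidableEquality Cell
_≟ᶜ_ = ×-≡-dec ℤ._≟_ _≟ᵇ_

module ClosedIntervals (K : CommutativeRing 0ℓ 0ℓ) where
  open CommutativeRing K using (1#; -_)
  open Sums K using (Combination)

  -- The open interval is [a, a+1] without its two ends. Keeping this formal allows the same
  -- expression to be evaluated in the Minkowski ring and at a single real number.
  closedIntervals : Cell → Combination Interval
  closedIntervals (a , false) = [ 1# , a , 0 ]
  closedIntervals (a , true)  = (1# , a , 1) ∷ (- 1# , a , 0) ∷ (- 1# , a ℤ.+ 1ℤ , 0) ∷ []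

module AxisCells {K : CommutativeRing 0ℓ 0ℓ} (A : CommutativeAlgebra K)
  (axis : Fin n → Interval → CommutativeAlgebra.Carrier A) where
  open CommutativeAlgebra A using (Carrier; commutativeRing)
  open ClosedIntervals K

  cells : Vec Cell n → Carrier
  cells c = Products.∏ commutativeRing (λ i → AlgebraSums.∑ A (closedIntervals (lookup c i)) (axis i))

-- Integers among the reals, and sample points of the cells.

module LatticeIntervals (F : CompleteOrderedField) where
  open CompleteOrderedField F renaming (Carrier to ℝ; _≤_ to _≤ᴿ_)
  open OrderedFieldProperties F
  open IntegerMultiples commutativeRing
  open Multiples semiring using (1+×) renaming (_×_ to _⋆_)

  private
    0≤n⋆1 : ∀ n → 0# ≤ᴿ n ⋆ 1#
    0≤n⋆1 zero    = ≤-refl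
    0≤n⋆1 (suc n) = ≤-resp (+-identityˡ 0#) (sym (1+× n 1#)) (+-mono-≤ 0≤1 (0≤n⋆1 n))

    1+ : ∀ a → fromℤ (a ℤ.+ 1ℤ) ≈ fromℤ a + 1#
    1+ a = fromℤ-+-homo a 1ℤ

  fromℤ-mono-≤ : ∀ {a b} → a ℤ.≤ b → fromℤ a ≤ᴿ fromℤ b
  fromℤ-mono-≤ {a} {b} a≤b = ≤-resp (+-identityʳ _)
    (trans (sym (fromℤ-+-homo a _)) (reflexive (≡.cong fromℤ (i+∣j-i∣≡j a≤b))))
    (+-monoʳ-≤ (fromℤ a) (0≤n⋆1 ℤ.∣ b ℤ.- a ∣))

  private
    +1≰ : ∀ a → ¬ fromℤ (a ℤ.+ 1ℤ) ≤ᴿ fromℤ a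
    +1≰ a p = 0≉1 (≤-antisym 0≤1 (0≤y-x⇒x≤y (≤-resp refl
      (trans (+-congˡ (-‿cong (1+ a))) (solve 1 (λ x → x :- (x :+ con 1ℤ) := con 0ℤ :- con 1ℤ) refl (fromℤ a)))
      (x≤y⇒0≤y-x p))))

    ≰⇒+1≤ : ∀ {a b} → ¬ a ℤ.≤ b → b ℤ.+ 1ℤ ℤ.≤ a
    ≰⇒+1≤ {a} {b} a≰b = ≡.subst (ℤ._≤ a) (ℤ.+-comm 1ℤ b) (ℤ.i<j⇒suc[i]≤j (ℤ.≰⇒> a≰b))

  fromℤ-cancel-≤ : ∀ {a b} → fromℤ a ≤ᴿ fromℤ b → a ℤ.≤ b
  fromℤ-cancel-≤ {a} {b} p with a ℤ.≤? b
  ... | yes q = q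
  ... | no ¬q = ⊥-elim (+1≰ b (≤-trans (fromℤ-mono-≤ (≰⇒+1≤ ¬q)) p))

  Within : Interval → ℝ → Set
  Within s t = fromℤ (lower s) ≤ᴿ t × t ≤ᴿ fromℤ (upper s)

  within? : ∀ s t → Dec (Within s t)
  within? s t = (fromℤ (lower s) ≤? t) ×-dec (t ≤? fromℤ (upper s))

  within-resp : ∀ s {t t′} → t ≈ t′ → Within s t → Within s t′
  within-resp s e (p , q) = ≤-resp refl e p , ≤-resp e refl q

  within-⊞ : ∀ u v {s t} → Within u s → Within v t → Within (u ⊞ᴵ v) (s + t)
  within-⊞ u v (p , q) (p′ , q′) =
    ≤-resp (sym (fromℤ-+-homo (lower u) (lower v))) refl (+-mono-≤ p p′) ,
    ≤-resp refl (trans (sym (fromℤ-+-homo (upper u) (upper v))) (reflexive (≡.cong fromℤ (≡.sym (upper-⊞ᴵ u v)))))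
      (+-mono-≤ q q′)

  lower≤upper : ∀ u → fromℤ (lower u) ≤ᴿ fromℤ (upper u)
  lower≤upper (a , n) = fromℤ-mono-≤ (ℤ.i≤i+j a (ℤ.+ n))

  -- The witness is the larger of l and t - m′: the least number that is at least l and leaves no
  -- more than m′ for v.
  within-split : ∀ u v {t} → Within (u ⊞ᴵ v) t → ∃ λ s → Within u s × Within v (t - s)
  within-split u v {t} (p , q) = split (total l (t - m′))
    where
    l = fromℤ (lower u)
    m = fromℤ (upper u)
    l′ = fromℤ (lower v)
    m′ = fromℤ (upper v)

    l+l′≤t : l + l′ ≤ᴿ t
    l+l′≤t = ≤-resp (fromℤ-+-homo (lower u) (lower v)) refl p

    t≤m+m′ : t ≤ᴿ m + m′
    t≤m+m′ = ≤-resp refl (trans (reflexive (≡.cong fromℤ (upper-⊞ᴵ u v))) (fromℤ-+-homo (upper u) (upper v))) q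

    split : l ≤ᴿ t - m′ ⊎ t - m′ ≤ᴿ l → ∃ λ s → Within u s × Within v (t - s)
    split (inj₁ l≤t-m′) = t - m′ ,
      (l≤t-m′ , ≤-resp refl (solve 2 (λ m m′ → m :+ m′ :- m′ := m) refl m m′) (+-monoˡ-≤ (- m′) t≤m+m′)) ,
      within-resp v (solve 2 (λ t m′ → m′ := t :- (t :- m′)) refl t m′) (lower≤upper v , ≤-refl)
    split (inj₂ t-m′≤l) = l , (≤-refl , lower≤upper u) ,
      ≤-resp (solve 2 (λ l l′ → l :+ l′ :- l := l′) refl l l′) refl (+-monoˡ-≤ (- l) l+l′≤t) ,
      ≤-resp (solve 3 (λ t l m′ → t :- m′ :+ (m′ :- l) := t :- l) refl t l m′)
             (solve 2 (λ l m′ → l :+ (m′ :- l) := m′) refl l m′) (+-monoˡ-≤ (m′ - l) t-m′≤l)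

  sample : Cell → ℝ
  sample (a , false) = fromℤ a
  sample (a , true)  = midpoint (fromℤ a) (fromℤ (a ℤ.+ 1ℤ))

  -- Purely integral form of membership of the sample point: an interval with integral ends contains
  -- an open cell exactly when it contains both ends of that cell.
  WithinCell : Interval → Cell → Set
  WithinCell s (b , false) = lower s ℤ.≤ b × b ℤ.≤ upper s
  WithinCell s (b , true)  = lower s ℤ.≤ b × b ℤ.+ 1ℤ ℤ.≤ upper s

  -- An integral end cannot lie strictly between b and b + 1. Were it on the wrong side of the whole
  -- cell, the midpoint would reach b or b + 1 and force b + 1 ≤ b.
  within-sample : ∀ s c → Within s (sample c) → WithinCell s c
  within-sample s (b , false) (p , q) = fromℤ-cancel-≤ p , fromℤ-cancel-≤ q
  within-sample s (b , true)  (p , q) = left (lower s ℤ.≤? b) , right (b ℤ.+ 1ℤ ℤ.≤? upper s)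
    where
    left : Dec (lower s ℤ.≤ b) → lower s ℤ.≤ b
    left (yes r) = r
    left (no ¬r) = ⊥-elim (+1≰ b (≤-midpoint⇒≥ (≤-trans (fromℤ-mono-≤ (≰⇒+1≤ ¬r)) p)))
    right : Dec (b ℤ.+ 1ℤ ℤ.≤ upper s) → b ℤ.+ 1ℤ ℤ.≤ upper s
    right (yes r) = r
    right (no ¬r) = ⊥-elim (+1≰ b (midpoint-≤⇒≥ (≤-trans q (fromℤ-mono-≤ u≤b))))
      where
      u≤b : upper s ℤ.≤ b
      u≤b = +1-cancel-≤ (≰⇒+1≤ ¬r)

  sample-within : ∀ s c → WithinCell s c → Within s (sample c)
  sample-within s (b , false) (p , q) = fromℤ-mono-≤ p , fromℤ-mono-≤ q
  sample-within s (b , true)  (p , q) =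
    ≤-trans (fromℤ-mono-≤ p) (≤-midpoint b≤b+1) , ≤-trans (midpoint-≤ b≤b+1) (fromℤ-mono-≤ q)
    where
    b≤b+1 : fromℤ b ≤ᴿ fromℤ (b ℤ.+ 1ℤ)
    b≤b+1 = fromℤ-mono-≤ (ℤ.i≤i+j b (ℤ.+ 1))

  module CellIndicators (K : CommutativeRing 0ℓ 0ℓ) where
    private module K = CommutativeRing K
    open Sums K
    open ClosedIntervals K
    open Indicators K
    open IntegerMultiples K using () renaming (solve to solveᴷ; _:=_ to _:=ᴷ_; _:+_ to _:+ᴷ_; _:*_ to _:*ᴷ_; :-_ to :-ᴷ_; con to conᴷ)

    private
      i+1≰i : ∀ {i} → ¬ i ℤ.+ 1ℤ ℤ.≤ i
      i+1≰i {i} p = ℤ.<-irrefl ≡.refl (ℤ.suc[i]≤j⇒i<j (≡.subst (ℤ._≤ i) (ℤ.+-comm i 1ℤ) p))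

      +0 : ∀ {i j} → i ℤ.≤ j ℤ.+ 0ℤ → i ℤ.≤ j
      +0 {i} {j} = ≡.subst (i ℤ.≤_) (ℤ.+-identityʳ j)

      +0⁻ : ∀ {i j} → i ℤ.≤ j → i ℤ.≤ j ℤ.+ 0ℤ
      +0⁻ {i} {j} = ≡.subst (i ℤ.≤_) (≡.sym (ℤ.+-identityʳ j))

      single : ∀ {p q} → p K.≈ q → K.1# K.* p K.+ K.0# K.≈ q
      single p≈q = K.trans (K.+-identityʳ _) (K.trans (K.*-identityˡ _) p≈q)

      triple : ∀ {p q r p′ q′ r′ s} → p K.≈ p′ → q K.≈ q′ → r K.≈ r′ →
               K.1# K.* p′ K.+ (K.- K.1# K.* q′ K.+ (K.- K.1# K.* r′ K.+ K.0#)) K.≈ s →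
               K.1# K.* p K.+ (K.- K.1# K.* q K.+ (K.- K.1# K.* r K.+ K.0#)) K.≈ s
      triple e₁ e₂ e₃ = K.trans (K.+-cong (K.*-congˡ e₁) (K.+-cong (K.*-congˡ e₂) (K.+-congʳ (K.*-congˡ e₃))))

      𝟙-in : ∀ s c → WithinCell s c → 𝟙 (within? s (sample c)) K.≈ K.1#
      𝟙-in s c p = 𝟙-yes (within? s (sample c)) (sample-within s c p)

      𝟙-out : ∀ s c → ¬ WithinCell s c → 𝟙 (within? s (sample c)) K.≈ K.0#
      𝟙-out s c p = 𝟙-no (within? s (sample c)) (p ∘ within-sample s c)

    -- The sample points are dual to the cells. For an open cell, at either end the closed interval
    -- cancels against one removed point; at its midpoint only the closed interval counts; at every
    -- other sample point all three terms vanish.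
    closedIntervals-𝟙 : ∀ c c′ → ∑ (closedIntervals c) (λ s → 𝟙 (within? s (sample c′))) K.≈ 𝟙 (c ≟ᶜ c′)
    closedIntervals-𝟙 (a , false) (b , false) = single (𝟙-cong (within? (a , 0) (fromℤ b)) ((a , false) ≟ᶜ (b , false))
      (λ w → let p , q = within-sample (a , 0) (b , false) w in ≡.cong (_, false) (ℤ.≤-antisym p (+0 q)))
      (λ { ≡.refl → sample-within (a , 0) (a , false) (ℤ.≤-refl , +0⁻ ℤ.≤-refl) }))
    closedIntervals-𝟙 (a , false) (b , true)  = single (K.trans
      (𝟙-out (a , 0) (b , true) λ (p , q) → i+1≰i (ℤ.≤-trans (+0 q) p))
      (K.sym (𝟙-no ((a , false) ≟ᶜ (b , true)) λ ())))
    closedIntervals-𝟙 (a , true)  (b , false) = K.trans (by-cases (b ℤ.≟ a) (b ℤ.≟ a ℤ.+ 1ℤ))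
      (K.sym (𝟙-no ((a , true) ≟ᶜ (b , false)) λ ()))
      where
      by-cases : Dec (b ≡ a) → Dec (b ≡ a ℤ.+ 1ℤ) →
        ∑ (closedIntervals (a , true)) (λ s → 𝟙 (within? s (fromℤ b))) K.≈ K.0#
      by-cases (yes ≡.refl) _ = triple
        (𝟙-in (a , 1) (a , false) (ℤ.≤-refl , ℤ.i≤i+j a (ℤ.+ 1)))
        (𝟙-in (a , 0) (a , false) (ℤ.≤-refl , +0⁻ ℤ.≤-refl))
        (𝟙-out (a ℤ.+ 1ℤ , 0) (a , false) (i+1≰i ∘ proj₁))
        (solveᴷ 0 (conᴷ 1ℤ :*ᴷ conᴷ 1ℤ :+ᴷ (:-ᴷ conᴷ 1ℤ :*ᴷ conᴷ 1ℤ :+ᴷ (:-ᴷ conᴷ 1ℤ :*ᴷ conᴷ 0ℤ :+ᴷ conᴷ 0ℤ)) :=ᴷ conᴷ 0ℤ) K.refl)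
      by-cases (no _) (yes ≡.refl) = triple
        (𝟙-in (a , 1) (a ℤ.+ 1ℤ , false) (ℤ.i≤i+j a (ℤ.+ 1) , ℤ.≤-refl))
        (𝟙-out (a , 0) (a ℤ.+ 1ℤ , false) (λ (_ , q) → i+1≰i (+0 {j = a} q)))
        (𝟙-in (a ℤ.+ 1ℤ , 0) (a ℤ.+ 1ℤ , false) (ℤ.≤-refl , +0⁻ ℤ.≤-refl))
        (solveᴷ 0 (conᴷ 1ℤ :*ᴷ conᴷ 1ℤ :+ᴷ (:-ᴷ conᴷ 1ℤ :*ᴷ conᴷ 0ℤ :+ᴷ (:-ᴷ conᴷ 1ℤ :*ᴷ conᴷ 1ℤ :+ᴷ conᴷ 0ℤ)) :=ᴷ conᴷ 0ℤ) K.refl)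
      by-cases (no b≢a) (no b≢a+1) = triple
        (𝟙-out (a , 1) (b , false) λ (p , q) → b≢a+1 (ℤ.≤-antisym q
          (≡.subst (ℤ._≤ b) (ℤ.+-comm 1ℤ a) (ℤ.i<j⇒suc[i]≤j (ℤ.≤∧≢⇒< p (b≢a ∘ ≡.sym))))))
        (𝟙-out (a , 0) (b , false) λ (p , q) → b≢a (ℤ.≤-antisym (+0 q) p))
        (𝟙-out (a ℤ.+ 1ℤ , 0) (b , false) λ (p , q) → b≢a+1 (ℤ.≤-antisym (+0 q) p))
        (solveᴷ 0 (conᴷ 1ℤ :*ᴷ conᴷ 0ℤ :+ᴷ (:-ᴷ conᴷ 1ℤ :*ᴷ conᴷ 0ℤ :+ᴷ (:-ᴷ conᴷ 1ℤ :*ᴷ conᴷ 0ℤ :+ᴷ conᴷ 0ℤ)) :=ᴷ conᴷ 0ℤ) K.refl)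
    closedIntervals-𝟙 (a , true)  (b , true)  = triple
      (𝟙-cong (within? (a , 1) (sample (b , true))) ((a , true) ≟ᶜ (b , true))
        (λ w → let p , q = within-sample (a , 1) (b , true) w in ≡.cong (_, true) (ℤ.≤-antisym p (+1-cancel-≤ q)))
        (λ { ≡.refl → sample-within (a , 1) (a , true) (ℤ.≤-refl , ℤ.≤-refl) }))
      (𝟙-out (a , 0) (b , true) λ (p , q) → i+1≰i (ℤ.≤-trans (+0 q) p))
      (𝟙-out (a ℤ.+ 1ℤ , 0) (b , true) λ (p , q) → i+1≰i (ℤ.≤-trans (+0 q) p))
      (solveᴷ 1 (λ z → conᴷ 1ℤ :*ᴷ z :+ᴷ (:-ᴷ conᴷ 1ℤ :*ᴷ conᴷ 0ℤ :+ᴷ (:-ᴷ conᴷ 1ℤ :*ᴷ conᴷ 0ℤ :+ᴷ conᴷ 0ℤ)) :=ᴷ z) K.refl _)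

-- Laurent monomials and the universal property of Laurent polynomials.

module LaurentMonomials (K : CommutativeRing 0ℓ 0ℓ) (d : ℕ) where
  private module K = CommutativeRing K
  open LaurentPolynomials K d
  open LaurentCombination using (_⊛_; ⊟_; pointwise; _at_)
  private module L = CommutativeAlgebra Laurent
  open AlgebraSums Laurent using (∑)
  open Products L.commutativeRing
  open Tensors K using (combine)
  open IntegerPowers L.commutativeRing using (IsPowerFunction)

  monomial : Monomial → L.Carrier
  monomial u = [ K.1# , u ]

  monomial-* : ∀ u v → monomial (u ∙ v) L.≈ monomial u L.* monomial v
  monomial-* u v = pointwise λ t → K.+-congʳ (K.*-congʳ (K.sym (K.*-identityˡ K.1#)))

  expansion : ∀ f → f L.≈ ∑ f monomial
  expansion []            = L.refl
  expansion ((a , u) ∷ f) = L.+-cong {[ a , u ]} {L.ι a L.* monomial u} {f} {∑ f monomial}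
    (pointwise λ t → K.+-congʳ (K.*-cong (K.sym (K.*-identityʳ a))
      (K.reflexive (≡.cong (λ v → coefficient v t) (≡.sym (∙-identityˡ u))))))
    (expansion f)

  xᵃ yᵇ : Fin d → ℤ → L.Carrier
  xᵃ i a = monomial (𝟘 [ i ]≔ a , 𝟘)
  yᵇ i b = monomial (𝟘 , 𝟘 [ i ]≔ b)

  private
    x-* : ∀ α α′ → monomial (zipWith ℤ._+_ α α′ , 𝟘) L.≈ monomial (α , 𝟘) L.* monomial (α′ , 𝟘)
    x-* α α′ = ≡.subst (λ β → monomial (zipWith ℤ._+_ α α′ , β) L.≈ monomial (α , 𝟘) L.* monomial (α′ , 𝟘))
      (Vec.zipWith-identityˡ ℤ.+-identityˡ 𝟘) (monomial-* (α , 𝟘) (α′ , 𝟘))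

    y-* : ∀ β β′ → monomial (𝟘 , zipWith ℤ._+_ β β′) L.≈ monomial (𝟘 , β) L.* monomial (𝟘 , β′)
    y-* β β′ = ≡.subst (λ α → monomial (α , zipWith ℤ._+_ β β′) L.≈ monomial (𝟘 , β) L.* monomial (𝟘 , β′))
      (Vec.zipWith-identityˡ ℤ.+-identityˡ 𝟘) (monomial-* (𝟘 , β) (𝟘 , β′))

  xᵃ-power : ∀ i → IsPowerFunction (xᵃ i)
  xᵃ-power i = record
    { 0-homo = L.reflexive (≡.cong (λ α → monomial (α , 𝟘)) (replicate-[]≔ 0ℤ i))
    ; +-homo = λ a b → ≡.subst (λ α → monomial (α , 𝟘) L.≈ xᵃ i a L.* xᵃ i b)
        (zipWith-[]≔ ℤ._+_ ≡.refl i a b) (x-* (𝟘 [ i ]≔ a) (𝟘 [ i ]≔ b))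
    }

  yᵇ-power : ∀ i → IsPowerFunction (yᵇ i)
  yᵇ-power i = record
    { 0-homo = L.reflexive (≡.cong (λ β → monomial (𝟘 , β)) (replicate-[]≔ 0ℤ i))
    ; +-homo = λ a b → ≡.subst (λ β → monomial (𝟘 , β) L.≈ yᵇ i a L.* yᵇ i b)
        (zipWith-[]≔ ℤ._+_ ≡.refl i a b) (y-* (𝟘 [ i ]≔ a) (𝟘 [ i ]≔ b))
    }

  monomial-∏ : ∀ α β → monomial (α , β) L.≈ ∏ (λ i → xᵃ i (lookup α i) L.* yᵇ i (lookup β i))
  monomial-∏ α β = begin
    monomial (α , β)                          ≡⟨ ≡.cong₂ (λ α β → monomial (α , β))
                                                   (Vec.zipWith-identityʳ ℤ.+-identityʳ α) (Vec.zipWith-identityˡ ℤ.+-identityˡ β) ⟨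
    monomial ((α , 𝟘) ∙ (𝟘 , β))              ≈⟨ monomial-* (α , 𝟘) (𝟘 , β) ⟩
    monomial (α , 𝟘) L.* monomial (𝟘 , β)     ≈⟨ L.*-cong
                                                   (axes (λ α → monomial (α , 𝟘)) L.refl x-* α)
                                                   (axes (λ β → monomial (𝟘 , β)) L.refl y-* β) ⟩
    ∏ (λ i → xᵃ i (lookup α i)) L.* ∏ (λ i → yᵇ i (lookup β i))
                                              ≈⟨ ∏-distrib-* (λ i → xᵃ i (lookup α i)) (λ i → yᵇ i (lookup β i)) ⟨
    ∏ (λ i → xᵃ i (lookup α i) L.* yᵇ i (lookup β i))  ∎
    where
    open SetoidReasoning L.setoid
    axes = homomorphism-axes ℤ._+_ 0ℤ ℤ.+-identityˡ ℤ.+-identityʳ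

  module _ {A : CommutativeAlgebra K} where
    private module A = CommutativeAlgebra A
    open AlgebraSums A using () renaming (∑ to ∑ᴬ; ∑-cong to ∑ᴬ-cong)
    open IntegerPowers A.commutativeRing using (powers-unique) renaming (IsPowerFunction to IsPowerFunctionᴬ)
    open Products A.commutativeRing using () renaming (∏ to ∏ᴬ; ∏-cong to ∏ᴬ-cong)

    module _ {ψ : L.Carrier → A.Carrier} (ψ-homo : IsAlgebraHomomorphism Laurent A ψ) where
      open IsAlgebraHomomorphism ψ-homo
      open IsRingHomomorphism isRingHomomorphism
      open HomomorphismProperties {A = Laurent} {B = A} ψ-homo

      homomorphism-power : ∀ {h} → IsPowerFunction h → IsPowerFunctionᴬ (ψ ∘ h)
      homomorphism-power h-power = record
        { 0-homo = A.trans (⟦⟧-cong h.0-homo) 1#-homo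
        ; +-homo = λ a b → A.trans (⟦⟧-cong (h.+-homo a b)) (*-homo _ _)
        }
        where module h = IsPowerFunction h-power

      homomorphism-expansion : ∀ f → ψ f A.≈ ∑ᴬ f (ψ ∘ monomial)
      homomorphism-expansion f = A.trans (⟦⟧-cong (expansion f)) (∑-homo f monomial)

      homomorphism-monomial : ∀ α β → ψ (monomial (α , β)) A.≈ ∏ᴬ (λ i → ψ (xᵃ i (lookup α i)) A.* ψ (yᵇ i (lookup β i)))
      homomorphism-monomial α β = A.trans (⟦⟧-cong (monomial-∏ α β))
        (A.trans (∏-homo (λ i → xᵃ i (lookup α i) L.* yᵇ i (lookup β i)))
          (∏ᴬ-cong (λ i → *-homo (xᵃ i (lookup α i)) (yᵇ i (lookup β i)))))

    -- Every Laurent polynomial is a combination of products of powers of the variables, and a power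
    -- function is determined by its value at 1 because inverses are unique.
    homomorphism-unique : ∀ {ψ χ} → IsAlgebraHomomorphism Laurent A ψ → IsAlgebraHomomorphism Laurent A χ →
                          (∀ i → ψ (x i) A.≈ χ (x i)) → (∀ i → ψ (y i) A.≈ χ (y i)) → ∀ f → ψ f A.≈ χ f
    homomorphism-unique {ψ} {χ} ψ-homo χ-homo ψx≈χx ψy≈χy f = begin
      ψ f                     ≈⟨ homomorphism-expansion ψ-homo f ⟩
      ∑ᴬ f (ψ ∘ monomial)     ≈⟨ ∑ᴬ-cong f (λ (α , β) → A.trans (homomorphism-monomial ψ-homo α β)
                                   (A.trans (∏ᴬ-cong λ i → A.*-cong (x-unique i (lookup α i)) (y-unique i (lookup β i)))
                                   (A.sym (homomorphism-monomial χ-homo α β)))) ⟩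
      ∑ᴬ f (χ ∘ monomial)     ≈⟨ homomorphism-expansion χ-homo f ⟨
      χ f                     ∎
      where
      open SetoidReasoning A.setoid
      x-unique : ∀ i a → ψ (xᵃ i a) A.≈ χ (xᵃ i a)
      x-unique i = powers-unique (homomorphism-power ψ-homo (xᵃ-power i)) (homomorphism-power χ-homo (xᵃ-power i)) (ψx≈χx i)
      y-unique : ∀ i b → ψ (yᵇ i b) A.≈ χ (yᵇ i b)
      y-unique i = powers-unique (homomorphism-power ψ-homo (yᵇ-power i)) (homomorphism-power χ-homo (yᵇ-power i)) (ψy≈χy i)

  module _ (A : CommutativeAlgebra K) where
    private module A = CommutativeAlgebra A
    open AlgebraSums A using (∑-++; ∑-*ˡ; ∑-*ʳ; ∑-combine; ∑-vanishes) renaming (∑ to ∑ᴬ; ∑-cong to ∑ᴬ-cong; ∑-[] to ∑ᴬ-[])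

    module MonomialExtension (m : Monomial → A.Carrier) (m-1 : m (𝟘 , 𝟘) A.≈ A.1#)
      (m-* : ∀ u v → m (u ∙ v) A.≈ m u A.* m v) where

      extend : L.Carrier → A.Carrier
      extend f = ∑ᴬ f m

      extend-monomial : ∀ u → extend (monomial u) A.≈ m u
      extend-monomial u = ∑ᴬ-[] u m

      private
        ⊛≡combine : ∀ f g → f ⊛ g ≡ combine _∙_ f g
        ⊛≡combine []            g = ≡.refl
        ⊛≡combine ((a , u) ∷ f) g = ≡.cong (map (λ (b , v) → a K.* b , u ∙ v) g ++_) (⊛≡combine f g)

        extend-neg : ∀ f → extend (L.- f) A.≈ A.- extend f
        extend-neg []            = A.sym (A.trans (A.sym (A.+-identityˡ _)) (A.-‿inverseʳ A.0#))
        extend-neg ((a , u) ∷ f) = A.trans (A.+-cong (A.trans (A.*-congʳ (ι-neg a)) (A.sym (-‿distribˡ-* _ _))) (extend-neg f))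
          (-‿+-comm _ _)
          where
          open IsRingHomomorphism A.ι-isRingHomomorphism using () renaming (-‿homo to ι-neg)
          open RingProperties A.ring using (-‿distribˡ-*; -‿+-comm)

        extend-* : ∀ f g → extend (f L.* g) A.≈ extend f A.* extend g
        extend-* f g = begin
          ∑ᴬ (f ⊛ g) m                              ≡⟨ ≡.cong (λ h → ∑ᴬ h m) (⊛≡combine f g) ⟩
          ∑ᴬ (combine _∙_ f g) m                    ≈⟨ ∑-combine _∙_ f g m ⟩
          ∑ᴬ f (λ u → ∑ᴬ g (λ v → m (u ∙ v)))       ≈⟨ ∑ᴬ-cong f (λ u → A.trans (∑ᴬ-cong g (m-* u)) (∑-*ˡ g (m u) m)) ⟩
          ∑ᴬ f (λ u → m u A.* ∑ᴬ g m)               ≈⟨ ∑-*ʳ f (∑ᴬ g m) m ⟩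
          ∑ᴬ f m A.* ∑ᴬ g m                         ∎
          where open SetoidReasoning A.setoid

        -- `extend` reads the list, whereas equality only sees coefficients. The list for f - g has
        -- zero total coefficients, so grouping by monomial makes its image vanish.
        extend-cong : ∀ {f g} → f L.≈ g → extend f A.≈ extend g
        extend-cong {f} {g} f≈g = x∙y⁻¹≈ε⇒x≈y _ _ (A.trans (A.+-congˡ (A.sym (extend-neg g)))
          (A.trans (A.sym (∑-++ f (⊟ g) m)) (∑-vanishes _≟ᵐ_ (f ++ ⊟ g) m λ v →
            K.trans (Sums.∑-++ K f (⊟ g) _) (K.trans (K.+-cong (f≈g at v) (Sums.∑-neg K g _)) (K.-‿inverseʳ _)))))
          where open RingProperties A.ring using (x∙y⁻¹≈ε⇒x≈y)

      extend-isAlgebraHomomorphism : IsAlgebraHomomorphism Laurent A extend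
      extend-isAlgebraHomomorphism = record
        { isRingHomomorphism = record
          { isSemiringHomomorphism = record
            { isNearSemiringHomomorphism = record
              { +-isMonoidHomomorphism = record
                { isMagmaHomomorphism = record
                  { isRelHomomorphism = record { cong = extend-cong }
                  ; homo = λ f g → ∑-++ f g m
                  }
                ; ε-homo = A.refl
                }
              ; *-homo = extend-*
              }
            ; 1#-homo = A.trans (extend-monomial (𝟘 , 𝟘)) m-1
            }
          ; -‿homo = extend-neg
          }
        ; ι-homo = λ k → A.trans (A.+-identityʳ _) (A.trans (A.*-congˡ m-1) (A.*-identityʳ _))
        }

-- Quotients, and reduction modulo the relations to products of cells.

module QuotientProperties {K : CommutativeRing 0ℓ 0ℓ} (A : CommutativeAlgebra K) {I : Set} (g : I → CommutativeAlgebra.Carrier A) where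
  open CommutativeAlgebra A
  private module Q = CommutativeAlgebra (quotient A g)

  ≈⇒quotient-≈ : ∀ {p q} → p ≈ q → p Q.≈ q
  ≈⇒quotient-≈ {p} {q} e = respects (sym (trans (+-congʳ e) (-‿inverseʳ q))) null

  ideal⇒quotient-≈0 : ∀ {p} → Ideal A g p → p Q.≈ Q.0#
  ideal⇒quotient-≈0 {p} = respects (sym (trans (+-congˡ (RingProperties.-0#≈0# ring)) (+-identityʳ p)))

  projection-isAlgebraHomomorphism : IsAlgebraHomomorphism A (quotient A g) id
  projection-isAlgebraHomomorphism = record
    { isRingHomomorphism = record
      { isSemiringHomomorphism = record
        { isNearSemiringHomomorphism = record
          { +-isMonoidHomomorphism = record
            { isMagmaHomomorphism = record
              { isRelHomomorphism = record { cong = ≈⇒quotient-≈ }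
              ; homo = λ _ _ → Q.refl
              }
            ; ε-homo = Q.refl
            }
          ; *-homo = λ _ _ → Q.refl
          }
        ; 1#-homo = Q.refl
        }
      ; -‿homo = λ _ → Q.refl
      }
    ; ι-homo = λ _ → Q.refl
    }

module CellSpans (K : CommutativeRing 0ℓ 0ℓ) (d : ℕ) where
  open LaurentPolynomials K d
  private module L = CommutativeAlgebra Laurent
  open LaurentMonomials K d
  open Sums K using (Combination)
  open Tensors K

  cellᴸ : Fin d → Cell → L.Carrier
  cellᴸ i = SpanOfCells.cell Laurent (xᵃ i) (yᵇ i)

  cellsᴸ : Vec Cell d → L.Carrier
  cellsᴸ c = Products.∏ L.commutativeRing (λ i → cellᴸ i (lookup c i))

  module _ {A : CommutativeAlgebra K} where
    open CommutativeAlgebra A hiding (zero)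
    open AlgebraSums A
    open Products commutativeRing

    module _ {ψ : L.Carrier → Carrier} (ψ-homo : IsAlgebraHomomorphism Laurent A ψ) where
      open IsRingHomomorphism (IsAlgebraHomomorphism.isRingHomomorphism ψ-homo) using (*-homo; 1#-homo)
      open HomomorphismProperties {A = Laurent} {B = A} ψ-homo

      ψ-cell : ∀ i c → SpanOfCells.cell A (ψ ∘ xᵃ i) (ψ ∘ yᵇ i) c ≈ ψ (cellᴸ i c)
      ψ-cell i (a , false) = refl
      ψ-cell i (a , true)  = sym (trans (*-homo (xᵃ i a) (y i L.- L.1# L.- x i))
        (*-congˡ (trans (minus-homo (y i L.- L.1#) (x i))
          (+-congʳ (trans (minus-homo (y i) L.1#) (+-congˡ (-‿cong 1#-homo)))))))

      module _ (ψ-relation : ∀ i → ψ (relation i) ≈ 0#) where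
        open Span (ψ ∘ cellsᴸ)

        private
          relation≈0 : ∀ i → (ψ (y i) - 1#) * (ψ (y i) - ψ (x i)) ≈ 0#
          relation≈0 i = trans (sym (trans (*-homo (y i L.- L.1#) (y i L.- x i))
            (*-cong (trans (minus-homo (y i) L.1#) (+-congˡ (-‿cong 1#-homo))) (minus-homo (y i) (x i))))) (ψ-relation i)

          factor : ∀ i a b → ∃ λ g → ψ (xᵃ i a) * ψ (yᵇ i b) ≈ ∑ g (ψ ∘ cellᴸ i)
          factor i a b =
            let g , e = SpanOfCells.monomial-spanned A (ψ ∘ xᵃ i) (ψ ∘ yᵇ i)
                  (homomorphism-power ψ-homo (xᵃ-power i)) (homomorphism-power ψ-homo (yᵇ-power i)) (relation≈0 i) a b
            in g , trans (*-comm _ _) (trans e (∑-cong g (ψ-cell i)))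

          monomial-spanned : ∀ u → Spanned (ψ (monomial u))
          monomial-spanned (α , β) = tensor g ,
            trans (homomorphism-monomial ψ-homo α β)
              (trans (∏-cong λ i → proj₂ (factor i (lookup α i) (lookup β i)))
              (trans (∏-∑ g (λ i → ψ ∘ cellᴸ i))
                (∑-cong (tensor g) λ c → sym (∏-homo (λ i → cellᴸ i (lookup c i))))))
            where
            g : Fin d → Combination Cell
            g i = proj₁ (factor i (lookup α i) (lookup β i))

        -- The combination is returned as a Laurent polynomial before ψ is applied. When ψ is the
        -- projection to the quotient, the equation says that p differs from it by an element of the
        -- ideal.
        cells-span : ∀ p → ∃ λ g → ψ p ≈ ψ (AlgebraSums.∑ Laurent g cellsᴸ)
        cells-span p =
          let g , e = spanned-resp (homomorphism-expansion ψ-homo p) (spanned-∑ p monomial-spanned)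
          in g , trans e (sym (∑-homo g cellsᴸ))

-- The homomorphism defined by intervals on the axes, and its kernel.

module _ {K : CommutativeRing 0ℓ 0ℓ} (A : CommutativeAlgebra K) (d : ℕ) where
  open CommutativeAlgebra A

  -- What the construction of φ takes from geometry: intervals on each axis multiply by Minkowski
  -- addition, and `axis-cut` is inclusion-exclusion for cutting [0,2] at 1.
  record AxisSystem : Set where
    field
      axis     : Fin d → Interval → Carrier
      axis-1   : ∀ i → axis i point ≈ 1#
      axis-*   : ∀ i s t → axis i (s ⊞ᴵ t) ≈ axis i s * axis i t
      axis-cut : ∀ i → axis i (0ℤ , 2) + axis i (1ℤ , 0) ≈ axis i (0ℤ , 1) + axis i (1ℤ , 1)

module AxisAlgebra {K : CommutativeRing 0ℓ 0ℓ} {d : ℕ} {A : CommutativeAlgebra K} (axes : AxisSystem A d) where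
  open AxisSystem axes
  open CommutativeAlgebra A hiding (zero)
  private module K = CommutativeRing K
  open QuotientProperties
  open LaurentPolynomials K d
  private module L = CommutativeAlgebra Laurent
  open LaurentMonomials K d
  open CellSpans K d
  open Products commutativeRing
  open IntegerPowers commutativeRing
  open IntegerMultiples commutativeRing using (solve; _:=_; _:*_; _:+_; _:-_; :-_; con)
  open AlgebraSums A using (∑; ι-neg-*)
  open IsRingHomomorphism ι-isRingHomomorphism using () renaming (1#-homo to ι-1)
  open ClosedIntervals K
  open AxisCells A axis
  open SetoidReasoning setoid

  𝐱 : Fin d → ℤ → Carrier
  𝐱 i a = axis i (a , 0)

  private
    u : Fin d → Carrier
    u i = axis i (0ℤ , 1)

  -- Expanded, the product is (y y + x) - (y + x y). Here y y is [0,2] and x y is [1,2], so this is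
  -- exactly the difference of the two sides of the cut.
  relation≈0 : ∀ i → (u i - 1#) * (u i - 𝐱 i 1ℤ) ≈ 0#
  relation≈0 i = begin
    (u i - 1#) * (u i - 𝐱 i 1ℤ)
      ≈⟨ solve 2 (λ x y → (y :- con 1ℤ) :* (y :- x) := (y :* y :+ x) :- (y :+ x :* y)) refl (𝐱 i 1ℤ) (u i) ⟩
    (u i * u i + 𝐱 i 1ℤ) - (u i + 𝐱 i 1ℤ * u i)
      ≈⟨ +-cong (+-congʳ (axis-* i (0ℤ , 1) (0ℤ , 1))) (-‿cong (+-congˡ (axis-* i (1ℤ , 0) (0ℤ , 1)))) ⟨
    (axis i (0ℤ , 2) + 𝐱 i 1ℤ) - (u i + axis i (1ℤ , 1))
      ≈⟨ +-congʳ (axis-cut i) ⟩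
    (u i + axis i (1ℤ , 1)) - (u i + axis i (1ℤ , 1))
      ≈⟨ -‿inverseʳ _ ⟩
    0# ∎

  𝐱-power : ∀ i → IsPowerFunction (𝐱 i)
  𝐱-power i = record { 0-homo = axis-1 i ; +-homo = λ a b → axis-* i (a , 0) (b , 0) }

  -- y⁻¹ = x⁻¹ (1 + x - y), because y (1 + x - y) = x - (y - 1) (y - x)
  u⁻¹ : Fin d → Carrier
  u⁻¹ i = 𝐱 i -1ℤ * (1# + 𝐱 i 1ℤ - u i)

  u*u⁻¹≈1 : ∀ i → u i * u⁻¹ i ≈ 1#
  u*u⁻¹≈1 i = begin
    u i * u⁻¹ i
      ≈⟨ solve 3 (λ x x′ y → y :* (x′ :* (con 1ℤ :+ x :- y)) := x :* x′ :- x′ :* ((y :- con 1ℤ) :* (y :- x)))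
           refl (𝐱 i 1ℤ) (𝐱 i -1ℤ) (u i) ⟩
    𝐱 i 1ℤ * 𝐱 i -1ℤ - 𝐱 i -1ℤ * ((u i - 1#) * (u i - 𝐱 i 1ℤ))
      ≈⟨ +-cong (IsPowerFunction.inverse (𝐱-power i)) (-‿cong (*-congˡ (relation≈0 i))) ⟩
    1# - 𝐱 i -1ℤ * 0#
      ≈⟨ solve 1 (λ z → con 1ℤ :- z :* con 0ℤ := con 1ℤ) refl (𝐱 i -1ℤ) ⟩
    1# ∎

  𝐲 : Fin d → ℤ → Carrier
  𝐲 i = power (u i) (u⁻¹ i) (u*u⁻¹≈1 i)

  𝐲-power : ∀ i → IsPowerFunction (𝐲 i)
  𝐲-power i = power-isPowerFunction (u i) (u⁻¹ i) (u*u⁻¹≈1 i)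

  𝐲-axis : ∀ i n → 𝐲 i (ℤ.+ n) ≈ axis i (0ℤ , n)
  𝐲-axis i zero    = sym (axis-1 i)
  𝐲-axis i (suc n) = trans (*-congˡ (𝐲-axis i n)) (sym (axis-* i (0ℤ , 1) (0ℤ , n)))

  𝐱*𝐲-axis : ∀ i a n → 𝐱 i a * 𝐲 i (ℤ.+ n) ≈ axis i (a , n)
  𝐱*𝐲-axis i a n = trans (*-congˡ (𝐲-axis i n)) (trans (sym (axis-* i (a , 0) (0ℤ , n)))
    (reflexive (≡.cong (λ b → axis i (b , n)) (ℤ.+-identityʳ a))))

  private
    module 𝐱 i = IsPowerFunction (𝐱-power i)
    module 𝐲 i = IsPowerFunction (𝐲-power i)

    m : Monomial → Carrier
    m (α , β) = ∏ (λ i → 𝐱 i (lookup α i) * 𝐲 i (lookup β i))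

    𝐱*𝐲-𝟘 : ∀ i → 𝐱 i (lookup 𝟘 i) * 𝐲 i (lookup 𝟘 i) ≈ 1#
    𝐱*𝐲-𝟘 i = trans (reflexive (≡.cong (λ a → 𝐱 i a * 𝐲 i a) (Vec.lookup-replicate i 0ℤ)))
      (trans (*-cong (𝐱.0-homo i) (𝐲.0-homo i)) (*-identityˡ 1#))

    m-1 : m (𝟘 , 𝟘) ≈ 1#
    m-1 = trans (∏-cong 𝐱*𝐲-𝟘) (∏-1 d)

    m-* : ∀ v w → m (v ∙ w) ≈ m v * m w
    m-* (α , β) (α′ , β′) = trans (∏-cong coordinate)
      (∏-distrib-* (λ i → 𝐱 i (lookup α i) * 𝐲 i (lookup β i)) (λ i → 𝐱 i (lookup α′ i) * 𝐲 i (lookup β′ i)))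
      where
      coordinate : ∀ i → 𝐱 i (lookup (zipWith ℤ._+_ α α′) i) * 𝐲 i (lookup (zipWith ℤ._+_ β β′) i) ≈
                         (𝐱 i (lookup α i) * 𝐲 i (lookup β i)) * (𝐱 i (lookup α′ i) * 𝐲 i (lookup β′ i))
      coordinate i = begin
        𝐱 i (lookup (zipWith ℤ._+_ α α′) i) * 𝐲 i (lookup (zipWith ℤ._+_ β β′) i)
          ≡⟨ ≡.cong₂ (λ a b → 𝐱 i a * 𝐲 i b) (Vec.lookup-zipWith ℤ._+_ i α α′) (Vec.lookup-zipWith ℤ._+_ i β β′) ⟩
        𝐱 i (lookup α i ℤ.+ lookup α′ i) * 𝐲 i (lookup β i ℤ.+ lookup β′ i)
          ≈⟨ *-cong (𝐱.+-homo i (lookup α i) (lookup α′ i)) (𝐲.+-homo i (lookup β i) (lookup β′ i)) ⟩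
        (𝐱 i (lookup α i) * 𝐱 i (lookup α′ i)) * (𝐲 i (lookup β i) * 𝐲 i (lookup β′ i))
          ≈⟨ solve 4 (λ p q r s → (p :* q) :* (r :* s) := (p :* r) :* (q :* s)) refl _ _ _ _ ⟩
        (𝐱 i (lookup α i) * 𝐲 i (lookup β i)) * (𝐱 i (lookup α′ i) * 𝐲 i (lookup β′ i)) ∎

  open MonomialExtension A m m-1 m-* using (extend; extend-isAlgebraHomomorphism; extend-monomial)

  φ : L.Carrier → Carrier
  φ = extend

  φ-homo : IsAlgebraHomomorphism (LaurentPolynomials.Laurent K d) A φ
  φ-homo = extend-isAlgebraHomomorphism

  open IsAlgebraHomomorphism φ-homo
  open IsRingHomomorphism isRingHomomorphism using (*-homo; 1#-homo)
  open HomomorphismProperties {A = Laurent} {B = A} φ-homo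

  private
    evaluate-axis : ∀ (h : Fin d → ℤ → Carrier) → (∀ i → IsPowerFunction (h i)) → ∀ i a →
                    ∏ (λ j → h j (lookup (𝟘 [ i ]≔ a) j)) ≈ h i a
    evaluate-axis h h-power = ∏-axis 0ℤ h (λ i → IsPowerFunction.0-homo (h-power i))

    evaluate-𝟘 : ∀ (h : Fin d → ℤ → Carrier) → (∀ i → IsPowerFunction (h i)) → ∏ (λ j → h j (lookup 𝟘 j)) ≈ 1#
    evaluate-𝟘 h h-power = trans (∏-cong λ j → trans (reflexive (≡.cong (h j) (Vec.lookup-replicate j 0ℤ)))
      (IsPowerFunction.0-homo (h-power j))) (∏-1 d)

  φ-xᵃ : ∀ i a → φ (xᵃ i a) ≈ 𝐱 i a
  φ-xᵃ i a = begin
    φ (xᵃ i a)                ≈⟨ extend-monomial (𝟘 [ i ]≔ a , 𝟘) ⟩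
    m (𝟘 [ i ]≔ a , 𝟘)        ≈⟨ ∏-distrib-* (λ j → 𝐱 j (lookup (𝟘 [ i ]≔ a) j)) (λ j → 𝐲 j (lookup 𝟘 j)) ⟩
    ∏ (λ j → 𝐱 j (lookup (𝟘 [ i ]≔ a) j)) * ∏ (λ j → 𝐲 j (lookup 𝟘 j))
                              ≈⟨ *-cong (evaluate-axis 𝐱 𝐱-power i a) (evaluate-𝟘 𝐲 𝐲-power) ⟩
    𝐱 i a * 1#                ≈⟨ *-identityʳ _ ⟩
    𝐱 i a                     ∎

  φ-yᵇ : ∀ i b → φ (yᵇ i b) ≈ 𝐲 i b
  φ-yᵇ i b = begin
    φ (yᵇ i b)                ≈⟨ extend-monomial (𝟘 , 𝟘 [ i ]≔ b) ⟩
    m (𝟘 , 𝟘 [ i ]≔ b)        ≈⟨ ∏-distrib-* (λ j → 𝐱 j (lookup 𝟘 j)) (λ j → 𝐲 j (lookup (𝟘 [ i ]≔ b) j)) ⟩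
    ∏ (λ j → 𝐱 j (lookup 𝟘 j)) * ∏ (λ j → 𝐲 j (lookup (𝟘 [ i ]≔ b) j))
                              ≈⟨ *-cong (evaluate-𝟘 𝐱 𝐱-power) (evaluate-axis 𝐲 𝐲-power i b) ⟩
    1# * 𝐲 i b                ≈⟨ *-identityˡ _ ⟩
    𝐲 i b                     ∎

  φ-x : ∀ i → φ (x i) ≈ axis i (1ℤ , 0)
  φ-x i = φ-xᵃ i 1ℤ

  φ-y : ∀ i → φ (y i) ≈ axis i (0ℤ , 1)
  φ-y i = trans (φ-yᵇ i 1ℤ) (𝐲-axis i 1)

  φ-box : ∀ (v : Vec Interval d) →
          φ (monomial (Vec.map proj₁ v , Vec.map (ℤ.+_ ∘ proj₂) v)) ≈ ∏ (λ i → axis i (lookup v i))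
  φ-box v = trans (extend-monomial (Vec.map proj₁ v , Vec.map (ℤ.+_ ∘ proj₂) v)) (∏-cong λ i → trans
    (reflexive (≡.cong₂ (λ a b → 𝐱 i a * 𝐲 i b) (Vec.lookup-map i proj₁ v) (Vec.lookup-map i (ℤ.+_ ∘ proj₂) v)))
    (𝐱*𝐲-axis i (proj₁ (lookup v i)) (proj₂ (lookup v i))))

  φ-relation : ∀ i → φ (relation i) ≈ 0#
  φ-relation i = begin
    φ (relation i)                                ≈⟨ *-homo (y i L.- L.1#) (y i L.- x i) ⟩
    φ (y i L.- L.1#) * φ (y i L.- x i)            ≈⟨ *-cong (minus-homo (y i) L.1#) (minus-homo (y i) (x i)) ⟩
    (φ (y i) - φ L.1#) * (φ (y i) - φ (x i))
      ≈⟨ *-cong (+-cong (φ-y i) (-‿cong 1#-homo)) (+-cong (φ-y i) (-‿cong (φ-x i))) ⟩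
    (u i - 1#) * (u i - 𝐱 i 1ℤ)                   ≈⟨ relation≈0 i ⟩
    0#                                            ∎

  φ-kills-ideal : ∀ {p} → Ideal Laurent relation p → φ p ≈ 0#
  φ-kills-ideal = ideal⊆kernel relation φ-relation

  φ-cell : ∀ i c → φ (cellᴸ i c) ≈ ∑ (closedIntervals c) (axis i)
  φ-cell i (a , false) = trans (φ-xᵃ i a) (sym (AlgebraSums.∑-[] A (a , 0) (axis i)))
  φ-cell i (a , true)  = begin
    φ (xᵃ i a L.* (y i L.- L.1# L.- x i))
      ≈⟨ *-homo (xᵃ i a) (y i L.- L.1# L.- x i) ⟩
    φ (xᵃ i a) * φ (y i L.- L.1# L.- x i)
      ≈⟨ *-cong (φ-xᵃ i a) (trans (minus-homo (y i L.- L.1#) (x i))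
           (+-cong (trans (minus-homo (y i) L.1#) (+-cong (φ-yᵇ i 1ℤ) (-‿cong 1#-homo))) (-‿cong (φ-x i)))) ⟩
    𝐱 i a * (𝐲 i 1ℤ - 1# - 𝐱 i 1ℤ)
      ≈⟨ solve 3 (λ p x y → p :* (y :- con 1ℤ :- x) := p :* y :+ (:- p :+ (:- (p :* x) :+ con 0ℤ))) refl (𝐱 i a) (𝐱 i 1ℤ) (𝐲 i 1ℤ) ⟩
    𝐱 i a * 𝐲 i 1ℤ + (- 𝐱 i a + (- (𝐱 i a * 𝐱 i 1ℤ) + 0#))
      ≈⟨ +-cong (trans (𝐱*𝐲-axis i a 1) (trans (sym (*-identityˡ _)) (*-congʳ (sym ι-1))))
           (+-cong (sym (ι-neg-* _)) (+-congʳ (trans (-‿cong (sym (𝐱.+-homo i a 1ℤ))) (sym (ι-neg-* _))))) ⟩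
    ∑ (closedIntervals (a , true)) (axis i) ∎

  φ-cells : ∀ c → φ (cellsᴸ c) ≈ cells c
  φ-cells c = trans (∏-homo (λ i → cellᴸ i (lookup c i))) (∏-cong λ i → φ-cell i (lookup c i))

  module _ (cells-independent : ∀ g → ∑ g cells ≈ 0# → ∀ c → Sums.∑ K g (λ c′ → Indicators.𝟙 K (Vec.≡-dec _≟ᶜ_ c′ c)) K.≈ K.0#) where

    -- A combination s of cells congruent to p is killed by φ too, since φ kills the ideal.
    -- Independence then removes s, leaving p itself in the ideal.
    φ-kernel : ∀ {p} → φ p ≈ 0# → Ideal Laurent relation p
    φ-kernel {p} φp≈0 = respects p-s≈p p~s
      where
      span = cells-span {A = quotient Laurent relation} (projection-isAlgebraHomomorphism Laurent relation)
        (λ i → ideal⇒quotient-≈0 Laurent relation {relation i} (generator i)) p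
      g = proj₁ span
      s = AlgebraSums.∑ Laurent g cellsᴸ

      p~s : Ideal Laurent relation (p L.- s)
      p~s = proj₂ span

      φs≈0 : ∑ g cells ≈ 0#
      φs≈0 = begin
        ∑ g cells                     ≈⟨ AlgebraSums.∑-cong A g φ-cells ⟨
        ∑ g (φ ∘ cellsᴸ)              ≈⟨ ∑-homo g cellsᴸ ⟨
        φ s                           ≈⟨ RingProperties.x∙y⁻¹≈ε⇒x≈y ring (φ p) (φ s) (trans (sym (minus-homo p s)) (φ-kills-ideal p~s)) ⟨
        φ p                           ≈⟨ φp≈0 ⟩
        0#                            ∎

      -- Every tuple of cells has total coefficient zero in g, so s is zero as a Laurent polynomial
      -- and not merely modulo the ideal.
      s≈0 : s L.≈ L.0#
      s≈0 = AlgebraSums.∑-vanishes Laurent (Vec.≡-dec _≟ᶜ_) g cellsᴸ (cells-independent g φs≈0)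

      p-s≈p : p L.- s L.≈ p
      p-s≈p = L.trans {p L.- s} {p L.- L.0#} {p} (L.+-cong {p} {p} (L.refl {p}) (L.-‿cong {s} {L.0#} s≈0)) (L.+-identityʳ p)

-- Lattice boxes, their Minkowski sums and their indicator functions.

module LatticeBoxes (F : CompleteOrderedField) (d : ℕ) where
  open CompleteOrderedField F using (commutativeRing) renaming
    (Carrier to ℝ; _≤_ to _≤ᴿ_; _≈_ to _≈ᴿ_; _+_ to _+ᴿ_; _-_ to _-ᴿ_; 0# to 0ᴿ; 1# to 1ᴿ; refl to ≈ᴿ-refl; sym to ≈ᴿ-sym; trans to ≈ᴿ-trans; reflexive to ≈ᴿ-reflexive)
  open OrderedFieldProperties F using (total; ≤-antisym; ≤-reflexive; ≤-trans)
  open IntegerMultiples commutativeRing using (fromℤ; solve; _:=_; _:+_; _:-_)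
  open Polyhedra F
  open MinkowskiSum F
  open LatticeIntervals F
  open Boxes F d
  private module ℂ = CommutativeRing ℂ
  open Sums ℂ using (Combination) renaming (∑ to ∑ᶜ)
  open Indicators ℂ
  open PolyhedralCombination using (⟦_⟧; pointwise; _at_; ∑-⊛; _≋_)

  Inside : Vec Interval d → W → Set
  Inside v w = ∀ i → Within (lookup v i) (lookup w i)

  private
    toPointwise : ∀ {A B : Set} {_∼_ : A → B → Set} {n} {xs : Vec A n} {ys : Vec B n} →
                  (∀ i → lookup xs i ∼ lookup ys i) → Pointwise _∼_ xs ys
    toPointwise f = Extensional.extensional⇒inductive (Extensional.ext f)

  polyhedron : Vec Interval d → Polyhedron d
  polyhedron v = box (Vec.map (fromℤ ∘ lower) v) (Vec.map (fromℤ ∘ upper) v)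

  ∈-polyhedron : ∀ v w → w ∈ᴾ polyhedron v ⇔ Inside v w
  ∈-polyhedron v w = mk⇔
    (λ p i → let l , u = Equivalence.to (∈-box _ _ w) p
             in ≡.subst (_≤ᴿ lookup w i) (Vec.lookup-map i _ v) (Pointwise.lookup l i) ,
                ≡.subst (lookup w i ≤ᴿ_) (Vec.lookup-map i _ v) (Pointwise.lookup u i))
    (λ q → Equivalence.from (∈-box _ _ w)
      ( toPointwise (λ i → ≡.subst (_≤ᴿ lookup w i) (≡.sym (Vec.lookup-map i _ v)) (proj₁ (q i)))
      , toPointwise (λ i → ≡.subst (lookup w i ≤ᴿ_) (≡.sym (Vec.lookup-map i _ v)) (proj₂ (q i)))))

  -- Boxes impose independent conditions on the coordinates, so splitting each coordinate of w
  -- separately already yields the two summands.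
  ∈-polyhedron-⊕ : ∀ u v w → w ∈ᴾ polyhedron u ⊕ polyhedron v ⇔ w ∈ᴾ polyhedron (zipWith _⊞ᴵ_ u v)
  ∈-polyhedron-⊕ u v w = mk⇔
    (λ p → let a , b , a∈ , b∈ , e = Equivalence.to (∈-⊕ (polyhedron u) (polyhedron v) w) p
           in Equivalence.from (∈-polyhedron _ w) λ i →
             ≡.subst (λ s → Within s (lookup w i)) (≡.sym (Vec.lookup-zipWith _⊞ᴵ_ i u v))
               (within-resp (lookup u i ⊞ᴵ lookup v i)
                 (≈ᴿ-trans (≈ᴿ-reflexive (≡.sym (Vec.lookup-zipWith _+ᴿ_ i a b))) (≈ᴿ-sym (Pointwise.lookup e i)))
                 (within-⊞ (lookup u i) (lookup v i)
                   (Equivalence.to (∈-polyhedron u a) a∈ i) (Equivalence.to (∈-polyhedron v b) b∈ i))))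
    (λ p → let part : ∀ i → ∃ λ s → Within (lookup u i) s × Within (lookup v i) (lookup w i -ᴿ s)
               part i = within-split (lookup u i) (lookup v i)
                 (≡.subst (λ s → Within s (lookup w i)) (Vec.lookup-zipWith _⊞ᴵ_ i u v) (Equivalence.to (∈-polyhedron _ w) p i))
               a = λ i → proj₁ (part i)
               b = λ i → lookup w i -ᴿ a i
           in Equivalence.from (∈-⊕ (polyhedron u) (polyhedron v) w)
             ( tabulate a , tabulate b
             , Equivalence.from (∈-polyhedron u _) (λ i →
                 ≡.subst (Within (lookup u i)) (≡.sym (Vec.lookup∘tabulate a i)) (proj₁ (proj₂ (part i))))
             , Equivalence.from (∈-polyhedron v _) (λ i →
                 ≡.subst (Within (lookup v i)) (≡.sym (Vec.lookup∘tabulate b i)) (proj₂ (proj₂ (part i))))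
             , toPointwise (λ i → ≈ᴿ-trans
                 (solve 2 (λ w a → w := a :+ (w :- a)) ≈ᴿ-refl (lookup w i) (a i))
                 (≈ᴿ-reflexive (≡.sym (≡.trans (Vec.lookup-zipWith _+ᴿ_ i (tabulate a) (tabulate b))
                   (≡.cong₂ _+ᴿ_ (Vec.lookup∘tabulate a i) (Vec.lookup∘tabulate b i))))))))

  polyhedron-latticeBox : ∀ v → LatticeBox (polyhedron v)
  polyhedron-latticeBox v = Vec.map lower v , Vec.map upper v ,
    (λ i → ≡.subst₂ ℤ._≤_ (≡.sym (Vec.lookup-map i lower v)) (≡.sym (Vec.lookup-map i upper v))
      (ℤ.i≤i+j _ (ℤ.+ proj₂ (lookup v i)))) ,
    λ w → mk⇔
      (λ p i → let l , u = Equivalence.to (∈-polyhedron v w) p i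
               in ≡.subst (λ a → fromℤ a ≤ᴿ lookup w i) (≡.sym (Vec.lookup-map i lower v)) l ,
                  ≡.subst (λ b → lookup w i ≤ᴿ fromℤ b) (≡.sym (Vec.lookup-map i upper v)) u)
      (λ q → Equivalence.from (∈-polyhedron v w) λ i →
        ≡.subst (λ a → fromℤ a ≤ᴿ lookup w i) (Vec.lookup-map i lower v) (proj₁ (q i)) ,
        ≡.subst (λ b → lookup w i ≤ᴿ fromℤ b) (Vec.lookup-map i upper v) (proj₂ (q i)))

  -- `LatticeBox` constrains the set of points and leaves the defining inequalities free; here they
  -- are replaced by the standard ones.
  latticeBox-polyhedron : ∀ {P} → LatticeBox P → ∃ λ v → ∀ w → w ∈ᴾ P ⇔ w ∈ᴾ polyhedron v
  latticeBox-polyhedron (a , b , a≤b , P⇔) = tabulate v , λ w → mk⇔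
    (λ p → Equivalence.from (∈-polyhedron _ w) λ i → let l , u = Equivalence.to (P⇔ w) p i in
      ≡.subst (λ s → Within s (lookup w i)) (≡.sym (Vec.lookup∘tabulate v i))
        (l , ≡.subst (λ c → lookup w i ≤ᴿ fromℤ c) (≡.sym (upper-v i)) u))
    (λ p → Equivalence.from (P⇔ w) λ i →
      let l , u = ≡.subst (λ s → Within s (lookup w i)) (Vec.lookup∘tabulate v i) (Equivalence.to (∈-polyhedron _ w) p i)
      in l , ≡.subst (λ c → lookup w i ≤ᴿ fromℤ c) (upper-v i) u)
    where
    v : Fin d → Interval
    v i = lookup a i , ℤ.∣ lookup b i ℤ.- lookup a i ∣
    upper-v : ∀ i → upper (v i) ≡ lookup b i
    upper-v i = i+∣j-i∣≡j (a≤b i)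

  value : M𝓑.Carrier → W → ℂ.Carrier
  value (f , _) w = ⟦ f ⟧ w

  open AlgebraSums M𝓑 using (∑; linear-∑)

  value-∑ : ∀ {X : Set} (f : Combination X) h w → value (∑ f h) w ℂ.≈ ∑ᶜ f (λ x → value (h x) w)
  value-∑ f h w = linear-∑ (λ p → value p w) ℂ.refl
    (λ p q → Sums.∑-++ ℂ (proj₁ p) (proj₁ q) _)
    -- A scalar acts as a Minkowski product with a multiple of the origin, and adding the origin
    -- leaves every polyhedron unchanged.
    (λ a p → ℂ.trans (∑-⊛ [ a , origin ] (proj₁ p) _) (ℂ.trans (ℂ.+-identityʳ _) (ℂ.*-congˡ
      (Sums.∑-cong ℂ (proj₁ p) λ P → 𝟙-cong (w ∈ᴾ? origin ⊕ P) (w ∈ᴾ? P) (⊕-identityˡ⇒ P w) (⊕-identityˡ⇐ P w)))))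
    f h

  ⟨_⟩ : Vec Interval d → M𝓑.Carrier
  ⟨ v ⟩ = indicator (polyhedron v) , generator (polyhedron v , polyhedron-latticeBox v)

  private
    value-indicator : ∀ c → ℂ.1# ℂ.* c ℂ.+ ℂ.0# ℂ.≈ c
    value-indicator c = ℂ.trans (ℂ.+-identityʳ _) (ℂ.*-identityˡ c)

  value-⟨⟩ : ∀ v w → value ⟨ v ⟩ w ℂ.≈ 𝟙 (w ∈ᴾ? polyhedron v)
  value-⟨⟩ v w = value-indicator _

  indicator-cong : ∀ {P Q : Polyhedron d} → (∀ w → w ∈ᴾ P ⇔ w ∈ᴾ Q) → indicator P ≋ indicator Q
  indicator-cong {P} {Q} P⇔Q = pointwise λ w → ℂ.+-congʳ (ℂ.*-congˡ
    (𝟙-cong (w ∈ᴾ? P) (w ∈ᴾ? Q) (Equivalence.to (P⇔Q w)) (Equivalence.from (P⇔Q w))))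

  ⟨⟩-* : ∀ u v → ⟨ zipWith _⊞ᴵ_ u v ⟩ M𝓑.≈ ⟨ u ⟩ M𝓑.* ⟨ v ⟩
  ⟨⟩-* u v = pointwise λ w → ℂ.+-congʳ (ℂ.*-cong (ℂ.sym (ℂ.*-identityˡ ℂ.1#))
    (𝟙-cong (w ∈ᴾ? polyhedron (zipWith _⊞ᴵ_ u v)) (w ∈ᴾ? polyhedron u ⊕ polyhedron v)
      (Equivalence.from (∈-polyhedron-⊕ u v w)) (Equivalence.to (∈-polyhedron-⊕ u v w))))

  ⟨⟩-1 : ⟨ replicate d point ⟩ M𝓑.≈ M𝓑.1#
  ⟨⟩-1 = ≡.subst (λ P → indicator (polyhedron (replicate d point)) ≋ indicator P)
    (≡.cong₂ box (Vec.map-replicate (fromℤ ∘ lower) point d) (Vec.map-replicate (fromℤ ∘ upper) point d))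
    (pointwise λ w → ℂ.refl)

  axis : Fin d → Interval → M𝓑.Carrier
  axis i s = ⟨ replicate d point [ i ]≔ s ⟩

  axis-* : ∀ i s t → axis i (s ⊞ᴵ t) M𝓑.≈ axis i s M𝓑.* axis i t
  axis-* i s t = ≡.subst (λ u → ⟨ u ⟩ M𝓑.≈ axis i s M𝓑.* axis i t) (zipWith-[]≔ _⊞ᴵ_ ≡.refl i s t) (⟨⟩-* _ _)

  axis-1 : ∀ i → axis i point M𝓑.≈ M𝓑.1#
  axis-1 i = ≡.subst (λ u → ⟨ u ⟩ M𝓑.≈ M𝓑.1#) (≡.sym (replicate-[]≔ point i)) ⟨⟩-1

  open Products M𝓑.commutativeRing using (∏; homomorphism-axes)

  ⟨⟩-axes : ∀ v → ⟨ v ⟩ M𝓑.≈ ∏ (λ i → axis i (lookup v i))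
  ⟨⟩-axes = homomorphism-axes _⊞ᴵ_ point ⊞ᴵ-identityˡ ⊞ᴵ-identityʳ ⟨_⟩ ⟨⟩-1 ⟨⟩-*

  inside-axis : ∀ i s w → Inside (replicate d point [ i ]≔ s) w → Within s (lookup w i)
  inside-axis i s w p = ≡.subst (λ t → Within t (lookup w i)) (Vec.lookup∘update i (replicate d point) s) (p i)

  off-axis : ∀ i s w → Inside (replicate d point [ i ]≔ s) w → ∀ j → ¬ j ≡ i → Within point (lookup w j)
  off-axis i s w p j j≢i = ≡.subst (λ t → Within t (lookup w j))
    (≡.trans (Vec.lookup∘update′ j≢i (replicate d point) s) (Vec.lookup-replicate j point)) (p j)

  axis-inside : ∀ i s w → Within s (lookup w i) → (∀ j → ¬ j ≡ i → Within point (lookup w j)) →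
                Inside (replicate d point [ i ]≔ s) w
  axis-inside i s w on off j with j ≟ᶠ i
  ... | yes ≡.refl = ≡.subst (λ t → Within t (lookup w i)) (≡.sym (Vec.lookup∘update i (replicate d point) s)) on
  ... | no j≢i = ≡.subst (λ t → Within t (lookup w j))
    (≡.sym (≡.trans (Vec.lookup∘update′ j≢i (replicate d point) s) (Vec.lookup-replicate j point))) (off j j≢i)

  -- [0,2] = [0,1] ∪ [1,2] and {1} = [0,1] ∩ [1,2]
  axis-cut : ∀ i → axis i (0ℤ , 2) M𝓑.+ axis i (1ℤ , 0) M𝓑.≈ axis i (0ℤ , 1) M𝓑.+ axis i (1ℤ , 1)
  axis-cut i = pointwise λ w → begin
    value (axis i (0ℤ , 2) M𝓑.+ axis i (1ℤ , 0)) w     ≈⟨ ℂ.+-congˡ (value-⟨⟩ (v (1ℤ , 0)) w) ⟩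
    ℂ.1# ℂ.* 𝟙 (in? w (0ℤ , 2)) ℂ.+ 𝟙 (in? w (1ℤ , 0))  ≈⟨ ℂ.+-congʳ (ℂ.*-identityˡ _) ⟩
    𝟙 (in? w (0ℤ , 2)) ℂ.+ 𝟙 (in? w (1ℤ , 0))           ≈⟨ cut w (in? w (0ℤ , 1)) (in? w (1ℤ , 1)) ⟩
    𝟙 (in? w (0ℤ , 1)) ℂ.+ 𝟙 (in? w (1ℤ , 1))           ≈⟨ ℂ.+-congʳ (ℂ.*-identityˡ _) ⟨
    ℂ.1# ℂ.* 𝟙 (in? w (0ℤ , 1)) ℂ.+ 𝟙 (in? w (1ℤ , 1))  ≈⟨ ℂ.+-congˡ (value-⟨⟩ (v (1ℤ , 1)) w) ⟨
    value (axis i (0ℤ , 1) M𝓑.+ axis i (1ℤ , 1)) w     ∎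
    where
    open SetoidReasoning ℂ.setoid

    v : Interval → Vec Interval d
    v s = replicate d point [ i ]≔ s

    in? : ∀ w s → Dec (w ∈ᴾ polyhedron (v s))
    in? w s = w ∈ᴾ? polyhedron (v s)

    module _ {w : W} where
      change : ∀ s t → (Within s (lookup w i) → Within t (lookup w i)) →
               w ∈ᴾ polyhedron (v s) → w ∈ᴾ polyhedron (v t)
      change s t f p = Equivalence.from (∈-polyhedron (v t) w) (axis-inside i t w (f (inside-axis i s w q)) (off-axis i s w q))
        where q = Equivalence.to (∈-polyhedron (v s) w) p

      both : w ∈ᴾ polyhedron (v (0ℤ , 1)) → w ∈ᴾ polyhedron (v (1ℤ , 1)) → w ∈ᴾ polyhedron (v (1ℤ , 0))
      both p q = change (0ℤ , 1) (1ℤ , 0)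
        (λ (_ , u) → proj₁ (inside-axis i (1ℤ , 1) w (Equivalence.to (∈-polyhedron (v (1ℤ , 1)) w) q)) , u) p

      either : w ∈ᴾ polyhedron (v (0ℤ , 2)) → w ∈ᴾ polyhedron (v (0ℤ , 1)) ⊎ w ∈ᴾ polyhedron (v (1ℤ , 1))
      either p with total (lookup w i) (fromℤ 1ℤ)
      ... | inj₁ w≤1 = inj₁ (change (0ℤ , 2) (0ℤ , 1) (λ (l , _) → l , w≤1) p)
      ... | inj₂ 1≤w = inj₂ (change (0ℤ , 2) (1ℤ , 1) (λ (_ , u) → 1≤w , u) p)

      0≤1≤2 : fromℤ 0ℤ ≤ᴿ fromℤ 1ℤ × fromℤ 1ℤ ≤ᴿ fromℤ (ℤ.+ 2)
      0≤1≤2 = fromℤ-mono-≤ (ℤ.i≤i+j 0ℤ (ℤ.+ 1)) , fromℤ-mono-≤ (ℤ.i≤i+j 1ℤ (ℤ.+ 1))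

      first⊆ : w ∈ᴾ polyhedron (v (0ℤ , 1)) → w ∈ᴾ polyhedron (v (0ℤ , 2))
      first⊆ = change (0ℤ , 1) (0ℤ , 2) λ (l , u) → l , ≤-trans u (proj₂ 0≤1≤2)

      second⊆ : w ∈ᴾ polyhedron (v (1ℤ , 1)) → w ∈ᴾ polyhedron (v (0ℤ , 2))
      second⊆ = change (1ℤ , 1) (0ℤ , 2) λ (l , u) → ≤-trans (proj₁ 0≤1≤2) l , u

      ∩⊆first : w ∈ᴾ polyhedron (v (1ℤ , 0)) → w ∈ᴾ polyhedron (v (0ℤ , 1))
      ∩⊆first = change (1ℤ , 0) (0ℤ , 1) λ (l , u) → ≤-trans (proj₁ 0≤1≤2) l , u

      ∩⊆second : w ∈ᴾ polyhedron (v (1ℤ , 0)) → w ∈ᴾ polyhedron (v (1ℤ , 1))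
      ∩⊆second = change (1ℤ , 0) (1ℤ , 1) λ (l , u) → l , ≤-trans u (proj₂ 0≤1≤2)

    -- Membership in [0,1] decides the matching. Inside, [0,2] pairs with [0,1] and {1} with [1,2];
    -- outside, {1} and [0,1] both give zero while [0,2] agrees with [1,2], hence the exchange of
    -- the terms.
    cut : ∀ w → Dec (w ∈ᴾ polyhedron (v (0ℤ , 1))) → Dec (w ∈ᴾ polyhedron (v (1ℤ , 1))) →
          𝟙 (in? w (0ℤ , 2)) ℂ.+ 𝟙 (in? w (1ℤ , 0)) ℂ.≈ 𝟙 (in? w (0ℤ , 1)) ℂ.+ 𝟙 (in? w (1ℤ , 1))
    cut w (yes p) _ = ℂ.+-cong
      (ℂ.trans (𝟙-yes (in? w (0ℤ , 2)) (first⊆ p)) (ℂ.sym (𝟙-yes (in? w (0ℤ , 1)) p)))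
      (𝟙-cong (in? w (1ℤ , 0)) (in? w (1ℤ , 1)) ∩⊆second (both p))
    cut w (no ¬p) _ = ℂ.trans (ℂ.+-comm _ _) (ℂ.+-cong
      (𝟙-cong (in? w (1ℤ , 0)) (in? w (0ℤ , 1)) ∩⊆first (⊥-elim ∘ ¬p))
      (𝟙-cong (in? w (0ℤ , 2)) (in? w (1ℤ , 1)) (λ q → [ ⊥-elim ∘ ¬p , id ]′ (either q)) second⊆))

  module _ {S : Pred W 0ℓ} (v : Vec Interval d) (S⇔ : ∀ w → w ∈ S ⇔ w ∈ᴾ polyhedron v) where

    ≈⇒isIndicatorOf : ∀ f → f M𝓑.≈ ⟨ v ⟩ → _isIndicatorOf_ {LatticeBox} f S
    ≈⇒isIndicatorOf f f≈ w =
      (λ w∈ → ℂ.trans (f≈ at w) (ℂ.trans (value-⟨⟩ v w) (𝟙-yes (w ∈ᴾ? polyhedron v) (Equivalence.to (S⇔ w) w∈)))) ,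
      (λ w∉ → ℂ.trans (f≈ at w) (ℂ.trans (value-⟨⟩ v w) (𝟙-no (w ∈ᴾ? polyhedron v) (w∉ ∘ Equivalence.from (S⇔ w)))))

    -- An element of the ring is determined by its values on W. This is what forces any box
    -- homomorphism to agree with φ on the variables.
    isIndicatorOf⇒≈ : ∀ f → _isIndicatorOf_ {LatticeBox} f S → f M𝓑.≈ ⟨ v ⟩
    isIndicatorOf⇒≈ f ind = pointwise λ w → ℂ.trans (by-membership w (w ∈ᴾ? polyhedron v)) (ℂ.sym (value-⟨⟩ v w))
      where
      -- S comes without a decision procedure; the case distinction is borrowed from the polyhedron
      -- with the same points.
      by-membership : ∀ w → Dec (w ∈ᴾ polyhedron v) → value f w ℂ.≈ 𝟙 (w ∈ᴾ? polyhedron v)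
      by-membership w (yes p) = ℂ.trans (proj₁ (ind w) (Equivalence.from (S⇔ w) p)) (ℂ.sym (𝟙-yes (w ∈ᴾ? polyhedron v) p))
      by-membership w (no ¬p) = ℂ.trans (proj₂ (ind w) (¬p ∘ Equivalence.to (S⇔ w))) (ℂ.sym (𝟙-no (w ∈ᴾ? polyhedron v) ¬p))

  private
    within-point : ∀ a {t} → Within (a , 0) t ⇔ t ≈ᴿ fromℤ a
    within-point a {t} = mk⇔
      (λ (l , u) → ≤-antisym (≡.subst (λ b → t ≤ᴿ fromℤ b) (ℤ.+-identityʳ a) u) l)
      (λ e → ≤-reflexive (≈ᴿ-sym e) , ≡.subst (λ b → t ≤ᴿ fromℤ b) (≡.sym (ℤ.+-identityʳ a)) (≤-reflexive e))

    on-axis : ∀ i (s : ℝ) → lookup (0ᵛ {d} [ i ]≔ s) i ≈ᴿ s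
    on-axis i s = ≈ᴿ-reflexive (Vec.lookup∘update i (0ᵛ {d}) s)

    off-axis-0 : ∀ {i j} (s : ℝ) → ¬ j ≡ i → lookup (0ᵛ {d} [ i ]≔ s) j ≈ᴿ 0ᴿ
    off-axis-0 {i} {j} s j≢i = ≈ᴿ-reflexive (≡.trans (Vec.lookup∘update′ j≢i (0ᵛ {d}) s) (Vec.lookup-replicate j 0ᴿ))

    ∈-axis : ∀ i s w → w ∈ᴾ polyhedron (replicate d point [ i ]≔ s) ⇔ ∃ λ t → Within s t × w ≐ 0ᵛ [ i ]≔ t
    ∈-axis i s w = mk⇔
      (λ p → let q = Equivalence.to (∈-polyhedron _ w) p in
        lookup w i , inside-axis i s w q , toPointwise λ j → coordinate q j (j ≟ᶠ i))
      (λ (t , t∈ , e) → Equivalence.from (∈-polyhedron _ w) (axis-inside i s w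
        (within-resp s (≈ᴿ-sym (≈ᴿ-trans (Pointwise.lookup e i) (on-axis i t))) t∈)
        λ j j≢i → Equivalence.from (within-point 0ℤ) (≈ᴿ-trans (Pointwise.lookup e j) (off-axis-0 t j≢i))))
      where
      coordinate : Inside (replicate d point [ i ]≔ s) w → ∀ j → Dec (j ≡ i) → lookup w j ≈ᴿ lookup (0ᵛ {d} [ i ]≔ lookup w i) j
      coordinate q j (yes ≡.refl) = ≈ᴿ-sym (on-axis i (lookup w i))
      coordinate q j (no j≢i) = ≈ᴿ-trans (Equivalence.to (within-point 0ℤ) (off-axis i s w q j j≢i)) (≈ᴿ-sym (off-axis-0 _ j≢i))

    []≔-cong : ∀ i {s t : ℝ} → s ≈ᴿ t → 0ᵛ {d} [ i ]≔ s ≐ 0ᵛ [ i ]≔ t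
    []≔-cong i {s} {t} e = toPointwise λ j → coordinate j (j ≟ᶠ i)
      where
      coordinate : ∀ j → Dec (j ≡ i) → lookup (0ᵛ {d} [ i ]≔ s) j ≈ᴿ lookup (0ᵛ {d} [ i ]≔ t) j
      coordinate j (yes ≡.refl) = ≈ᴿ-trans (on-axis i s) (≈ᴿ-trans e (≈ᴿ-sym (on-axis i t)))
      coordinate j (no j≢i) = ≈ᴿ-trans (off-axis-0 s j≢i) (≈ᴿ-sym (off-axis-0 t j≢i))

  ∈-｛ẽ｝ : ∀ i w → w ∈ ｛ẽ i ｝ ⇔ w ∈ᴾ polyhedron (replicate d point [ i ]≔ (1ℤ , 0))
  ∈-｛ẽ｝ i w = mk⇔
    (λ e → Equivalence.from (∈-axis i _ w) (1ᴿ , Equivalence.from (within-point 1ℤ) ≈ᴿ-refl , e))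
    (λ p → let t , t∈ , e = Equivalence.to (∈-axis i _ w) p
           in Pointwise.trans ≈ᴿ-trans e ([]≔-cong i (Equivalence.to (within-point 1ℤ) t∈)))

  ∈-π[unitCube] : ∀ i w → w ∈ π[unitCube] i ⇔ w ∈ᴾ polyhedron (replicate d point [ i ]≔ (0ℤ , 1))
  ∈-π[unitCube] i w = mk⇔
    (λ (c , c∈ , e) → Equivalence.from (∈-axis i _ w) (lookup c i , c∈ i , e))
    (λ p → let t , t∈ , e = Equivalence.to (∈-axis i _ w) p in
      -- Any point of the cube with i-th coordinate t would serve as preimage; the constant vector
      -- lies in the cube because t lies in [0,1].
      replicate d t ,
      (λ j → ≡.subst (Within (0ℤ , 1)) (≡.sym (Vec.lookup-replicate j t)) t∈) ,
      Pointwise.trans ≈ᴿ-trans e ([]≔-cong i (≈ᴿ-reflexive (≡.sym (Vec.lookup-replicate i t)))))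

  open ClosedIntervals ℂ
  open CellIndicators ℂ

  open AxisCells M𝓑 axis public

  -- The product of cells is expanded into boxes, the value of a box at w splits over the
  -- coordinates, and the sum is folded back into a product. Each coordinate then contributes the
  -- one-axis delta.
  value-cells : ∀ c c′ → value (cells c) (Vec.map sample c′) ℂ.≈ 𝟙 (Vec.≡-dec _≟ᶜ_ c c′)
  value-cells c c′ = begin
    value (cells c) w                                                           ≈⟨ AlgebraSums.∏-∑ M𝓑 g axis at w ⟩
    value (∑ (tensor g) (λ v → ∏ (λ i → axis i (lookup v i)))) w                ≈⟨ value-∑ (tensor g) _ w ⟩
    ∑ᶜ (tensor g) (λ v → value (∏ (λ i → axis i (lookup v i))) w)              ≈⟨ Sums.∑-cong ℂ (tensor g) value-box ⟩
    ∑ᶜ (tensor g) (λ v → ∏ᶜ (λ i → withinᶜ i (lookup v i)))     ≈⟨ ∏-∑ᶜ ⟨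
    ∏ᶜ (λ i → ∑ᶜ (g i) (withinᶜ i))                    ≈⟨ ∏-congᶜ (λ i → coordinate i) ⟩
    ∏ᶜ (λ i → 𝟙 (lookup c i ≟ᶜ lookup c′ i))                                   ≈⟨ ∏-𝟙 (Vec.≡-dec _≟ᶜ_ c c′) (λ i → lookup c i ≟ᶜ lookup c′ i)
                                                                                    (λ { ≡.refl i → ≡.refl }) lookup-injective ⟨
    𝟙 (Vec.≡-dec _≟ᶜ_ c c′)                                                   ∎
    where
    open SetoidReasoning ℂ.setoid
    open Tensors ℂ
    open Products ℂ using (∏-𝟙) renaming (∏ to ∏ᶜ; ∏-cong to ∏-congᶜ)
    w = Vec.map sample c′
    g = λ i → closedIntervals (lookup c i)

    withinᶜ : Fin d → Interval → ℂ.Carrier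
    withinᶜ i s = 𝟙 (within? s (lookup w i))

    value-box : ∀ v → value (∏ (λ i → axis i (lookup v i))) w ℂ.≈ ∏ᶜ (λ i → withinᶜ i (lookup v i))
    value-box v = ℂ.trans (ℂ.sym (⟨⟩-axes v at w)) (ℂ.trans (value-⟨⟩ v w)
      (∏-𝟙 (w ∈ᴾ? polyhedron v) (λ i → within? (lookup v i) (lookup w i))
        (Equivalence.to (∈-polyhedron v w)) (Equivalence.from (∈-polyhedron v w))))

    ∏-∑ᶜ : ∏ᶜ (λ i → ∑ᶜ (g i) (withinᶜ i)) ℂ.≈ ∑ᶜ (tensor g) (λ v → ∏ᶜ (λ i → withinᶜ i (lookup v i)))
    -- The expansion is taken in ℂ as an algebra over itself; its structure map is the identity,
    -- which `List.map-id` removes from the coefficients.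
    ∏-∑ᶜ = ℂ.trans (∏-congᶜ (λ i → ℂ.reflexive (≡.cong (λ f → ∑ᶜ f (withinᶜ i)) (≡.sym (List.map-id (g i))))))
      (ℂ.trans (AlgebraSums.∏-∑ (selfAlgebra ℂ) g withinᶜ)
        (ℂ.reflexive (≡.cong (λ f → ∑ᶜ f (λ v → ∏ᶜ (λ i → withinᶜ i (lookup v i)))) (List.map-id (tensor g)))))

    coordinate : ∀ i → ∑ᶜ (g i) (withinᶜ i) ℂ.≈ 𝟙 (lookup c i ≟ᶜ lookup c′ i)
    coordinate i = ≡.subst (λ t → ∑ᶜ (g i) (λ s → 𝟙 (within? s t)) ℂ.≈ 𝟙 (lookup c i ≟ᶜ lookup c′ i))
      (≡.sym (Vec.lookup-map i sample c′)) (closedIntervals-𝟙 (lookup c i) (lookup c′ i))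

    lookup-injective : (∀ i → lookup c i ≡ lookup c′ i) → c ≡ c′
    lookup-injective e = Pointwise.Pointwise-≡⇒≡ (toPointwise e)

-- The presentation of the Minkowski ring of lattice boxes.

module BoxPresentation (F : CompleteOrderedField) (d : ℕ) where
  open Boxes F d
  open LatticeBoxes F d
  open PolyhedralCombination using (_at_; _≋_)
  -- MinkowskiRings.ℂ F d instead of its reexported copy ℂ: otherwise equal
  -- algebras are not syntactically equal, and are compared by unfolding.
  open LaurentMonomials (MinkowskiRings.ℂ F d) d using (monomial; homomorphism-unique)

  axes : AxisSystem M𝓑 d
  axes = record { axis = axis ; axis-1 = axis-1 ; axis-* = axis-* ; axis-cut = axis-cut }

  open AxisAlgebra {MinkowskiRings.ℂ F d} {d} {Boxes.M𝓑 F d} axes using (φ; φ-homo; φ-x; φ-y; φ-box; φ-kills-ideal; φ-kernel) public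
  private
    module ℂ = CommutativeRing ℂ

  φ-isBoxHomomorphism : IsBoxHomomorphism φ
  φ-isBoxHomomorphism = record
    { isAlgebraHomomorphism = φ-homo
    ; φx = λ i → ≈⇒isIndicatorOf _ (∈-｛ẽ｝ i) (φ (x i)) (φ-x i)
    ; φy = λ i → ≈⇒isIndicatorOf _ (∈-π[unitCube] i) (φ (y i)) (φ-y i)
    }

  φ-unique : ∀ ψ → IsBoxHomomorphism ψ → ∀ p → ψ p M𝓑.≈ φ p
  φ-unique ψ ψ-box = homomorphism-unique {A = Boxes.M𝓑 F d} {ψ} {φ} ψ.isAlgebraHomomorphism φ-homo
    (λ i → M𝓑.trans {ψ (x i)} {axis i (1ℤ , 0)} {φ (x i)}
      (isIndicatorOf⇒≈ _ (∈-｛ẽ｝ i) (ψ (x i)) (ψ.φx i)) (M𝓑.sym {φ (x i)} {axis i (1ℤ , 0)} (φ-x i)))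
    (λ i → M𝓑.trans {ψ (y i)} {axis i (0ℤ , 1)} {φ (y i)}
      (isIndicatorOf⇒≈ _ (∈-π[unitCube] i) (ψ (y i)) (ψ.φy i)) (M𝓑.sym {φ (y i)} {axis i (0ℤ , 1)} (φ-y i)))
    where module ψ = IsBoxHomomorphism ψ-box

  private
    open CommutativeAlgebra polyhedralAlgebra using () renaming
      (trans to ≋-trans; sym to ≋-sym; +-cong to ≋-+-cong; *-cong to ≋-*-cong)
    module φ where
      open IsAlgebraHomomorphism φ-homo public
      open IsRingHomomorphism isRingHomomorphism public

  -- Induction on the way f is generated; the substance is in the boxes. A box is the image of the
  -- monomial whose x-exponents are its lower corner and whose y-exponents are its side lengths.
  generated-image : ∀ {f} → Generated polyhedralAlgebra {Σ (Polyhedra.Polyhedron F d) LatticeBox} (λ (P , _) → indicator P) f →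
                    ∃ λ p → proj₁ (φ p) ≋ f
  generated-image (generator (P , P-box)) =
    let v , P⇔ = latticeBox-polyhedron P-box
        p = monomial (Vec.map proj₁ v , Vec.map (ℤ.+_ ∘ proj₂) v)
        ∏-axes = Products.∏ M𝓑.commutativeRing (λ i → axis i (lookup v i))
    in p , ≋-trans (M𝓑.trans {φ p} {∏-axes} {⟨ v ⟩} (φ-box v) (M𝓑.sym {⟨ v ⟩} {∏-axes} (⟨⟩-axes v)))
                   (≋-sym (indicator-cong P⇔))
  generated-image (scalar k) = Laurent.ι k , φ.ι-homo k
  generated-image (sum s t) =
    let p , p≈ = generated-image s
        q , q≈ = generated-image t
    in p Laurent.+ q , ≋-trans (φ.+-homo p q) (≋-+-cong p≈ q≈)
  generated-image (product {f} {g} s t) =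
    let p , p≈ = generated-image s
        q , q≈ = generated-image t
    in p Laurent.* q , ≋-trans (φ.*-homo p q) (≋-*-cong {proj₁ (φ p)} {f} {proj₁ (φ q)} {g} p≈ q≈)
  generated-image (respects e s) = let p , p≈ = generated-image s in p , ≋-trans p≈ e

  φ-surjective : Surjective Laurent._≈_ M𝓑._≈_ φ
  φ-surjective (f , s) = let p , p≈ = generated-image s in p , λ {z} z≈p → ≋-trans (φ.⟦⟧-cong z≈p) p≈

  -- Evaluating at the sample point of c turns the value of each product of cells into a delta, so
  -- what remains of the sum is the total coefficient of c.
  cells-independent : ∀ g → AlgebraSums.∑ M𝓑 g cells M𝓑.≈ M𝓑.0# →
                      ∀ c → Sums.∑ ℂ g (λ c′ → Indicators.𝟙 ℂ (Vec.≡-dec _≟ᶜ_ c′ c)) ℂ.≈ ℂ.0#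
  cells-independent g g≈0 c = ℂ.trans (Sums.∑-cong ℂ g (λ c′ → ℂ.sym (value-cells c′ c)))
    (ℂ.trans (ℂ.sym (value-∑ g cells w)) (g≈0 at w))
    where w = Vec.map (LatticeIntervals.sample F) c

  φ-kernel-ideal : ∀ p → φ p M𝓑.≈ M𝓑.0# ⇔ Ideal Laurent relation p
  φ-kernel-ideal p = mk⇔ (φ-kernel cells-independent) φ-kills-ideal

  isomorphism = HomomorphismProperties.firstIsomorphism {MinkowskiRings.ℂ F d} {Boxes.Laurent F d} {Boxes.M𝓑 F d} {φ}
    φ-homo (Boxes.relation F d) φ-surjective φ-kernel-ideal

corollary3p13 : (ℝ : CompleteOrderedField) (d : ℕ) → 1 ≤ d →
    let open Boxes ℝ d in
    (∃ λ φ →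
    IsBoxHomomorphism φ ×
    (∀ ψ → IsBoxHomomorphism ψ → ∀ p → ψ p M𝓑.≈ φ p) ×
    Surjective Laurent._≈_ M𝓑._≈_ φ ×
    (∀ p → φ p M𝓑.≈ M𝓑.0# ⇔ Ideal Laurent relation p)) ×
    (M𝓑 ≅ quotient Laurent relation)
corollary3p13 ℝ d _ =
  (φ , φ-isBoxHomomorphism , φ-unique , φ-surjective , φ-kernel-ideal) ,
  -- Rebuilt from its fields: for the pair as a whole, the type checker would
  -- compare all the proofs inside the two copies of the quotient algebra.
  proj₁ isomorphism , record
    { isRingIsomorphism = IsAlgebraIsomorphism.isRingIsomorphism (proj₂ isomorphism)
    ; ι-homo            = IsAlgebraIsomorphism.ι-homo (proj₂ isomorphism)
    }
  where open BoxPresentation ℝ d
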